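{- The decision problem Strong Geodetic (given a graph $G$ and a positive integer $k$, decide whether $G$ has a strong geodetic set $S$ with $|S|\le k$), restricted to co-bipartite graphs $G$, is NP-complete.
   Context: All graphs are finite, simple, undirected and connected. A graph is co-bipartite if its vertex set can be partitioned into two cliques (equivalently, it is the complement of a bipartite graph). A shortest path assignment $I(S)$ of a vertex set $S\subseteq V(G)$ consists of exactly one chosen shortest path of $G$ between $u$ and $v$ for each unordered pair of distinct vertices $u,v\in S$. The set $S$ is a strong geodetic set of $G$ if there is a shortest path assignment $I(S)$ such that every vertex of $V(G)\setminus S$ lies on some path of $I(S)$ (for $|S|\ge 2$ this is the same as $\bigcup_{P\in I(S)}V(P)=V(G)$). -}

module Defs where

open import Data.Bool.Base using (Bool; true; false; T)
open import Data.Fin.Base using (Fin; _<_)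
open import Data.Fin.Subset using (Subset; _∈_; _∉_; ∣_∣; ∁)
open import Data.List.Base as List using (List; []; _∷_; [_]; _++_; length)
open import Data.List.Membership.Propositional using () renaming (_∈_ to _∈ˡ_)
open import Data.List.Relation.Unary.Unique.Propositional using (Unique)
open import Data.Maybe.Base as Maybe using (Maybe; just; nothing)
open import Data.Nat.Base using (ℕ; zero; suc; _+_; _*_; _≤_; NonZero)
open import Data.Nat.Binary.Base using (ℕᵇ; zero; 2[1+_]; 1+[2_]; fromℕ)
open import Data.Product.Base using (Σ; ∃; ∃-syntax; _×_; _,_; proj₁)
open import Data.Vec.Base as Vec using (Vec)
open import Function.Bundles using (_↔_; _⇔_)
open import Relation.Binary.Construct.Closure.ReflexiveTransitive using (Star; ε; _◅_)
open import Relation.Binary.PropositionalEquality.Core using (_≡_; _≢_)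

------------------------------------------------------------------------
-- Turing machines

BitString : Set
BitString = List Bool

-- The tape alphabet is {0, 1, blank}; `nothing` is the blank.
Symbol : Set
Symbol = Maybe Bool

data Move : Set where
  goLeft stay goRight : Move

-- A two-way infinite tape. `left` lists the cells to the left of the head,
-- nearest first; all cells beyond the two lists are blank.
record Tape : Set where
  constructor tape
  field
    left    : List Symbol
    scanned : Symbol
    right   : List Symbol

open Tape public

blankTape : Tape
blankTape = tape [] nothing []

inputTape : BitString → Tape
inputTape []       = blankTape
inputTape (b ∷ bs) = tape [] (just b) (List.map just bs)

moveHead : Move → Tape → Tape
moveHead goLeft  (tape []       a rs)       = tape [] nothing (a ∷ rs)
moveHead goLeft  (tape (l ∷ ls) a rs)       = tape ls l (a ∷ rs)
moveHead stay    t                          = t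
moveHead goRight (tape ls       a [])       = tape (a ∷ ls) nothing []
moveHead goRight (tape ls       a (r ∷ rs)) = tape (a ∷ ls) r rs

writeMove : Symbol × Move → Tape → Tape
writeMove (a , m) t = moveHead m (tape (left t) a (right t))

bitsBeforeBlank : List Symbol → BitString
bitsBeforeBlank (just b ∷ as) = b ∷ bitsBeforeBlank as
bitsBeforeBlank _             = []

-- The string starting at the head and ending before the first blank.
tapeContents : Tape → BitString
tapeContents t = bitsBeforeBlank (scanned t ∷ right t)

-- Deterministic machines with one output tape (the first), `inputs` input
-- tapes and any number of work tapes. All tapes are readable and writable.
-- The machine halts when `δ` returns `nothing`.
record TM (inputs : ℕ) : Set₁ where
  field
    State     : Set
    finite    : ∃[ n ] (State ↔ Fin n)
    start     : State
    workTapes : ℕ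

  tapes : ℕ
  tapes = suc (inputs + workTapes)

  field
    δ : State → Vec Symbol tapes → Maybe (State × Vec (Symbol × Move) tapes)

  Config : Set
  Config = State × Vec Tape tapes

  step : Config → Maybe Config
  step (q , ts) =
    Maybe.map (λ (q′ , as) → q′ , Vec.zipWith writeMove as ts)
              (δ q (Vec.map scanned ts))

  initial : Vec BitString inputs → Config
  initial xs =
    start , blankTape Vec.∷ (Vec.map inputTape xs Vec.++ Vec.replicate workTapes blankTape)

  output : Config → BitString
  output (_ , ts) = tapeContents (Vec.head ts)

  -- `HaltsIn c t d`: started in c, the machine halts in d after exactly t steps.
  data HaltsIn : Config → ℕ → Config → Set where
    halted : ∀ {c} → step c ≡ nothing → HaltsIn c 0 c
    steps  : ∀ {c c′ t d} → step c ≡ just c′ → HaltsIn c′ t d → HaltsIn c (suc t) d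

------------------------------------------------------------------------
-- Polynomial time and NP

-- Coefficients, constant term first.
Polynomial : Set
Polynomial = List ℕ

eval : Polynomial → ℕ → ℕ
eval []      n = 0
eval (a ∷ p) n = a + n * eval p n

PolyTime : ∀ {i} → (Vec BitString i → BitString) → Set₁
PolyTime {i} f =
  Σ (TM i) λ M → let open TM M in
  ∃[ p ] ∀ xs → ∃[ t ] ∃[ c ]
    HaltsIn (initial xs) t c
    × t ≤ eval p (Vec.sum (Vec.map length xs))
    × output c ≡ f xs

Language : Set₁
Language = BitString → Set

-- V is a polynomial-time verifier and y a certificate, accepted when V outputs 1.
InNP : Language → Set₁
InNP L =
  Σ (Vec BitString 2 → BitString) λ V → PolyTime V ×
  ∃[ p ] ∀ x →
    L x ⇔ (∃[ y ] length y ≤ eval p (length x) × V (x Vec.∷ y Vec.∷ Vec.[]) ≡ [ true ])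

-- Polynomial-time many-one reducibility.
infix 4 _≤ₚ_

_≤ₚ_ : Language → Language → Set₁
A ≤ₚ B =
  Σ (BitString → BitString) λ f →
    PolyTime {1} (λ xs → f (Vec.head xs)) × (∀ x → A x ⇔ B (f x))

NPHard : Language → Set₁
NPHard B = ∀ A → InNP A → A ≤ₚ B

NPComplete : Language → Set₁
NPComplete L = InNP L × NPHard L

record DecisionProblem : Set₁ where
  field
    Instance : Set
    Yes      : Instance → Set
    encode   : Instance → BitString

open DecisionProblem public

languageOf : DecisionProblem → Language
languageOf Π w = ∃[ i ] Yes Π i × w ≡ encode Π i

infixl 5 _restrictedTo_

_restrictedTo_ : (Π : DecisionProblem) → (Instance Π → Set) → DecisionProblem
Π restrictedTo C = record
  { Instance = Σ (Instance Π) C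
  ; Yes      = λ i → Yes Π (proj₁ i)
  ; encode   = λ i → encode Π (proj₁ i)
  }

------------------------------------------------------------------------
-- Graphs

record Graph (n : ℕ) : Set where
  field
    adjacent    : Fin n → Fin n → Bool
    symmetric   : ∀ u v → adjacent u v ≡ adjacent v u
    irreflexive : ∀ v → adjacent v v ≡ false

open Graph public

module _ {n : ℕ} (G : Graph n) where

  Adj : Fin n → Fin n → Set
  Adj u v = T (adjacent G u v)

  Walk : Fin n → Fin n → Set
  Walk = Star Adj

  walkVertices : ∀ {u v} → Walk u v → List (Fin n)
  walkVertices {u} ε       = [ u ]
  walkVertices {u} (_ ◅ w) = u ∷ walkVertices w

  walkLength : ∀ {u v} → Walk u v → ℕ
  walkLength ε       = 0
  walkLength (_ ◅ w) = suc (walkLength w)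

  record Path (u v : Fin n) : Set where
    field
      walk   : Walk u v
      simple : Unique (walkVertices walk)

    vertices : List (Fin n)
    vertices = walkVertices walk

    edgeCount : ℕ
    edgeCount = walkLength walk

  open Path

  IsShortest : ∀ {u v} → Path u v → Set
  IsShortest {u} {v} P = (Q : Path u v) → edgeCount P ≤ edgeCount Q

  ShortestPath : Fin n → Fin n → Set
  ShortestPath u v = Σ (Path u v) IsShortest

  Connected : Set
  Connected = ∀ u v → Path u v

  IsClique : Subset n → Set
  IsClique A = ∀ {u v} → u ∈ A → v ∈ A → u ≢ v → Adj u v

  -- Either of the two cliques may be empty.
  CoBipartite : Set
  CoBipartite = ∃[ A ] IsClique A × IsClique (∁ A)

  -- Unordered pairs are represented by u < v. Both _∈_ and _<_ are
  -- propositions, so this chooses exactly one path for each pair.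
  PathAssignment : Subset n → Set
  PathAssignment S = ∀ {u v} → u ∈ S → v ∈ S → u < v → ShortestPath u v

  LiesOn : ∀ {S} → Fin n → PathAssignment S → Set
  LiesOn {S} w I =
    ∃[ u ] ∃[ v ] Σ (u ∈ S) λ u∈S → Σ (v ∈ S) λ v∈S → Σ (u < v) λ u<v →
      w ∈ˡ vertices (proj₁ (I u∈S v∈S u<v))

  IsStrongGeodetic : Subset n → Set
  IsStrongGeodetic S =
    Σ (PathAssignment S) λ I → ∀ w → w ∉ S → LiesOn {S} w I

------------------------------------------------------------------------
-- The decision problem

record StrongGeodeticInstance : Set where
  field
    order     : ℕ
    graph     : Graph order
    bound     : ℕ
    nonempty  : NonZero order
    connected : Connected graph
    positive  : NonZero bound

open StrongGeodeticInstance public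

-- Bijective base 2, least significant digit first: digit 1 is `false` and
-- digit 2 is `true`. Equivalently, the usual binary expansion of k + 1
-- without its leading 1.
binaryDigits : ℕᵇ → BitString
binaryDigits zero     = []
binaryDigits 2[1+ x ] = true ∷ binaryDigits x
binaryDigits 1+[2 x ] = false ∷ binaryDigits x

-- 1ⁿ0, then the n × n adjacency matrix row by row, then k in binary.
encodeGraphNumber : ∀ {n} → Graph n → ℕ → BitString
encodeGraphNumber {n} G k =
  List.replicate n true ++ false ∷
  List.concat (List.tabulate λ u → List.tabulate (adjacent G u)) ++
  binaryDigits (fromℕ k)

StrongGeodetic : DecisionProblem
StrongGeodetic = record
  { Instance = StrongGeodeticInstance
  ; Yes      = λ i → ∃[ S ] IsStrongGeodetic (graph i) S × ∣ S ∣ ≤ bound i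
  ; encode   = λ i → encodeGraphNumber (graph i) (bound i)
  }

{-# OPTIONS --safe #-}

-- Membership. A certificate lists the two cliques, the set S, and for every
-- pair of vertices the vertices that its path is to cover. The graph has
-- diameter at most 3, so a shortest path is determined by at most two interior
-- vertices and the certificate is checked by a formula with quantifiers bounded
-- by the input length. Such formulas, over numbers kept in unary, are compiled
-- to Turing machines through programs on stacks; a stack is the part of a tape
-- from the head to the first blank.
--
-- Hardness. Let a verifier for the given language run for at most T steps, and
-- write its tapes relative to the head, so that the tape moves and the head
-- stays at a fixed position. The contents of a cell then depend only on four
-- cells one step earlier, and acceptance becomes a choice of one value per cell
-- such that every clause of a list meets a chosen value: a clause says that one of
-- these four cells has another value or this cell has the right one. The
-- element clause, that the cell has some value, is added for every cell.
--
-- The graph has the cliques X ∪ C ∪ H and Z ∪ S. A clause c_i is joined to the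
-- choices s_j that meet it, h_i is joined to z_i, and x_i to nothing in the
-- other clique. A clause c_0 met by every choice and a choice s_0 that meets no
-- proper clause are added. Given a solution, take all x_i, all z_i, c_0 and the
-- chosen s_j: the pairs (x_i , s_j) cover the clauses, (x_i , z_i) covers h_i
-- and (c_0 , z_j) covers s_j. Conversely all distances are at most 2, so a
-- strong geodetic set contains every x_i, one of z_i and h_i, a vertex on
-- account of s_0, and for every cell one of its values or its element
-- clause. If it is no larger than that, it contains nothing else; every other
-- clause is then covered by a path to a chosen value that meets it.
module Submission where

open import Data.Product.Base using (_,_)

open import Defs

-- The reduction is written in the same formula language as the verifier: the adjacency matrix is
-- printed by nested loops around one formula for each pair of vertex classes, so no second machine
-- has to be built. All five classes are therefore indexed by one common set of triples, with
-- padding where a class has fewer proper members. Unary numbers clash with the bound k, which is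
-- given in binary and may be exponential; it is never evaluated by the verifier, only subtracted
-- digit by digit from the size of the set.
--
-- In the graph a pair of chosen vertices fixes a single path, and that path has at most one
-- interior vertex, so every vertex to be covered needs a pair of its own. This is why there are as
-- many x_i as clauses and as many z_j as choices. The h_i give each z_i a common neighbour with
-- every x_j, which keeps all distances at most 2, and still leave z_i only one neighbour in the
-- other clique, so that z_i or h_i is forced into the set.

-- Polynomials and monotone functions below them

module Bounds where

  open import Data.List.Base using ([]; _∷_)
  open import Data.Nat.Base
  open import Data.Nat.Properties
  open import Data.Nat.Tactic.RingSolver using (solve-∀)
  open import Function.Base using (id)
  open import Relation.Binary.PropositionalEquality

  eval-mono : ∀ p {m n} → m ≤ n → eval p m ≤ eval p n
  eval-mono []      _   = z≤n
  eval-mono (a ∷ p) m≤n = +-monoʳ-≤ a (*-mono-≤ m≤n (eval-mono p m≤n))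

  infixl 6 _+ₚ_
  infixl 7 _*ₚ_

  _+ₚ_ _*ₚ_ _∘ₚ_ : Polynomial → Polynomial → Polynomial
  []      +ₚ q       = q
  (a ∷ p) +ₚ []      = a ∷ p
  (a ∷ p) +ₚ (b ∷ q) = (a + b) ∷ (p +ₚ q)

  scale : ℕ → Polynomial → Polynomial
  scale a []      = []
  scale a (b ∷ q) = (a * b) ∷ scale a q

  []      *ₚ q = []
  (a ∷ p) *ₚ q = scale a q +ₚ (0 ∷ p *ₚ q)

  []      ∘ₚ q = []
  (a ∷ p) ∘ₚ q = (a ∷ []) +ₚ q *ₚ (p ∘ₚ q)

  eval-+ₚ : ∀ p q n → eval (p +ₚ q) n ≡ eval p n + eval q n
  eval-+ₚ []      q       n = refl
  eval-+ₚ (a ∷ p) []      n = sym (+-identityʳ _)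
  eval-+ₚ (a ∷ p) (b ∷ q) n = trans (cong (λ e → a + b + n * e) (eval-+ₚ p q n))
                                    (lemma a b n (eval p n) (eval q n))
    where
    lemma : ∀ a b n x y → a + b + n * (x + y) ≡ a + n * x + (b + n * y)
    lemma = solve-∀

  eval-scale : ∀ a q n → eval (scale a q) n ≡ a * eval q n
  eval-scale a []      n = sym (*-zeroʳ a)
  eval-scale a (b ∷ q) n = trans (cong (λ e → a * b + n * e) (eval-scale a q n))
                                 (lemma a b n (eval q n))
    where
    lemma : ∀ a b n x → a * b + n * (a * x) ≡ a * (b + n * x)
    lemma = solve-∀

  eval-*ₚ : ∀ p q n → eval (p *ₚ q) n ≡ eval p n * eval q n
  eval-*ₚ []      q n = refl
  eval-*ₚ (a ∷ p) q n = trans (eval-+ₚ (scale a q) (0 ∷ p *ₚ q) n)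
    (trans (cong₂ (λ x y → x + n * y) (eval-scale a q n) (eval-*ₚ p q n))
           (lemma a n (eval p n) (eval q n)))
    where
    lemma : ∀ a n x y → a * y + n * (x * y) ≡ (a + n * x) * y
    lemma = solve-∀

  eval-∘ₚ : ∀ p q n → eval (p ∘ₚ q) n ≡ eval p (eval q n)
  eval-∘ₚ []      q n = refl
  eval-∘ₚ (a ∷ p) q n = trans (eval-+ₚ (a ∷ []) (q *ₚ (p ∘ₚ q)) n)
    (cong₂ _+_ (trans (cong (a +_) (*-zeroʳ n)) (+-identityʳ a))
               (trans (eval-*ₚ q (p ∘ₚ q) n) (cong (eval q n *_) (eval-∘ₚ p q n))))

  -- A monotone function together with a polynomial above it. The operations
  -- below compute pointwise on `fn`, which keeps cost bounds in readable form.
  record Bound : Set where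
    field
      fn   : ℕ → ℕ
      mono : ∀ {m n} → m ≤ n → fn m ≤ fn n
      poly : Polynomial
      fn≤  : ∀ n → fn n ≤ eval poly n

  open Bound public

  const-bound : ℕ → Bound
  const-bound c = record
    { fn = λ _ → c ; mono = λ _ → ≤-refl ; poly = c ∷ [] ; fn≤ = λ n → m≤m+n c _ }

  id-bound : Bound
  id-bound = record
    { fn = id ; mono = id ; poly = 0 ∷ 1 ∷ []
    ; fn≤ = λ n → ≤-reflexive (sym (trans (cong (λ z → n * (1 + z)) (*-zeroʳ n)) (*-identityʳ n))) }

  infixl 6 _⊞_
  infixl 7 _⊠_
  infixr 9 _⊚_

  _⊞_ _⊠_ _⊚_ : Bound → Bound → Bound
  f ⊞ g = record
    { fn   = λ n → fn f n + fn g n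
    ; mono = λ m≤n → +-mono-≤ (mono f m≤n) (mono g m≤n)
    ; poly = poly f +ₚ poly g
    ; fn≤  = λ n → ≤-trans (+-mono-≤ (fn≤ f n) (fn≤ g n)) (≤-reflexive (sym (eval-+ₚ (poly f) (poly g) n))) }
  f ⊠ g = record
    { fn   = λ n → fn f n * fn g n
    ; mono = λ m≤n → *-mono-≤ (mono f m≤n) (mono g m≤n)
    ; poly = poly f *ₚ poly g
    ; fn≤  = λ n → ≤-trans (*-mono-≤ (fn≤ f n) (fn≤ g n)) (≤-reflexive (sym (eval-*ₚ (poly f) (poly g) n))) }
  f ⊚ g = record
    { fn   = λ n → fn f (fn g n)
    ; mono = λ m≤n → mono f (mono g m≤n)
    ; poly = poly f ∘ₚ poly g
    ; fn≤  = λ n → ≤-trans (fn≤ f (fn g n))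
                   (≤-trans (eval-mono (poly f) (fn≤ g n)) (≤-reflexive (sym (eval-∘ₚ (poly f) (poly g) n)))) }

-- Stack programs and their simulation by Turing machines

module StackPrograms where

  open import Data.Bool.Base using (Bool; true; false)
  open import Data.Empty using (⊥-elim)
  open import Data.Fin.Base as Fin using (Fin; zero; suc; toℕ)
  open import Data.Fin.Properties as Fin using (1↔⊤; +↔⊎; toℕ<n; toℕ-injective)
  open import Data.List.Base as List using ([]; _∷_; length)
  open import Data.Maybe.Base using (Maybe; just; nothing; maybe)
  open import Data.Nat.Base
  open import Data.Nat.Properties
  open import Data.Product.Base using (∃-syntax; _×_; _,_; proj₁; proj₂)
  open import Data.Sum.Base using (_⊎_; inj₁; inj₂)
  open import Data.Sum.Function.Propositional using (_⊎-↔_)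
  open import Data.Unit.Base using (⊤; tt)
  open import Data.Vec.Base as Vec using (Vec; []; _∷_; lookup; updateAt; _[_]≔_)
  open import Data.Vec.Properties using (lookup∘updateAt; lookup∘updateAt′)
  open import Function.Base using (_∘_)
  open import Function.Bundles using (_↔_)
  open import Function.Construct.Composition using (_↔-∘_)
  open import Function.Construct.Symmetry using (↔-sym)
  open import Relation.Nullary using (yes; no)
  open import Relation.Binary.PropositionalEquality

  open Bounds

  Store : ℕ → Set
  Store = Vec BitString

  -- Programs over n stacks of bits, the stacks being tape contents: popping moves
  -- the head right and pushing moves it left and writes. `while i p` pops stack i
  -- until it is empty and runs p b after popping b; `branch` pops at most once;
  -- `new` allocates a stack that is empty before and after.
  infixr 5 _⨾_

  data Prog : ℕ → Set where
    skip   : ∀ {n} → Prog n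
    push   : ∀ {n} → Bool → Fin n → Prog n
    _⨾_    : ∀ {n} → Prog n → Prog n → Prog n
    branch : ∀ {n} → Fin n → Prog n → (Bool → Prog n) → Prog n
    while  : ∀ {n} → Fin n → (Bool → Prog n) → Prog n
    new    : ∀ {n} → Prog (suc n) → Prog n

  infix 4 _⊢_⇓[_]_

  -- Big-step runs. By `relax` the time index is only an upper bound, so that branches of unequal
  -- length can be given a common cost.
  data _⊢_⇓[_]_ : ∀ {n} → Prog n → Store n → ℕ → Store n → Set where
    relax    : ∀ {n} {p : Prog n} {σ σ′ t t′} → t ≤ t′ → p ⊢ σ ⇓[ t ] σ′ → p ⊢ σ ⇓[ t′ ] σ′
    skip     : ∀ {n} {σ : Store n} → skip ⊢ σ ⇓[ 1 ] σ
    -- Two steps: a transition writes before it moves, so the first one moves left and the second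
    -- one writes `b`.
    push     : ∀ {n b i} {σ : Store n} → push b i ⊢ σ ⇓[ 2 ] updateAt σ i (b ∷_)
    _⨾_      : ∀ {n} {p q : Prog n} {σ σ′ σ″ t u} →
               p ⊢ σ ⇓[ t ] σ′ → q ⊢ σ′ ⇓[ u ] σ″ → p ⨾ q ⊢ σ ⇓[ t + u ] σ″
    branch[] : ∀ {n i e p} {σ σ′ : Store n} {t} →
               lookup σ i ≡ [] → e ⊢ σ ⇓[ t ] σ′ → branch i e p ⊢ σ ⇓[ suc t ] σ′
    branch∷  : ∀ {n i e p} {σ σ′ : Store n} {b bs t} →
               lookup σ i ≡ b ∷ bs → p b ⊢ σ [ i ]≔ bs ⇓[ t ] σ′ → branch i e p ⊢ σ ⇓[ suc t ] σ′
    while[]  : ∀ {n i p} {σ : Store n} → lookup σ i ≡ [] → while i p ⊢ σ ⇓[ 1 ] σ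
    while∷   : ∀ {n i p} {σ σ′ σ″ : Store n} {b bs t u} →
               lookup σ i ≡ b ∷ bs → p b ⊢ σ [ i ]≔ bs ⇓[ t ] σ′ → while i p ⊢ σ′ ⇓[ u ] σ″ →
               while i p ⊢ σ ⇓[ suc (t + u) ] σ″
    new      : ∀ {n} {p : Prog (suc n)} {σ σ′ t} → p ⊢ [] ∷ σ ⇓[ t ] [] ∷ σ′ → new p ⊢ σ ⇓[ t ] σ′

  -- The number of work tapes. Only nested allocations add up, hence the maxima: `new` hands its
  -- tape back empty, and the next part can use it again.
  extra : ∀ {n} → Prog n → ℕ
  extra skip           = 0
  extra (push _ _)     = 0
  extra (p ⨾ q)        = extra p ⊔ extra q
  extra (branch _ e p) = extra e ⊔ (extra (p false) ⊔ extra (p true))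
  extra (while _ p)    = extra (p false) ⊔ extra (p true)
  extra (new p)        = suc (extra p)

  St : ∀ {n} → Prog n → Set
  St skip           = ⊤
  St (push _ _)     = ⊤ ⊎ ⊤
  St (p ⨾ q)        = St p ⊎ St q
  St (branch _ e p) = ⊤ ⊎ (St e ⊎ (St (p false) ⊎ St (p true)))
  St (while _ p)    = ⊤ ⊎ (St (p false) ⊎ St (p true))
  St (new p)        = St p

  Finite : Set → Set
  Finite A = ∃[ n ] (A ↔ Fin n)

  ⊤-finite : Finite ⊤
  ⊤-finite = 1 , ↔-sym 1↔⊤

  ⊎-finite : ∀ {A B} → Finite A → Finite B → Finite (A ⊎ B)
  ⊎-finite (_ , f) (_ , g) = _ , (↔-sym +↔⊎ ↔-∘ (f ⊎-↔ g))

  St-finite : ∀ {n} (p : Prog n) → Finite (St p)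
  St-finite skip           = ⊤-finite
  St-finite (push _ _)     = ⊎-finite ⊤-finite ⊤-finite
  St-finite (p ⨾ q)        = ⊎-finite (St-finite p) (St-finite q)
  St-finite (branch _ e p) = ⊎-finite ⊤-finite (⊎-finite (St-finite e)
                               (⊎-finite (St-finite (p false)) (St-finite (p true))))
  St-finite (while _ p)    = ⊎-finite ⊤-finite (⊎-finite (St-finite (p false)) (St-finite (p true)))
  St-finite (new p)        = St-finite p

  entry : ∀ {n} (p : Prog n) → St p
  entry skip           = tt
  entry (push _ _)     = inj₁ tt
  entry (p ⨾ _)        = inj₁ (entry p)
  entry (branch _ _ _) = inj₁ tt
  entry (while _ _)    = inj₁ tt
  entry (new p)        = entry p

  entry-of : ∀ {n} (p : Bool → Prog n) → Bool → St (p false) ⊎ St (p true)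
  entry-of p false = inj₁ (entry (p false))
  entry-of p true  = inj₂ (entry (p true))

  -- Tapes are addressed by plain numbers, with a blank as default, so that the transition function
  -- needs no proof that a tape exists; `Placement` supplies that proof later.
  look : ∀ {m} → Vec Symbol m → ℕ → Symbol
  look []       _       = nothing
  look (s ∷ _)  zero    = s
  look (_ ∷ ss) (suc k) = look ss k

  Act : ℕ → Set
  Act m = Vec (Symbol × Move) m

  idle : ∀ {m} → Vec Symbol m → Act m
  idle []       = []
  idle (s ∷ ss) = (s , stay) ∷ idle ss

  only : ∀ {m} → ℕ → Symbol × Move → Vec Symbol m → Act m
  only _       _ []       = []
  only zero    a (_ ∷ ss) = a ∷ idle ss
  only (suc k) a (s ∷ ss) = (s , stay) ∷ only k a ss

  -- A new stack becomes number 0 and renumbers the others, but the tapes stay where they are: the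
  -- new stack gets tape `n`, the first one beyond the `n` tapes in use.
  extend : ∀ {n} → (Fin n → ℕ) → Fin (suc n) → ℕ
  extend {n} ρ zero    = n
  extend     ρ (suc i) = ρ i

  module _ {m : ℕ} where

    -- The transition function of p, whose stack i is tape ρ i; in the first
    -- component `nothing` means that p has finished.
    δ-of : ∀ {n} (p : Prog n) → (Fin n → ℕ) → St p → Vec Symbol m → Maybe (St p) × Act m
    δ-of skip           ρ _ o = nothing , idle o
    δ-of (push b i)     ρ (inj₁ _) o = just (inj₂ tt) , only (ρ i) (look o (ρ i) , goLeft) o
    δ-of (push b i)     ρ (inj₂ _) o = nothing , only (ρ i) (just b , stay) o
    δ-of (p ⨾ q)        ρ (inj₁ s) o =
      let s′ , a = δ-of p ρ s o in maybe (just ∘ inj₁) (just (inj₂ (entry q))) s′ , a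
    δ-of (p ⨾ q)        ρ (inj₂ s) o =
      let s′ , a = δ-of q ρ s o in maybe (just ∘ inj₂) nothing s′ , a
    δ-of (branch i e p) ρ (inj₁ _) o =
      maybe (λ b → just (inj₂ (inj₂ (entry-of p b))) , only (ρ i) (nothing , goRight) o)
            (just (inj₂ (inj₁ (entry e))) , idle o) (look o (ρ i))
    δ-of (branch i e p) ρ (inj₂ (inj₁ s)) o =
      let s′ , a = δ-of e ρ s o in maybe (just ∘ inj₂ ∘ inj₁) nothing s′ , a
    δ-of (branch i e p) ρ (inj₂ (inj₂ (inj₁ s))) o =
      let s′ , a = δ-of (p false) ρ s o in maybe (just ∘ inj₂ ∘ inj₂ ∘ inj₁) nothing s′ , a
    δ-of (branch i e p) ρ (inj₂ (inj₂ (inj₂ s))) o =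
      let s′ , a = δ-of (p true) ρ s o in maybe (just ∘ inj₂ ∘ inj₂ ∘ inj₂) nothing s′ , a
    δ-of (while i p)    ρ (inj₁ _) o =
      maybe (λ b → just (inj₂ (entry-of p b)) , only (ρ i) (nothing , goRight) o)
            (nothing , idle o) (look o (ρ i))
    δ-of (while i p)    ρ (inj₂ (inj₁ s)) o =
      let s′ , a = δ-of (p false) ρ s o in maybe (just ∘ inj₂ ∘ inj₁) (just (inj₁ tt)) s′ , a
    δ-of (while i p)    ρ (inj₂ (inj₂ s)) o =
      let s′ , a = δ-of (p true) ρ s o in maybe (just ∘ inj₂ ∘ inj₂) (just (inj₁ tt)) s′ , a
    δ-of (new p)        ρ s o = δ-of p (extend ρ) s o

    data Exec {S : Set} (δ : S → Vec Symbol m → Maybe S × Act m) :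
              Maybe S → Vec Tape m → ℕ → Vec Tape m → Set where
      done : ∀ {ts} → Exec δ nothing ts 0 ts
      go   : ∀ {s s′ as ts ts′ ts″ t} → δ s (Vec.map scanned ts) ≡ (s′ , as) →
             Vec.zipWith writeMove as ts ≡ ts′ → Exec δ s′ ts′ t ts″ → Exec δ (just s) ts (suc t) ts″

    -- A run of a part inside a whole: `f` injects the states of the part, and `k` is where the
    -- whole goes on afterwards. Leaving the part costs no step of its own, because its last
    -- transition already leads to `k`.
    embed : ∀ {S S′ : Set} {δ : S → Vec Symbol m → Maybe S × Act m}
              {δ′ : S′ → Vec Symbol m → Maybe S′ × Act m} (f : S → S′) (k : Maybe S′) →
            (∀ s o → δ′ (f s) o ≡ (maybe (just ∘ f) k (proj₁ (δ s o)) , proj₂ (δ s o))) →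
            ∀ {s ts t ts′ u ts″} → Exec δ s ts t ts′ → Exec δ′ k ts′ u ts″ →
            Exec δ′ (maybe (just ∘ f) k s) ts (t + u) ts″
    embed f k h done         e′ = e′
    embed {δ = δ} f k h (go {s} {ts = ts} eq w e) e′ =
      go (trans (h s (Vec.map scanned ts)) (cong (λ (s′ , a) → maybe (just ∘ f) k s′ , a) eq)) w
         (embed f k h e e′)

  modify : ∀ {m} → ℕ → (Tape → Tape) → Vec Tape m → Vec Tape m
  modify _       f []       = []
  modify zero    f (t ∷ ts) = f t ∷ ts
  modify (suc k) f (t ∷ ts) = t ∷ modify k f ts

  zipWith-idle : ∀ {m} (ts : Vec Tape m) → Vec.zipWith writeMove (idle (Vec.map scanned ts)) ts ≡ ts
  zipWith-idle []       = refl
  zipWith-idle (t ∷ ts) = cong (t ∷_) (zipWith-idle ts)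

  zipWith-only : ∀ {m} k a (ts : Vec Tape m) →
                 Vec.zipWith writeMove (only k a (Vec.map scanned ts)) ts ≡ modify k (writeMove a) ts
  zipWith-only _       a []       = refl
  zipWith-only zero    a (t ∷ ts) = cong (writeMove a t ∷_) (zipWith-idle ts)
  zipWith-only (suc k) a (t ∷ ts) = cong (t ∷_) (zipWith-only k a ts)

  contents : ∀ {m} → Vec Tape m → ℕ → BitString
  contents []       _       = []
  contents (t ∷ _)  zero    = tapeContents t
  contents (_ ∷ ts) (suc k) = contents ts k

  look-[] : ∀ {m} (ts : Vec Tape m) k → contents ts k ≡ [] → look (Vec.map scanned ts) k ≡ nothing
  look-[] []                     _       _ = refl
  look-[] (tape _ nothing _ ∷ _) zero    _ = refl
  look-[] (_ ∷ ts)               (suc k) e = look-[] ts k e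

  look-∷ : ∀ {m} (ts : Vec Tape m) k {b bs} → contents ts k ≡ b ∷ bs →
           look (Vec.map scanned ts) k ≡ just b
  look-∷ (tape _ (just _) _ ∷ _) zero    refl = refl
  look-∷ (_ ∷ ts)                (suc k) e    = look-∷ ts k e

  contents-modify-≢ : ∀ {m} k f (ts : Vec Tape m) {j} → j ≢ k → contents (modify k f ts) j ≡ contents ts j
  contents-modify-≢ _       f []       _ = refl
  contents-modify-≢ zero    f (t ∷ ts) {zero}  j≢k = ⊥-elim (j≢k refl)
  contents-modify-≢ zero    f (t ∷ ts) {suc j} j≢k = refl
  contents-modify-≢ (suc k) f (t ∷ ts) {zero}  j≢k = refl
  contents-modify-≢ (suc k) f (t ∷ ts) {suc j} j≢k = contents-modify-≢ k f ts (j≢k ∘ cong suc)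

  contents-pop : ∀ {m} k s (ts : Vec Tape m) {b bs} → contents ts k ≡ b ∷ bs →
                 contents (modify k (writeMove (s , goRight)) ts) k ≡ bs
  contents-pop zero    s (tape _ (just _) []      ∷ _) refl = refl
  contents-pop zero    s (tape _ (just _) (_ ∷ _) ∷ _) refl = refl
  contents-pop (suc k) s (_ ∷ ts)                      e    = contents-pop k s ts e

  contents-push : ∀ {m} k b (ts : Vec Tape m) → k < m →
    contents (modify k (writeMove (just b , stay))
               (modify k (writeMove (look (Vec.map scanned ts) k , goLeft)) ts)) k ≡ b ∷ contents ts k
  contents-push zero    b (tape [] _ _      ∷ _) _   = refl
  contents-push zero    b (tape (_ ∷ _) _ _ ∷ _) _   = refl
  contents-push (suc k) b (_ ∷ ts)           k<m = contents-push k b ts (s≤s⁻¹ k<m)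

  module Simulation {m : ℕ} where

    record Placement {n} (ρ : Fin n → ℕ) : Set where
      field
        below     : ∀ i → ρ i < n
        injective : ∀ {i j} → ρ i ≡ ρ j → i ≡ j
    open Placement

    extend-placement : ∀ {n} {ρ : Fin n → ℕ} → Placement ρ → Placement (extend ρ)
    below     (extend-placement P) zero    = ≤-refl
    below     (extend-placement P) (suc i) = m≤n⇒m≤1+n (below P i)
    injective (extend-placement P) {zero}  {zero}  _ = refl
    injective (extend-placement P) {zero}  {suc j} e = ⊥-elim (<-irrefl (sym e) (below P j))
    injective (extend-placement P) {suc i} {zero}  e = ⊥-elim (<-irrefl e (below P i))
    injective (extend-placement P) {suc i} {suc j} e = cong suc (injective P e)

    -- The tapes from `n` on are required to be empty, so that `new` can hand one out without
    -- initialising it.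
    record Holds {n} (ρ : Fin n → ℕ) (σ : Store n) (ts : Vec Tape m) : Set where
      field
        used   : ∀ i → contents ts (ρ i) ≡ lookup σ i
        unused : ∀ j → n ≤ j → contents ts j ≡ []
    open Holds

    holds-new : ∀ {n} {ρ : Fin n → ℕ} {σ ts} → Holds ρ σ ts → Holds (extend ρ) ([] ∷ σ) ts
    used   (holds-new H) zero    = unused H _ ≤-refl
    used   (holds-new H) (suc i) = used H i
    unused (holds-new H) j n<j   = unused H j (<⇒≤ n<j)

    holds-drop : ∀ {n} {ρ : Fin n → ℕ} {σ ts} → Holds (extend ρ) ([] ∷ σ) ts → Holds ρ σ ts
    used   (holds-drop H) i = used H (suc i)
    unused (holds-drop {n} H) j n≤j with n ≟ j
    ... | yes refl = used H zero
    ... | no  n≢j  = unused H j (≤∧≢⇒< n≤j n≢j)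

    holds-change : ∀ {n} {ρ : Fin n → ℕ} {σ ts} i f {ts′} → Placement ρ → Holds ρ σ ts →
                   contents ts′ (ρ i) ≡ f (lookup σ i) → (∀ {j} → j ≢ ρ i → contents ts′ j ≡ contents ts j) →
                   Holds ρ (updateAt σ i f) ts′
    used   (holds-change {σ = σ} i f P H here there) j with i Fin.≟ j
    ... | yes refl = trans here (sym (lookup∘updateAt i σ))
    ... | no  i≢j  = trans (there (i≢j ∘ sym ∘ injective P))
                       (trans (used H j) (sym (lookup∘updateAt′ j i (i≢j ∘ sym) σ)))
    unused (holds-change {ρ = ρ} i f P H here there) j n≤j =
      trans (there λ { refl → <-irrefl refl (<-≤-trans (below P i) n≤j) }) (unused H j n≤j)

    holds-pop : ∀ {n} {ρ : Fin n → ℕ} {σ ts b bs} i → Placement ρ → Holds ρ σ ts → lookup σ i ≡ b ∷ bs →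
                Holds ρ (σ [ i ]≔ bs) (modify (ρ i) (writeMove (nothing , goRight)) ts)
    holds-pop {ρ = ρ} {ts = ts} i P H e =
      holds-change i _ P H (contents-pop (ρ i) nothing ts (trans (used H i) e))
        (contents-modify-≢ (ρ i) _ ts)

    module _ {A : Set} where
      maybe-just : ∀ {s} {b : Bool} {n : A} {j : Bool → A} → s ≡ just b → maybe j n s ≡ j b
      maybe-just refl = refl
      maybe-nothing : ∀ {s : Symbol} {n : A} {j : Bool → A} → s ≡ nothing → maybe j n s ≡ n
      maybe-nothing refl = refl

    Simulates : ∀ {n} → Prog n → (Fin n → ℕ) → Store n → Vec Tape m → ℕ → Set
    Simulates p ρ σ′ ts t = ∃[ t′ ] ∃[ ts′ ] t′ ≤ t × Exec (δ-of p ρ) (just (entry p)) ts t′ ts′ × Holds ρ σ′ ts′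

    simulate : ∀ {n} {p : Prog n} {σ t σ′ ρ ts} → p ⊢ σ ⇓[ t ] σ′ → Placement ρ → n + extra p ≤ m →
               Holds ρ σ ts → Simulates p ρ σ′ ts t
    simulate-body : ∀ {n} {p : Bool → Prog n} b {σ t σ′ ρ ts} → p b ⊢ σ ⇓[ t ] σ′ → Placement ρ →
                    n + (extra (p false) ⊔ extra (p true)) ≤ m → Holds ρ σ ts → Simulates (p b) ρ σ′ ts t

    simulate (relax t≤t′ r) P n≤m H =
      let t , ts , t≤ , e , H′ = simulate r P n≤m H in t , ts , ≤-trans t≤ t≤t′ , e , H′
    simulate skip P n≤m H = 1 , _ , ≤-refl , go refl (zipWith-idle _) done , H
    simulate {ρ = ρ} {ts} (push {b = b} {i}) P n≤m H =
      2 , _ , ≤-refl , go refl (zipWith-only (ρ i) _ ts) (go refl (zipWith-only (ρ i) _ _) done) ,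
      holds-change i _ P H
        (trans (contents-push (ρ i) b ts (<-≤-trans (below P i) (≤-trans (m≤m+n _ _) n≤m)))
               (cong (b ∷_) (used H i)))
        (λ j≢ → trans (contents-modify-≢ (ρ i) _ (modify (ρ i) _ ts) j≢) (contents-modify-≢ (ρ i) _ ts j≢))
    simulate {n} (_⨾_ {p = p} {q} r r′) P n≤m H =
      let t , ts₁ , t≤ , e , H₁ = simulate r  P (≤-trans (+-monoʳ-≤ n (m≤m⊔n _ _)) n≤m) H
          u , ts₂ , u≤ , f , H₂ = simulate r′ P (≤-trans (+-monoʳ-≤ n (m≤n⊔m (extra p) _)) n≤m) H₁
      in _ , _ , +-mono-≤ t≤ u≤ ,
         embed inj₁ (just (inj₂ (entry q))) (λ _ _ → refl) e
           (subst (λ k → Exec (δ-of (p ⨾ q) _) (just (inj₂ (entry q))) ts₁ k ts₂) (+-identityʳ u)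
             (embed inj₂ nothing (λ _ _ → refl) f done)) , H₂
    simulate {n} {ρ = ρ} {ts} (branch[] {i = i} {e} {p} eq r) P n≤m H =
      let t , _ , t≤ , x , H₁ = simulate r P (≤-trans (+-monoʳ-≤ n (m≤m⊔n _ _)) n≤m) H
      in _ , _ , s≤s (≤-trans (≤-reflexive (+-identityʳ t)) t≤) ,
         go (maybe-nothing (look-[] ts (ρ i) (trans (used H i) eq))) (zipWith-idle ts)
            (embed (inj₂ ∘ inj₁) nothing (λ _ _ → refl) x done) , H₁
    simulate {n} {ρ = ρ} {ts} (branch∷ {i = i} {e} {p} {b = b} eq r) P n≤m H =
      let t , _ , t≤ , x , H₁ = simulate-body {p = p} b r P
                                  (≤-trans (+-monoʳ-≤ n (m≤n⊔m (extra e) _)) n≤m) (holds-pop i P H eq)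
      in _ , _ , s≤s (≤-trans (≤-reflexive (+-identityʳ t)) t≤) ,
         go (maybe-just (look-∷ ts (ρ i) (trans (used H i) eq))) (zipWith-only (ρ i) _ ts) (inside b x) , H₁
      where
      inside : ∀ b {ts ts′ t} → Exec (δ-of (p b) ρ) (just (entry (p b))) ts t ts′ →
               Exec (δ-of (branch i e p) ρ) (just (inj₂ (inj₂ (entry-of p b)))) ts (t + 0) ts′
      inside false x = embed (inj₂ ∘ inj₂ ∘ inj₁) nothing (λ _ _ → refl) x done
      inside true  x = embed (inj₂ ∘ inj₂ ∘ inj₂) nothing (λ _ _ → refl) x done
    simulate {ρ = ρ} {ts} (while[] {i = i} eq) P n≤m H =
      1 , _ , ≤-refl ,
      go (maybe-nothing (look-[] ts (ρ i) (trans (used H i) eq))) (zipWith-idle ts) done , H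
    simulate {n} {ρ = ρ} {ts} (while∷ {i = i} {p} {b = b} eq r r′) P n≤m H =
      let t , _ , t≤ , x , H₁ = simulate-body {p = p} b r P n≤m (holds-pop i P H eq)
          u , _ , u≤ , y , H₂ = simulate r′ P n≤m H₁
      in _ , _ , s≤s (+-mono-≤ t≤ u≤) ,
         go (maybe-just (look-∷ ts (ρ i) (trans (used H i) eq))) (zipWith-only (ρ i) _ ts) (inside b x y) , H₂
      where
      inside : ∀ b {ts ts′ ts″ t u} → Exec (δ-of (p b) ρ) (just (entry (p b))) ts t ts′ →
               Exec (δ-of (while i p) ρ) (just (inj₁ tt)) ts′ u ts″ →
               Exec (δ-of (while i p) ρ) (just (inj₂ (entry-of p b))) ts (t + u) ts″
      inside false x y = embed (inj₂ ∘ inj₁) (just (inj₁ tt)) (λ _ _ → refl) x y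
      inside true  x y = embed (inj₂ ∘ inj₂) (just (inj₁ tt)) (λ _ _ → refl) x y
    simulate {n} (new {p = p} r) P n≤m H =
      let t , ts′ , t≤ , x , H₁ = simulate r (extend-placement P)
                                   (≤-trans (≤-reflexive (sym (+-suc n (extra p)))) n≤m) (holds-new H)
      in t , ts′ , t≤ , x , holds-drop H₁

    simulate-body {n} {p} false r P n≤m H =
      simulate r P (≤-trans (+-monoʳ-≤ n (m≤m⊔n _ _)) n≤m) H
    simulate-body {n} {p} true r P n≤m H =
      simulate r P (≤-trans (+-monoʳ-≤ n (m≤n⊔m (extra (p false)) _)) n≤m) H

  contents-inputTape : ∀ x → tapeContents (inputTape x) ≡ x
  contents-inputTape []       = refl
  contents-inputTape (b ∷ bs) = cong (b ∷_) (lemma bs)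
    where
    lemma : ∀ bs → bitsBeforeBlank (List.map just bs) ≡ bs
    lemma []       = refl
    lemma (b ∷ bs) = cong (b ∷_) (lemma bs)

  contents-blank : ∀ w j → contents (Vec.replicate w blankTape) j ≡ []
  contents-blank zero    j       = refl
  contents-blank (suc w) zero    = refl
  contents-blank (suc w) (suc j) = contents-blank w j

  contents-inputs : ∀ {i} w (xs : Vec BitString i) j →
    contents (Vec.map inputTape xs Vec.++ Vec.replicate w blankTape) (toℕ j) ≡ lookup xs j
  contents-inputs w (x ∷ xs) zero    = contents-inputTape x
  contents-inputs w (x ∷ xs) (suc j) = contents-inputs w xs j

  contents-work : ∀ {i} w (xs : Vec BitString i) j → i ≤ j →
    contents (Vec.map inputTape xs Vec.++ Vec.replicate w blankTape) j ≡ []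
  contents-work w []       j       _         = contents-blank w j
  contents-work w (x ∷ xs) (suc j) (s≤s i≤j) = contents-work w xs j i≤j

  -- Stack 0 is the output tape and the stacks after it are the input tapes, so `toℕ` is the
  -- placement. The machine gets one state more than the program, in which it halts.
  polyTime : ∀ {i} {f : Vec BitString i → BitString} (p : Prog (suc i)) (B : Bound) →
             (∀ xs → ∃[ σ ] p ⊢ [] ∷ xs ⇓[ fn B (Vec.sum (Vec.map length xs)) ] f xs ∷ σ) → PolyTime f
  polyTime {i} {f} p B run = M , poly B , halts
    where
    M : TM i
    M = record
      { State     = ⊤ ⊎ St p
      ; finite    = ⊎-finite ⊤-finite (St-finite p)
      ; start     = inj₂ (entry p)
      ; workTapes = extra p
      ; δ         = λ { (inj₁ _) o → nothing
                      ; (inj₂ s) o → let s′ , a = δ-of p toℕ s o in just (maybe inj₂ (inj₁ tt) s′ , a) } }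
    open TM M

    open Simulation {tapes}

    halt : ∀ {s ts t ts′} → Exec (δ-of p toℕ) s ts t ts′ →
           HaltsIn (maybe inj₂ (inj₁ tt) s , ts) t (inj₁ tt , ts′)
    halt done = halted refl
    halt (go eq refl e) =
      steps (cong (λ (s′ , a) → just (maybe inj₂ (inj₁ tt) s′ , Vec.zipWith writeMove a _)) eq) (halt e)

    result : ∀ {σ : Store i} {y} (ts : Vec Tape tapes) → Holds toℕ (y ∷ σ) ts → tapeContents (Vec.head ts) ≡ y
    result (t ∷ ts) H = Holds.used H zero

    halts : ∀ xs → ∃[ t ] ∃[ c ] HaltsIn (initial xs) t c
                   × t ≤ eval (poly B) (Vec.sum (Vec.map length xs)) × output c ≡ f xs
    halts xs =
      let σ , r = run xs
          t , ts , t≤ , x , H = simulate r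
            (record { below = toℕ<n ; injective = toℕ-injective }) ≤-refl
            (record { used   = λ { zero → refl ; (suc j) → contents-inputs (extra p) xs j }
                    ; unused = λ { (suc j) (s≤s i≤j) → contents-work (extra p) xs j i≤j } })
      in t , _ , halt x , ≤-trans t≤ (fn≤ B _) , result ts H

-- Bounded terms, formulas and printing programs, and their compilation

module Terms where

  open import Data.Bool.Base using (Bool; true; false; not; _∧_; _∨_)
  open import Data.Fin.Base using (Fin; zero; suc)
  open import Data.Fin.Properties using (suc-injective)
  open import Data.List.Base using (List; []; _∷_; [_]; _++_; _ʳ++_; length; replicate)
  open import Data.List.Properties using (length-replicate; reverse-involutive; length-reverse; ++-assoc; ++-identityʳ)
  open import Data.Nat.Base hiding (_⊔_)
  open import Data.Nat.Properties hiding (suc-injective)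
  open import Data.Nat.Tactic.RingSolver using (solve-∀)
  open import Data.Product.Base using (∃-syntax; _×_; _,_)
  open import Data.Vec.Base as Vec using (Vec; []; _∷_; lookup; updateAt; _[_]≔_)
  open import Data.Vec.Properties
    using (lookup∘update; lookup∘update′; []≔-idempotent; []≔-lookup; updateAt-updateAt)
  open import Function.Base using (_∘_)
  open import Relation.Binary.PropositionalEquality hiding ([_])

  open Bounds
  open StackPrograms

  -- The recursion goes down from the largest index, in the order in which a unary loop counter
  -- passes through its values while it is popped.
  sumTo : ℕ → (ℕ → ℕ) → ℕ
  sumTo zero    f = 0
  sumTo (suc k) f = f k + sumTo k f

  -- A loop with an accumulator that can only decrease. It allows iteration, yet no value exceeds
  -- the initial one, so that values stay polynomial in the input length.
  decTo : ℕ → (ℕ → ℕ → ℕ) → ℕ → ℕ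
  decTo zero    f a = a
  decTo (suc k) f a = decTo k f (a ∸ f k a)

  allTo anyTo : ℕ → (ℕ → Bool) → Bool
  allTo zero    f = true
  allTo (suc k) f = f k ∧ allTo k f
  anyTo zero    f = false
  anyTo (suc k) f = f k ∨ anyTo k f

  concatTo : ∀ {A : Set} → ℕ → (ℕ → List A) → List A
  concatTo zero    f = []
  concatTo (suc k) f = concatTo k f ++ f k

  -- The values of bitAt: 0 is past the end, 1 is false and 2 is true.
  code : Bool → ℕ
  code false = 1
  code true  = 2

  bitAt : BitString → ℕ → ℕ
  bitAt []       _       = 0
  bitAt (b ∷ _)  zero    = code b
  bitAt (_ ∷ bs) (suc k) = bitAt bs k

  indicator : Bool → ℕ
  indicator false = 0
  indicator true  = 1

  infixl 6 _⊕_ _⊖_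

  -- Terms over i input strings with n natural-number variables, number 0 being
  -- the innermost; `dec n a t` binds the accumulator as variable 1.
  data Tm (i : ℕ) : ℕ → Set where
    var     : ∀ {n} → Fin n → Tm i n
    lit     : ∀ {n} → ℕ → Tm i n
    _⊕_ _⊖_ : ∀ {n} → Tm i n → Tm i n → Tm i n
    wk      : ∀ {n} → Tm i n → Tm i (suc n)
    sum     : ∀ {n} → Tm i n → Tm i (suc n) → Tm i n
    dec     : ∀ {n} → Tm i n → Tm i n → Tm i (suc (suc n)) → Tm i n
    bit     : ∀ {n} → Fin i → Tm i n → Tm i n
    len     : ∀ {n} → Fin i → Tm i n

  ⟦_⟧ : ∀ {i n} → Tm i n → Vec BitString i → Vec ℕ n → ℕ
  ⟦ var x ⟧     xs ρ = lookup ρ x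
  ⟦ lit k ⟧     xs ρ = k
  ⟦ a ⊕ b ⟧     xs ρ = ⟦ a ⟧ xs ρ + ⟦ b ⟧ xs ρ
  ⟦ a ⊖ b ⟧     xs ρ = ⟦ a ⟧ xs ρ ∸ ⟦ b ⟧ xs ρ
  ⟦ wk t ⟧      xs ρ = ⟦ t ⟧ xs (Vec.tail ρ)
  ⟦ sum n t ⟧   xs ρ = sumTo (⟦ n ⟧ xs ρ) (λ k → ⟦ t ⟧ xs (k ∷ ρ))
  ⟦ dec n a t ⟧ xs ρ = decTo (⟦ n ⟧ xs ρ) (λ k acc → ⟦ t ⟧ xs (k ∷ acc ∷ ρ)) (⟦ a ⟧ xs ρ)
  ⟦ bit j t ⟧   xs ρ = bitAt (lookup xs j) (⟦ t ⟧ xs ρ)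
  ⟦ len j ⟧     xs ρ = length (lookup xs j)

  unary : ℕ → BitString
  unary k = replicate k true

  drain cancel : ∀ {n} → Fin n → Prog (suc n)
  drain  r = while zero λ _ → push true (suc r)
  cancel r = while zero λ _ → branch (suc r) skip λ _ → skip

  -- Reading a stack destroys it. Its elements are kept, in reverse order, in the scratch stack 0
  -- and put back at the end; the result is collected in stack 1.
  restore count measure : ∀ {n} → Fin n → Prog (suc (suc n))
  restore r = while zero λ b → push b (suc (suc r))
  count   r = while (suc (suc r)) λ b → push true (suc zero) ⨾ push b zero
  measure r = count r ⨾ restore r

  literal : ∀ {n} → ℕ → Prog (suc n)
  literal zero    = skip
  literal (suc k) = literal k ⨾ push true zero

  -- Stack 1 holds the position at first. As `seek` uses it up, `peek` can leave the answer there;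
  -- the elements passed over wait in stack 0.
  seek peek fetch : ∀ {n} → Fin n → Prog (suc (suc n))
  seek  r = while (suc zero) λ _ → branch (suc (suc r)) skip λ b → push b zero
  peek  r = branch (suc (suc r)) skip λ
    { false → push false (suc (suc r)) ⨾ push true (suc zero)
    ; true  → push true (suc (suc r)) ⨾ push true (suc zero) ⨾ push true (suc zero) }
  fetch r = seek r ⨾ peek r ⨾ restore r

  under : ∀ {n m} → (Fin n → Fin m) → Fin (suc n) → Fin (suc m)
  under ρ zero    = zero
  under ρ (suc x) = suc (ρ x)

  -- The variable x is in stack ρ x and the input j in stack ι j; the value is
  -- left in the stack in front of these.
  compile : ∀ {i n m} → Tm i n → (Fin n → Fin m) → (Fin i → Fin m) → Prog (suc m)
  compile (var x)     ρ ι = new (measure (ρ x))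
  compile (lit k)     ρ ι = literal k
  compile (a ⊕ b)     ρ ι = compile a ρ ι ⨾ new (compile b (suc ∘ ρ) (suc ∘ ι) ⨾ drain zero)
  compile (a ⊖ b)     ρ ι = compile a ρ ι ⨾ new (compile b (suc ∘ ρ) (suc ∘ ι) ⨾ cancel zero)
  compile (wk t)      ρ ι = compile t (ρ ∘ suc) ι
  compile (sum n t)   ρ ι = new (compile n (suc ∘ ρ) (suc ∘ ι) ⨾
    while zero λ _ → new (compile t (under (suc ∘ ρ)) (λ j → suc (suc (ι j))) ⨾ drain (suc zero)))
  compile (dec n a t) ρ ι = compile a ρ ι ⨾ new (compile n (suc ∘ ρ) (suc ∘ ι) ⨾
    while zero λ _ → new (compile t (under (under ρ)) (λ j → suc (suc (ι j))) ⨾ cancel (suc zero)))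
  compile (bit j t)   ρ ι = compile t ρ ι ⨾ new (fetch (ι j))
  compile (len j)     ρ ι = new (measure (ι j))

  -- Functions of a common bound `N` on the variables and the input lengths. Under a binder `N`
  -- grows by the bounds on the newly bound variables, hence the compositions with `id-bound ⊞ _`.
  value cost : ∀ {i n} → Tm i n → Bound
  value (var x)     = id-bound
  value (lit k)     = const-bound k
  value (a ⊕ b)     = value a ⊞ value b
  value (a ⊖ b)     = value a
  value (wk t)      = value t
  value (sum n t)   = value n ⊠ (value t ⊚ (id-bound ⊞ value n))
  value (dec n a t) = value a
  value (bit j t)   = const-bound 2
  value (len j)     = id-bound

  -- The cost of a loop: `c` steps for every round and one for the test that ends it.
  linear : ℕ → Bound → Bound
  linear c b = b ⊠ const-bound c ⊞ const-bound 1

  loop-cost : Bound → Bound → Bound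
  loop-cost n c = n ⊠ (const-bound 1 ⊞ c) ⊞ const-bound 1

  cost (var x)     = linear 5 id-bound ⊞ linear 3 id-bound
  cost (lit k)     = const-bound (1 + k * 2)
  cost (a ⊕ b)     = cost a ⊞ (cost b ⊞ linear 3 (value b))
  cost (a ⊖ b)     = cost a ⊞ (cost b ⊞ linear 3 (value b))
  cost (wk t)      = cost t
  cost (sum n t)   = cost n ⊞ loop-cost (value n) ((cost t ⊞ linear 3 (value t)) ⊚ (id-bound ⊞ value n))
  cost (dec n a t) = cost a ⊞ (cost n ⊞ loop-cost (value n)
                       ((cost t ⊞ linear 3 (value t)) ⊚ (id-bound ⊞ (value n ⊞ value a))))
  cost (bit j t)   = cost t ⊞ (linear 4 (value t) ⊞ (const-bound 7 ⊞ linear 3 (value t)))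
  cost (len j)     = linear 5 id-bound ⊞ linear 3 id-bound

  sumTo-≤ : ∀ k f c → (∀ {j} → j < k → f j ≤ c) → sumTo k f ≤ k * c
  sumTo-≤ zero    f c h = z≤n
  sumTo-≤ (suc k) f c h = +-mono-≤ (h ≤-refl) (sumTo-≤ k f c (h ∘ m<n⇒m<1+n))

  decTo-≤ : ∀ k f a → decTo k f a ≤ a
  decTo-≤ zero    f a = ≤-refl
  decTo-≤ (suc k) f a = ≤-trans (decTo-≤ k f (a ∸ f k a)) (m∸n≤m a (f k a))

  bitAt-≤ : ∀ x k → bitAt x k ≤ 2
  bitAt-≤ []          k       = z≤n
  bitAt-≤ (false ∷ x) zero    = s≤s z≤n
  bitAt-≤ (true ∷ x)  zero    = ≤-refl
  bitAt-≤ (_ ∷ x)     (suc k) = bitAt-≤ x k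

  record Small {i n} (xs : Vec BitString i) (ρ : Vec ℕ n) (N : ℕ) : Set where
    field
      vars   : ∀ x → lookup ρ x ≤ N
      inputs : ∀ j → length (lookup xs j) ≤ N
  open Small

  small-∷ : ∀ {i n} {xs : Vec BitString i} {ρ : Vec ℕ n} {N k} c → k ≤ c → Small xs ρ N → Small xs (k ∷ ρ) (N + c)
  vars   (small-∷ {N = N} c k≤c s) zero    = ≤-trans k≤c (m≤n+m c N)
  vars   (small-∷ c k≤c s)         (suc x) = ≤-trans (vars s x) (m≤m+n _ c)
  inputs (small-∷ c k≤c s)         j       = ≤-trans (inputs s j) (m≤m+n _ c)

  small-∷∷ : ∀ {i n} {xs : Vec BitString i} {ρ : Vec ℕ n} {N k l} c d → k ≤ c → l ≤ d → Small xs ρ N →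
             Small xs (k ∷ l ∷ ρ) (N + (c + d))
  vars   (small-∷∷ {N = N} c d k≤c l≤d s) zero          = ≤-trans k≤c (≤-trans (m≤m+n c d) (m≤n+m _ N))
  vars   (small-∷∷ {N = N} c d k≤c l≤d s) (suc zero)    = ≤-trans l≤d (≤-trans (m≤n+m d c) (m≤n+m _ N))
  vars   (small-∷∷ c d k≤c l≤d s)         (suc (suc x)) = ≤-trans (vars s x) (m≤m+n _ _)
  inputs (small-∷∷ c d k≤c l≤d s)         j             = ≤-trans (inputs s j) (m≤m+n _ _)

  small-tail : ∀ {i n} {xs : Vec BitString i} {ρ : Vec ℕ (suc n)} {N} → Small xs ρ N → Small xs (Vec.tail ρ) N
  vars   (small-tail {ρ = _ ∷ _} s) x = vars s (suc x)
  inputs (small-tail s) = inputs s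

  value-≤ : ∀ {i n} (t : Tm i n) {xs ρ N} → Small xs ρ N → ⟦ t ⟧ xs ρ ≤ fn (value t) N
  value-≤ (var x)     s = vars s x
  value-≤ (lit k)     s = ≤-refl
  value-≤ (a ⊕ b)     s = +-mono-≤ (value-≤ a s) (value-≤ b s)
  value-≤ (a ⊖ b)     {xs} {ρ} s = ≤-trans (m∸n≤m (⟦ a ⟧ xs ρ) (⟦ b ⟧ xs ρ)) (value-≤ a s)
  value-≤ (wk t)      s = value-≤ t (small-tail s)
  value-≤ (sum n t)   s = ≤-trans
    (sumTo-≤ _ _ _ λ j<k → value-≤ t (small-∷ (fn (value n) _) (≤-trans (<⇒≤ j<k) (value-≤ n s)) s))
    (*-monoˡ-≤ _ (value-≤ n s))
  value-≤ (dec n a t) {xs} {ρ} s = ≤-trans (decTo-≤ (⟦ n ⟧ xs ρ) _ _) (value-≤ a s)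
  value-≤ (bit j t)   {xs} s = bitAt-≤ (lookup xs j) _
  value-≤ (len j)     s = inputs s j

  at : ∀ {n} {p : Prog n} {σ τ t σ′} → σ ≡ τ → p ⊢ τ ⇓[ t ] σ′ → p ⊢ σ ⇓[ t ] σ′
  at refl r = r

  to : ∀ {n} {p : Prog n} {σ t τ σ′} → p ⊢ σ ⇓[ t ] τ → τ ≡ σ′ → p ⊢ σ ⇓[ t ] σ′
  to r refl = r

  within : ∀ {n} {p : Prog n} {σ t u σ′} → p ⊢ σ ⇓[ t ] σ′ → t ≡ u → p ⊢ σ ⇓[ u ] σ′
  within r refl = r

  tick : ∀ k c → suc (c + (k * suc c + 1)) ≡ suc k * suc c + 1
  tick k c = cong suc (sym (+-assoc c (k * suc c) 1))

  module _ {n} (σ : Store n) (r : Fin n) where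

    -- The stack that changes is written as an update of a fixed `σ`, so that the updates of
    -- successive rounds collapse into one.
    drain-run : ∀ k {d} → drain r ⊢ unary k ∷ (σ [ r ]≔ unary d) ⇓[ k * 3 + 1 ] [] ∷ (σ [ r ]≔ unary (k + d))
    drain-run zero        = while[] refl
    drain-run (suc k) {d} = while∷ refl push
      (at (cong (unary k ∷_) (updateAt-updateAt r σ))
        (to (drain-run k) (cong (λ z → [] ∷ (σ [ r ]≔ unary z)) (+-suc k d))))

    cancel-run : ∀ k {d} → cancel r ⊢ unary k ∷ (σ [ r ]≔ unary d) ⇓[ k * 3 + 1 ] [] ∷ (σ [ r ]≔ unary (d ∸ k))
    cancel-run zero            = while[] refl
    cancel-run (suc k) {zero}  = while∷ refl (branch[] (lookup∘update r σ []) skip)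
      (to (cancel-run k) (cong (λ z → [] ∷ (σ [ r ]≔ unary z)) (0∸n≡0 k)))
    cancel-run (suc k) {suc d} = while∷ refl (branch∷ (lookup∘update r σ _) skip)
      (at (cong (unary k ∷_) ([]≔-idempotent σ r)) (cancel-run k))

    restore-run : ∀ bs {e cs} → restore r ⊢ bs ∷ e ∷ (σ [ r ]≔ cs) ⇓[ length bs * 3 + 1 ] [] ∷ e ∷ (σ [ r ]≔ (bs ʳ++ cs))
    restore-run []           = while[] refl
    restore-run (b ∷ bs) {e} = while∷ refl push
      (at (cong (λ s → bs ∷ e ∷ s) (updateAt-updateAt r σ)) (restore-run bs))

    measure-run : ∀ bs {d} → measure r ⊢ [] ∷ unary d ∷ (σ [ r ]≔ bs)
                    ⇓[ length bs * 5 + 1 + (length bs * 3 + 1) ] [] ∷ unary (length bs + d) ∷ (σ [ r ]≔ bs)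
    measure-run bs {d} = counting bs ⨾
      within (to (restore-run (bs ʳ++ []))
                 (cong (λ z → [] ∷ unary (length bs + d) ∷ (σ [ r ]≔ z)) (reverse-involutive bs)))
             (cong (λ l → l * 3 + 1) (length-reverse bs))
      where
      counting : ∀ bs {cs d} → count r ⊢ cs ∷ unary d ∷ (σ [ r ]≔ bs)
                ⇓[ length bs * 5 + 1 ] (bs ʳ++ cs) ∷ unary (length bs + d) ∷ (σ [ r ]≔ [])
      counting []               = while[] (lookup∘update r σ [])
      counting (b ∷ bs) {cs} {d} = while∷ (lookup∘update r σ (b ∷ bs)) (push ⨾ push)
        (at (cong (λ s → (b ∷ cs) ∷ unary (suc d) ∷ s) ([]≔-idempotent σ r))
          (to (counting bs) (cong (λ z → (bs ʳ++ b ∷ cs) ∷ unary z ∷ (σ [ r ]≔ [])) (+-suc (length bs) d))))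

    fetch-run : ∀ bs k → fetch r ⊢ [] ∷ unary k ∷ (σ [ r ]≔ bs)
                  ⇓[ k * 4 + 1 + (7 + (k * 3 + 1)) ] [] ∷ unary (bitAt bs k) ∷ (σ [ r ]≔ bs)
    fetch-run bs k =
      let cs , ds , walk , same , back , short = advance k bs []
      in walk ⨾ to (subst (λ z → peek r ⊢ cs ∷ [] ∷ (σ [ r ]≔ ds) ⇓[ 7 ] cs ∷ unary z ∷ (σ [ r ]≔ ds)) (sym same) (peeking cs ds) ⨾
                    relax (+-monoˡ-≤ 1 (*-monoˡ-≤ 3 (≤-trans short (≤-reflexive (+-identityʳ k))))) (restore-run cs))
                   (cong (λ z → [] ∷ unary (bitAt bs k) ∷ (σ [ r ]≔ z)) back)
      where
      advance : ∀ k bs cs → ∃[ cs′ ] ∃[ bs′ ]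
        seek r ⊢ cs ∷ unary k ∷ (σ [ r ]≔ bs) ⇓[ k * 4 + 1 ] cs′ ∷ [] ∷ (σ [ r ]≔ bs′)
        × bitAt bs k ≡ bitAt bs′ 0 × cs′ ʳ++ bs′ ≡ cs ʳ++ bs × length cs′ ≤ k + length cs
      advance zero    bs cs = cs , bs , while[] refl , refl , refl , ≤-refl
      advance (suc k) [] cs =
        let cs′ , bs′ , walk , same , back , short = advance k [] cs
        in cs′ , bs′ ,
           while∷ refl (relax (n≤1+n 2) (branch[] (lookup∘update r σ []) skip)) walk ,
           same , back , m≤n⇒m≤1+n short
      advance (suc k) (b ∷ bs) cs =
        let cs′ , bs′ , walk , same , back , short = advance k bs (b ∷ cs)
        in cs′ , bs′ ,
           while∷ refl (branch∷ (lookup∘update r σ (b ∷ bs)) push)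
             (at (cong (λ s → (b ∷ cs) ∷ unary k ∷ s) ([]≔-idempotent σ r)) walk) ,
           same , back , ≤-trans short (≤-reflexive (+-suc k (length cs)))

      undo : ∀ b ds → updateAt ((σ [ r ]≔ (b ∷ ds)) [ r ]≔ ds) r (b ∷_) ≡ σ [ r ]≔ (b ∷ ds)
      undo b ds = trans (cong (λ s → updateAt s r (b ∷_)) ([]≔-idempotent σ r)) (updateAt-updateAt r σ)

      peeking : ∀ cs ds → peek r ⊢ cs ∷ [] ∷ (σ [ r ]≔ ds) ⇓[ 7 ] cs ∷ unary (bitAt ds 0) ∷ (σ [ r ]≔ ds)
      peeking cs []           = relax (s≤s (s≤s z≤n)) (branch[] (lookup∘update r σ []) skip)
      peeking cs (false ∷ ds) = relax (m≤m+n 5 2) (branch∷ (lookup∘update r σ (false ∷ ds))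
        (push ⨾ at (cong (λ s → cs ∷ [] ∷ s) (undo false ds)) push))
      -- The longest case, from which the constant 7 comes: one test and three pushes of two steps
      -- each.
      peeking cs (true ∷ ds)  = branch∷ (lookup∘update r σ (true ∷ ds))
        (push ⨾ (at (cong (λ s → cs ∷ [] ∷ s) (undo true ds)) (push ⨾ push)))

  literal-run : ∀ {n} k {σ : Store n} → literal k ⊢ [] ∷ σ ⇓[ 1 + k * 2 ] unary k ∷ σ
  literal-run zero    = skip
  literal-run (suc k) = within (literal-run k ⨾ push) (lemma (k * 2))
    where
    lemma : ∀ j → 1 + j + 2 ≡ 1 + (2 + j)
    lemma = solve-∀

  record Fits {i n m} (ρ : Fin n → Fin m) (ι : Fin i → Fin m)
              (xs : Vec BitString i) (env : Vec ℕ n) (σ : Store m) : Set where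
    field
      var-at   : ∀ x → lookup σ (ρ x) ≡ unary (lookup env x)
      input-at : ∀ j → lookup σ (ι j) ≡ lookup xs j
  open Fits

  fits-suc : ∀ {i n m} {ρ : Fin n → Fin m} {ι : Fin i → Fin m} {xs env σ s} →
             Fits ρ ι xs env σ → Fits (suc ∘ ρ) (suc ∘ ι) xs env (s ∷ σ)
  fits-suc F = record { var-at = var-at F ; input-at = input-at F }

  fits-tail : ∀ {i n m} {ρ : Fin (suc n) → Fin m} {ι : Fin i → Fin m} {xs env σ} →
              Fits ρ ι xs env σ → Fits (ρ ∘ suc) ι xs (Vec.tail env) σ
  fits-tail {env = _ ∷ _} F = record { var-at = λ x → var-at F (suc x) ; input-at = input-at F }

  fits-under : ∀ {i n m} {ρ : Fin n → Fin m} {ι : Fin i → Fin m} {xs env σ} k →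
               Fits ρ ι xs env σ → Fits (under ρ) (suc ∘ ι) xs (k ∷ env) (unary k ∷ σ)
  fits-under k F = record { var-at = λ { zero → refl ; (suc x) → var-at F x } ; input-at = input-at F }

  measure-at : ∀ {m} (σ : Store m) r {N bs} → lookup σ r ≡ bs → length bs ≤ N →
               new (measure r) ⊢ [] ∷ σ ⇓[ N * 5 + 1 + (N * 3 + 1) ] unary (length bs) ∷ σ
  measure-at σ r {bs = bs} refl bs≤N =
    new (relax (+-mono-≤ (+-monoˡ-≤ 1 (*-monoˡ-≤ 5 bs≤N)) (+-monoˡ-≤ 1 (*-monoˡ-≤ 3 bs≤N)))
      (at (cong (λ s → [] ∷ [] ∷ s) (sym ([]≔-lookup σ r)))
        (to (measure-run σ r bs {0})
            (cong₂ (λ z s → [] ∷ unary z ∷ s) (+-identityʳ (length bs)) ([]≔-lookup σ r)))))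

  compile-run : ∀ {i n m} (t : Tm i n) {ρ : Fin n → Fin m} {ι xs env σ N} → Fits ρ ι xs env σ → Small xs env N →
                compile t ρ ι ⊢ [] ∷ σ ⇓[ fn (cost t) N ] unary (⟦ t ⟧ xs env) ∷ σ
  compile-run (var x) {ρ} {env = env} {σ} F s =
    to (measure-at σ (ρ x) (var-at F x) (≤-trans (≤-reflexive (length-replicate (lookup env x))) (vars s x)))
       (cong (λ z → unary z ∷ σ) (length-replicate (lookup env x)))
  compile-run (lit k) F s = literal-run k
  compile-run (a ⊕ b) {xs = xs} {env} {σ} {N} F s =
    compile-run a F s ⨾ new (compile-run b (fits-suc F) s ⨾
      to (relax (+-monoˡ-≤ 1 (*-monoˡ-≤ 3 (value-≤ b s))) (drain-run (unary (⟦ a ⟧ xs env) ∷ σ) zero (⟦ b ⟧ xs env)))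
         (cong (λ z → [] ∷ unary z ∷ σ) (+-comm (⟦ b ⟧ xs env) _)))
  compile-run (a ⊖ b) {xs = xs} {env} {σ} F s =
    compile-run a F s ⨾ new (compile-run b (fits-suc F) s ⨾
      relax (+-monoˡ-≤ 1 (*-monoˡ-≤ 3 (value-≤ b s))) (cancel-run (unary (⟦ a ⟧ xs env) ∷ σ) zero (⟦ b ⟧ xs env)))
  compile-run (wk t) F s = compile-run t (fits-tail F) (small-tail s)
  compile-run {m = m} (sum n t) {ρ} {ι} {xs} {env} {σ} {N} F s =
    new (compile-run n (fits-suc F) s ⨾
      to (relax (+-monoˡ-≤ 1 (*-monoˡ-≤ (suc c) (value-≤ n s))) (loop (⟦ n ⟧ xs env) 0 (value-≤ n s)))
         (cong (λ z → [] ∷ unary z ∷ σ) (+-identityʳ _)))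
    where
    f : ℕ → ℕ
    f k = ⟦ t ⟧ xs (k ∷ env)
    c : ℕ
    c = fn (cost t ⊞ linear 3 (value t)) (N + fn (value n) N)
    loop : ∀ k d → k ≤ fn (value n) N →
           while zero (λ _ → new (compile t (under (suc ∘ ρ)) (λ j → suc (suc (ι j))) ⨾ drain (suc zero)))
             ⊢ unary k ∷ unary d ∷ σ ⇓[ k * suc c + 1 ] [] ∷ unary (sumTo k f + d) ∷ σ
    loop zero    d k≤ = while[] refl
    loop (suc k) d k≤ = within (while∷ refl
        (new (compile-run t (fits-under k (fits-suc F)) s′ ⨾
              relax (+-monoˡ-≤ 1 (*-monoˡ-≤ 3 (value-≤ t s′)))
                    (drain-run (unary k ∷ unary d ∷ σ) (suc zero) (f k))))
        (to (loop k (f k + d) (<⇒≤ k≤)) (cong (λ z → [] ∷ unary z ∷ σ) (lemma (sumTo k f) (f k) d))))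
      (tick k c)
      where
      s′ = small-∷ (fn (value n) N) (<⇒≤ k≤) s
      lemma : ∀ x y z → x + (y + z) ≡ y + x + z
      lemma = solve-∀
  compile-run {m = m} (dec n a t) {ρ} {ι} {xs} {env} {σ} {N} F s =
    compile-run a F s ⨾ new (compile-run n (fits-suc F) s ⨾
      relax (+-monoˡ-≤ 1 (*-monoˡ-≤ (suc c) (value-≤ n s))) (loop (⟦ n ⟧ xs env) _ (value-≤ n s) (value-≤ a s)))
    where
    f : ℕ → ℕ → ℕ
    f k d = ⟦ t ⟧ xs (k ∷ d ∷ env)
    c : ℕ
    c = fn (cost t ⊞ linear 3 (value t)) (N + (fn (value n) N + fn (value a) N))
    loop : ∀ k d → k ≤ fn (value n) N → d ≤ fn (value a) N →
           while zero (λ _ → new (compile t (under (under ρ)) (λ j → suc (suc (ι j))) ⨾ cancel (suc zero)))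
             ⊢ unary k ∷ unary d ∷ σ ⇓[ k * suc c + 1 ] [] ∷ unary (decTo k f d) ∷ σ
    loop zero    d k≤ d≤ = while[] refl
    loop (suc k) d k≤ d≤ = within (while∷ refl
        (new (compile-run t (fits-under k (fits-under d F)) s′ ⨾
              relax (+-monoˡ-≤ 1 (*-monoˡ-≤ 3 (value-≤ t s′)))
                    (cancel-run (unary k ∷ unary d ∷ σ) (suc zero) (f k d))))
        (loop k (d ∸ f k d) (<⇒≤ k≤) (≤-trans (m∸n≤m d (f k d)) d≤)))
      (tick k c)
      where
      s′ = small-∷∷ (fn (value n) N) (fn (value a) N) (<⇒≤ k≤) d≤ s
  compile-run (bit j t) {ι = ι} {xs} {env} {σ} F s =
    compile-run t F s ⨾ new
      (relax (+-mono-≤ (+-monoˡ-≤ 1 (*-monoˡ-≤ 4 v≤)) (+-monoʳ-≤ 7 (+-monoˡ-≤ 1 (*-monoˡ-≤ 3 v≤))))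
        (at (cong (λ s → [] ∷ unary v ∷ s) (sym same)) (to (fetch-run σ (ι j) (lookup xs j) v) (cong (λ s → [] ∷ unary (bitAt (lookup xs j) v) ∷ s) same))))
    where
    v  = ⟦ t ⟧ xs env
    v≤ = value-≤ t s
    same : σ [ ι j ]≔ lookup xs j ≡ σ
    same = trans (cong (σ [ ι j ]≔_) (sym (input-at F j))) ([]≔-lookup σ (ι j))
  compile-run (len j) {ι = ι} {σ = σ} F s = measure-at σ (ι j) (input-at F j) (inputs s j)

  infix  5 _≐_ _≺_
  infixr 4 _∧ᶠ_
  infixr 3 _∨ᶠ_

  data Fm (i : ℕ) : ℕ → Set where
    _≐_ _≺_   : ∀ {n} → Tm i n → Tm i n → Fm i n
    ¬ᶠ_       : ∀ {n} → Fm i n → Fm i n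
    _∧ᶠ_ _∨ᶠ_ : ∀ {n} → Fm i n → Fm i n → Fm i n
    all any   : ∀ {n} → Tm i n → Fm i (suc n) → Fm i n

  ⟦_⟧ᶠ : ∀ {i n} → Fm i n → Vec BitString i → Vec ℕ n → Bool
  ⟦ a ≐ b ⟧ᶠ   xs ρ = ⟦ a ⟧ xs ρ ≡ᵇ ⟦ b ⟧ xs ρ
  ⟦ a ≺ b ⟧ᶠ   xs ρ = ⟦ a ⟧ xs ρ <ᵇ ⟦ b ⟧ xs ρ
  ⟦ ¬ᶠ φ ⟧ᶠ    xs ρ = not (⟦ φ ⟧ᶠ xs ρ)
  ⟦ φ ∧ᶠ ψ ⟧ᶠ  xs ρ = ⟦ φ ⟧ᶠ xs ρ ∧ ⟦ ψ ⟧ᶠ xs ρ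
  ⟦ φ ∨ᶠ ψ ⟧ᶠ  xs ρ = ⟦ φ ⟧ᶠ xs ρ ∨ ⟦ ψ ⟧ᶠ xs ρ
  ⟦ all n φ ⟧ᶠ xs ρ = allTo (⟦ n ⟧ xs ρ) (λ k → ⟦ φ ⟧ᶠ xs (k ∷ ρ))
  ⟦ any n φ ⟧ᶠ xs ρ = anyTo (⟦ n ⟧ xs ρ) (λ k → ⟦ φ ⟧ᶠ xs (k ∷ ρ))

  -- Formulas are compiled as terms with value 0 or 1. Truncated subtraction does all the logic: 1 ∸
  -- n negates, and 1 ∸ (1 ∸ n) caps n at 1.
  truth : ∀ {i n} → Fm i n → Tm i n
  truth (a ≐ b)   = lit 1 ⊖ ((a ⊖ b) ⊕ (b ⊖ a))
  truth (a ≺ b)   = lit 1 ⊖ (lit 1 ⊖ (b ⊖ a))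
  truth (¬ᶠ φ)    = lit 1 ⊖ truth φ
  truth (φ ∧ᶠ ψ)  = (truth φ ⊕ truth ψ) ⊖ lit 1
  truth (φ ∨ᶠ ψ)  = lit 1 ⊖ (lit 1 ⊖ (truth φ ⊕ truth ψ))
  truth (all n φ) = lit 1 ⊖ sum n (lit 1 ⊖ truth φ)
  truth (any n φ) = lit 1 ⊖ (lit 1 ⊖ sum n (truth φ))

  ≐-value : ∀ a b → 1 ∸ ((a ∸ b) + (b ∸ a)) ≡ indicator (a ≡ᵇ b)
  ≐-value zero    zero    = refl
  ≐-value zero    (suc b) = 0∸n≡0 b
  ≐-value (suc a) zero    = 0∸n≡0 (a + 0)
  ≐-value (suc a) (suc b) = ≐-value a b

  ≺-value : ∀ a b → 1 ∸ (1 ∸ (b ∸ a)) ≡ indicator (a <ᵇ b)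
  ≺-value zero    zero    = refl
  ≺-value zero    (suc b) = cong (1 ∸_) (0∸n≡0 b)
  ≺-value (suc a) zero    = refl
  ≺-value (suc a) (suc b) = ≺-value a b

  not-value : ∀ x → 1 ∸ indicator x ≡ indicator (not x)
  not-value false = refl
  not-value true  = refl

  ∧-value : ∀ x y → indicator x + indicator y ∸ 1 ≡ indicator (x ∧ y)
  ∧-value false false = refl
  ∧-value false true  = refl
  ∧-value true  y     = refl

  ∨-value : ∀ x y n → 1 ∸ (1 ∸ n) ≡ indicator y → 1 ∸ (1 ∸ (indicator x + n)) ≡ indicator (x ∨ y)
  ∨-value false y n h = h
  ∨-value true  y n h = cong (1 ∸_) (0∸n≡0 n)

  signum : ∀ x → 1 ∸ (1 ∸ indicator x) ≡ indicator x
  signum false = refl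
  signum true  = refl

  any-value : ∀ k f (g : ℕ → ℕ) → (∀ j → g j ≡ indicator (f j)) → 1 ∸ (1 ∸ sumTo k g) ≡ indicator (anyTo k f)
  any-value zero    f g h = refl
  any-value (suc k) f g h rewrite h k = ∨-value (f k) _ _ (any-value k f g h)

  all-value : ∀ k f (g : ℕ → ℕ) → (∀ j → g j ≡ indicator (f j)) →
              1 ∸ sumTo k (λ j → 1 ∸ g j) ≡ indicator (allTo k f)
  all-value zero    f g h = refl
  all-value (suc k) f g h rewrite h k with f k
  ... | true  = all-value k f g h
  ... | false = 0∸n≡0 (sumTo k _)

  truth-value : ∀ {i n} (φ : Fm i n) xs ρ → ⟦ truth φ ⟧ xs ρ ≡ indicator (⟦ φ ⟧ᶠ xs ρ)
  truth-value (a ≐ b)   xs ρ = ≐-value (⟦ a ⟧ xs ρ) (⟦ b ⟧ xs ρ)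
  truth-value (a ≺ b)   xs ρ = ≺-value (⟦ a ⟧ xs ρ) (⟦ b ⟧ xs ρ)
  truth-value (¬ᶠ φ)    xs ρ = trans (cong (1 ∸_) (truth-value φ xs ρ)) (not-value (⟦ φ ⟧ᶠ xs ρ))
  truth-value (φ ∧ᶠ ψ)  xs ρ = trans (cong₂ (λ x y → x + y ∸ 1) (truth-value φ xs ρ) (truth-value ψ xs ρ))
                                     (∧-value (⟦ φ ⟧ᶠ xs ρ) (⟦ ψ ⟧ᶠ xs ρ))
  truth-value (φ ∨ᶠ ψ)  xs ρ = trans (cong₂ (λ x y → 1 ∸ (1 ∸ (x + y))) (truth-value φ xs ρ) (truth-value ψ xs ρ))
                                     (∨-value (⟦ φ ⟧ᶠ xs ρ) _ _ (signum (⟦ ψ ⟧ᶠ xs ρ)))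
  truth-value (all n φ) xs ρ = all-value (⟦ n ⟧ xs ρ) _ _ λ k → truth-value φ xs (k ∷ ρ)
  truth-value (any n φ) xs ρ = any-value (⟦ n ⟧ xs ρ) _ _ λ k → truth-value φ xs (k ∷ ρ)

  infixr 5 _▹_

  data Out (i : ℕ) : ℕ → Set where
    emit : ∀ {n} → Fm i n → Out i n
    _▹_  : ∀ {n} → Out i n → Out i n → Out i n
    for  : ∀ {n} → Tm i n → Out i (suc n) → Out i n

  ⟦_⟧ᵒ : ∀ {i n} → Out i n → Vec BitString i → Vec ℕ n → BitString
  ⟦ emit φ ⟧ᵒ  xs ρ = [ ⟦ φ ⟧ᶠ xs ρ ]
  ⟦ d ▹ e ⟧ᵒ   xs ρ = ⟦ d ⟧ᵒ xs ρ ++ ⟦ e ⟧ᵒ xs ρ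
  ⟦ for n e ⟧ᵒ xs ρ = concatTo (⟦ n ⟧ xs ρ) (λ k → ⟦ e ⟧ᵒ xs (k ∷ ρ))

  -- The output stack ω grows at the front, so it is produced from its end.
  compileᵒ : ∀ {i n m} → Out i n → (Fin n → Fin m) → (Fin i → Fin m) → Fin m → Prog m
  compileᵒ (emit φ)  ρ ι ω = new (compile (truth φ) ρ ι ⨾
                               branch zero (push false (suc ω)) (λ _ → push true (suc ω)))
  compileᵒ (d ▹ e)   ρ ι ω = compileᵒ e ρ ι ω ⨾ compileᵒ d ρ ι ω
  compileᵒ (for n e) ρ ι ω = new (compile n ρ ι ⨾ while zero λ _ → compileᵒ e (under ρ) (suc ∘ ι) (suc ω))

  costᵒ : ∀ {i n} → Out i n → Bound
  costᵒ (emit φ)  = cost (truth φ) ⊞ const-bound 3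
  costᵒ (d ▹ e)   = costᵒ e ⊞ costᵒ d
  costᵒ (for n e) = cost n ⊞ loop-cost (value n) (costᵒ e ⊚ (id-bound ⊞ value n))

  record Apart {i n m} (ρ : Fin n → Fin m) (ι : Fin i → Fin m) (ω : Fin m) : Set where
    field
      var≢   : ∀ x → ρ x ≢ ω
      input≢ : ∀ j → ι j ≢ ω
  open Apart

  apart-under : ∀ {i n m} {ρ : Fin n → Fin m} {ι : Fin i → Fin m} {ω} →
                Apart ρ ι ω → Apart (under ρ) (suc ∘ ι) (suc ω)
  var≢   (apart-under A) zero    ()
  var≢   (apart-under A) (suc x) e = var≢ A x (suc-injective e)
  input≢ (apart-under A) j       e = input≢ A j (suc-injective e)

  fits-update : ∀ {i n m} {ρ : Fin n → Fin m} {ι : Fin i → Fin m} {ω xs env σ o} → Apart ρ ι ω →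
                Fits ρ ι xs env σ → Fits ρ ι xs env (σ [ ω ]≔ o)
  var-at   (fits-update {σ = σ} A F) x = trans (lookup∘update′ (var≢ A x) σ _) (var-at F x)
  input-at (fits-update {σ = σ} A F) j = trans (lookup∘update′ (input≢ A j) σ _) (input-at F j)

  compileᵒ-run : ∀ {i n m} (e : Out i n) {ρ : Fin n → Fin m} {ι ω xs env σ o N} → Apart ρ ι ω →
                 Fits ρ ι xs env σ → Small xs env N →
                 compileᵒ e ρ ι ω ⊢ σ [ ω ]≔ o ⇓[ fn (costᵒ e) N ] σ [ ω ]≔ (⟦ e ⟧ᵒ xs env ++ o)
  compileᵒ-run (emit φ) {ω = ω} {xs} {env} {σ} {o} A F s =
    new (compile-run (truth φ) (fits-update A F) s ⨾
         at (cong (λ z → unary z ∷ _) (truth-value φ xs env)) (write (⟦ φ ⟧ᶠ xs env)))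
    where
    write : ∀ x → branch zero (push false (suc ω)) (λ _ → push true (suc ω))
                    ⊢ unary (indicator x) ∷ (σ [ ω ]≔ o) ⇓[ 3 ] [] ∷ (σ [ ω ]≔ (x ∷ o))
    write false = branch[] refl (to push (cong ([] ∷_) (updateAt-updateAt ω σ)))
    write true  = branch∷  refl (to push (cong ([] ∷_) (updateAt-updateAt ω σ)))
  compileᵒ-run (d ▹ e) {ω = ω} {xs} {env} {σ} {o} A F s =
    compileᵒ-run e A F s ⨾
    to (compileᵒ-run d A F s) (cong (σ [ ω ]≔_) (sym (++-assoc (⟦ d ⟧ᵒ xs env) (⟦ e ⟧ᵒ xs env) o)))
  compileᵒ-run (for n e) {ρ} {ι} {ω} {xs} {env} {σ} {o} {N} A F s =
    new (compile-run n (fits-update A F) s ⨾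
         relax (+-monoˡ-≤ 1 (*-monoˡ-≤ (suc c) (value-≤ n s))) (loop (⟦ n ⟧ xs env) (value-≤ n s)))
    where
    f : ℕ → BitString
    f k = ⟦ e ⟧ᵒ xs (k ∷ env)
    c : ℕ
    c = fn (costᵒ e) (N + fn (value n) N)
    loop : ∀ k {o} → k ≤ fn (value n) N →
           while zero (λ _ → compileᵒ e (under ρ) (suc ∘ ι) (suc ω))
             ⊢ unary k ∷ (σ [ ω ]≔ o) ⇓[ k * suc c + 1 ] [] ∷ (σ [ ω ]≔ (concatTo k f ++ o))
    loop zero    k≤ = while[] refl
    loop (suc k) {o} k≤ = within (while∷ refl
        (compileᵒ-run e {σ = unary k ∷ σ} (apart-under A) (fits-under k F) (small-∷ (fn (value n) N) (<⇒≤ k≤) s))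
        (to (loop k (<⇒≤ k≤)) (cong (λ z → [] ∷ (σ [ ω ]≔ z)) (sym (++-assoc (concatTo k f) (f k) o)))))
      (tick k c)

  length≤sum : ∀ {i} (xs : Vec BitString i) j → length (lookup xs j) ≤ Vec.sum (Vec.map length xs)
  length≤sum (x ∷ xs) zero    = m≤m+n _ _
  length≤sum (x ∷ xs) (suc j) = ≤-trans (length≤sum xs j) (m≤n+m _ _)

  -- A closed program has no variables, so the total input length can serve as the bound `N` of
  -- `Small`.
  out-polyTime : ∀ {i} (e : Out i 0) {f : Vec BitString i → BitString} → (∀ xs → ⟦ e ⟧ᵒ xs [] ≡ f xs) → PolyTime f
  out-polyTime e e≡f = polyTime (compileᵒ e (λ ()) suc zero) (costᵒ e) λ xs →
    xs , to (compileᵒ-run e {xs = xs} {σ = [] ∷ xs} {o = []} (record { var≢ = λ () ; input≢ = λ _ () })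
                            (record { var-at = λ () ; input-at = λ j → refl })
                            (record { vars = λ () ; inputs = length≤sum xs }))
            (cong (_∷ xs) (trans (++-identityʳ _) (e≡f xs)))

-- The covering problem and its co-bipartite graph

module Covers where

  open import Data.Bool.Base using (Bool; true; false; T; not; if_then_else_)
  open import Data.Bool.Properties using (T?; T-≡)
  open import Data.Empty using (⊥; ⊥-elim)
  open import Data.Fin.Base as Fin using (Fin; zero; suc; toℕ; combine; remQuot)
  open import Data.Fin.Properties as Fin using (_≟_; any?; remQuot-combine; combine-remQuot; combine-monoˡ-<)
  open import Data.Fin.Subset using (Subset; _∈_; _∉_; ∣_∣; ∁; _-_) renaming (⊥ to ∅)
  open import Data.Fin.Subset.Properties
    using (_∈?_; x∈p⇒∣p-x∣<∣p∣; x∈p∧x∉q⇒x∈p─q; x∈⁅y⁆⇒x≡y; ∉⊥; ∣⊥∣≡0; x∈∁p⇒x∉p)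
  open import Data.List.Base using (List; []; _∷_; length; tabulate)
  open import Data.List.Properties using (length-tabulate)
  open import Data.List.Membership.Propositional using () renaming (_∈_ to _∈ˡ_)
  open import Data.List.Relation.Unary.All as All using (All; []; _∷_)
  open import Data.List.Relation.Unary.All.Properties using (¬Any⇒All¬; tabulate⁺)
  open import Data.List.Relation.Unary.Any using (here; there)
  open import Data.List.Relation.Unary.AllPairs using ([]; _∷_)
  open import Data.List.Relation.Unary.Unique.Propositional using (Unique)
  import Data.List.Relation.Unary.Unique.Propositional.Properties as Unique
  open import Data.Maybe.Base using (Maybe; just; nothing)
  open import Data.Maybe.Properties using (just-injective)
  open import Data.Nat.Base hiding (_⊔_)
  open import Data.Nat.Properties hiding (_≟_)
  open import Data.Product.Base using (Σ; ∃-syntax; _×_; _,_; proj₁; proj₂; uncurry)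
  open import Data.Sum.Base using (_⊎_; inj₁; inj₂)
  open import Data.Unit.Base using (⊤; tt)
  open import Data.Vec.Base as Vec using (Vec; []; _∷_; _[_]≔_; here; there)
  open import Data.Vec.Properties using ([]≔-updates; []≔-minimal; lookup∘tabulate; []=⇒lookup; lookup⇒[]=)
  open import Function.Base using (_∘_; id)
  open import Function.Bundles using (_⇔_; mk⇔; Inverse; Equivalence)
  open import Function.Construct.Identity using (↔-id)
  open import Relation.Binary.Construct.Closure.ReflexiveTransitive using (ε; _◅_)
  open import Relation.Nullary using (yes; no; ¬_; does; contradiction)
  open import Relation.Nullary.Decidable using (dec-true; dec-false)
  open import Relation.Binary.PropositionalEquality hiding ([_])

  open StackPrograms using (Finite; ⊤-finite; ⊎-finite)

  open Path

  module _ {n} (G : Graph n) where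

    open import Data.List.Membership.DecPropositional (_≟_ {n}) using () renaming (_∈?_ to _∈ˡ?_)

    Adj-sym : ∀ {u v} → Adj G u v → Adj G v u
    Adj-sym {u} {v} = subst T (symmetric G u v)

    Adj⇒≢ : ∀ {u v} → Adj G u v → u ≢ v
    Adj⇒≢ {u} a refl = subst T (irreflexive G u) a

    suffix : ∀ {u v t} (w : Walk G v t) → Unique (walkVertices G w) → u ∈ˡ walkVertices G w →
             Σ (Path G u t) λ P → edgeCount P ≤ walkLength G w
    suffix ε       U (here refl) = record { walk = ε ; simple = U } , ≤-refl
    suffix (a ◅ w) U (here refl) = record { walk = a ◅ w ; simple = U } , ≤-refl
    suffix (a ◅ w) (_ ∷ U) (there u∈) = let P , P≤ = suffix w U u∈ in P , m≤n⇒m≤1+n P≤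

    -- If `u` occurs again on the path found for the rest of the walk, the part of that path from
    -- there on is taken.
    shortcut : ∀ {u v} (w : Walk G u v) → Σ (Path G u v) λ P → edgeCount P ≤ walkLength G w
    shortcut ε = record { walk = ε ; simple = [] ∷ [] } , z≤n
    shortcut {u} (a ◅ w) with shortcut w
    ... | P , P≤ with u ∈ˡ? vertices P
    ...   | yes u∈ = let Q , Q≤ = suffix (walk P) (simple P) u∈ in Q , m≤n⇒m≤1+n (≤-trans Q≤ P≤)
    ...   | no  u∉ = record { walk = a ◅ walk P ; simple = ¬Any⇒All¬ _ u∉ ∷ simple P } , s≤s P≤

    path₁ : ∀ {u v} → Adj G u v → ShortestPath G u v
    path₁ {u} {v} a = record { walk = a ◅ ε ; simple = (Adj⇒≢ a ∷ []) ∷ [] ∷ [] } , shortest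
      where
      shortest : ∀ Q → 1 ≤ edgeCount Q
      shortest record { walk = ε }     = ⊥-elim (Adj⇒≢ a refl)
      shortest record { walk = _ ◅ _ } = s≤s z≤n

    path₂ : ∀ {u m v} → u ≢ v → ¬ Adj G u v → Adj G u m → Adj G m v → ShortestPath G u v
    path₂ {u} {m} {v} u≢v ¬a b c =
      record { walk = b ◅ c ◅ ε ; simple = (Adj⇒≢ b ∷ u≢v ∷ []) ∷ (Adj⇒≢ c ∷ []) ∷ [] ∷ [] } , shortest
      where
      shortest : ∀ Q → 2 ≤ edgeCount Q
      shortest record { walk = ε }         = ⊥-elim (u≢v refl)
      shortest record { walk = a ◅ ε }     = ⊥-elim (¬a a)
      shortest record { walk = _ ◅ _ ◅ _ } = s≤s (s≤s z≤n)

    path₃ : ∀ {u a b v} → u ≢ v → ¬ Adj G u v → (∀ m → Adj G u m → ¬ Adj G m v) →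
            Adj G u a → Adj G a b → Adj G b v → ShortestPath G u v
    path₃ {u} {a} {b} {v} u≢v ¬uv ¬m x y z = record
      { walk   = x ◅ y ◅ z ◅ ε
      ; simple = (Adj⇒≢ x ∷ (λ { refl → ¬uv z }) ∷ u≢v ∷ []) ∷
                 (Adj⇒≢ y ∷ (λ { refl → ¬uv x }) ∷ []) ∷ (Adj⇒≢ z ∷ []) ∷ [] ∷ [] } , shortest
      where
      shortest : ∀ Q → 3 ≤ edgeCount Q
      shortest record { walk = ε }             = ⊥-elim (u≢v refl)
      shortest record { walk = a ◅ ε }         = ⊥-elim (¬uv a)
      shortest record { walk = a ◅ b ◅ ε }     = ⊥-elim (¬m _ a b)
      shortest record { walk = _ ◅ _ ◅ _ ◅ _ } = s≤s (s≤s (s≤s z≤n))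

    -- In a graph of diameter at most 2 a shortest path has at most one interior vertex. A covered
    -- vertex outside the set is not an end of its path, so it is that vertex, and then the ends are
    -- not adjacent.
    between : (∀ u v → u ≢ v → ¬ Adj G u v → ∃[ m ] Adj G u m × Adj G m v) →
              ∀ {S} (I : PathAssignment G S) {w} → w ∉ S → LiesOn G {S} w I →
              ∃[ u ] ∃[ v ] u ∈ S × v ∈ S × u ≢ v × ¬ Adj G u v × Adj G u w × Adj G w v
    between common I {w} w∉S (u , v , u∈S , v∈S , u<v , w∈P) with I u∈S v∈S u<v
    ... | P , shortest = go (walk P) shortest w∈P
      where
      u≢v : u ≢ v
      u≢v refl = <-irrefl refl u<v
      go : (W : Walk G u v) → (∀ Q → walkLength G W ≤ edgeCount Q) → w ∈ˡ walkVertices G W → _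
      go ε           _ (here refl)         = ⊥-elim (w∉S u∈S)
      go (_ ◅ ε)     _ (here refl)         = ⊥-elim (w∉S u∈S)
      go (_ ◅ ε)     _ (there (here refl)) = ⊥-elim (w∉S v∈S)
      go (a ◅ b ◅ ε) s (here refl)         = ⊥-elim (w∉S u∈S)
      go (a ◅ b ◅ ε) s (there (there (here refl))) = ⊥-elim (w∉S v∈S)
      go (a ◅ b ◅ ε) s (there (here refl)) =
        u , v , u∈S , v∈S , u≢v , (λ uv → case (s (proj₁ (path₁ uv)))) , a , b
        where
        case : ¬ 2 ≤ 1
        case (s≤s ())
      go (a ◅ b ◅ c ◅ W) s _ with T? (adjacent G u v)
      ... | yes uv = contradiction (s (proj₁ (path₁ uv))) λ { (s≤s ()) }
      ... | no ¬uv with common u v u≢v ¬uv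
      ...   | m , um , mv = contradiction (s (proj₁ (path₂ u≢v ¬uv um mv))) λ { (s≤s (s≤s ())) }

  x∈p∧x≢y⇒x∈p-y : ∀ {n} {p : Subset n} {x y} → x ∈ p → x ≢ y → x ∈ p - y
  x∈p∧x≢y⇒x∈p-y x∈p x≢y = x∈p∧x∉q⇒x∈p─q x∈p (x≢y ∘ x∈⁅y⁆⇒x≡y _)

  unique⇒length≤ : ∀ {n} {p : Subset n} xs → Unique xs → All (_∈ p) xs → length xs ≤ ∣ p ∣
  unique⇒length≤ []       _        _          = z≤n
  unique⇒length≤ (x ∷ xs) (x∉ ∷ U) (x∈p ∷ xs∈p) =
    ≤-<-trans (unique⇒length≤ xs U (All.zipWith (λ (y∈p , x≢y) → x∈p∧x≢y⇒x∈p-y y∈p (x≢y ∘ sym)) (xs∈p , x∉)))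
              (x∈p⇒∣p-x∣<∣p∣ x∈p)

  -- A further element would give `suc k` distinct elements of `p`.
  exhausts : ∀ {n k} {p : Subset n} (f : Fin k → Fin n) → (∀ {i j} → f i ≡ f j → i ≡ j) →
             (∀ i → f i ∈ p) → ∣ p ∣ ≤ k → ∀ {x} → x ∈ p → ∃[ i ] x ≡ f i
  exhausts {p = p} f inj f∈p p≤k {x} x∈p with any? (λ i → x ≟ f i)
  ... | yes found = found
  ... | no  x∉f   = ⊥-elim (<-irrefl refl (≤-trans
    (subst (_≤ ∣ p ∣) (cong suc (length-tabulate f))
      (unique⇒length≤ (x ∷ tabulate f) (tabulate⁺ (λ i e → x∉f (i , e)) ∷ Unique.tabulate⁺ inj)
        (x∈p ∷ tabulate⁺ f∈p)))
    p≤k))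

  image : ∀ {n} k → (Fin k → Fin n) → Subset n
  image zero    f = ∅
  image (suc k) f = image k (f ∘ suc) [ f zero ]≔ true

  ∣image∣≤ : ∀ {n} k (f : Fin k → Fin n) → ∣ image k f ∣ ≤ k
  ∣image∣≤ {n} zero    f = ≤-reflexive (∣⊥∣≡0 n)
  ∣image∣≤     (suc k) f = ≤-trans (insert (image k (f ∘ suc)) (f zero)) (s≤s (∣image∣≤ k (f ∘ suc)))
    where
    insert : ∀ {n} (p : Subset n) x → ∣ p [ x ]≔ true ∣ ≤ suc ∣ p ∣
    insert (false ∷ p) zero    = ≤-refl
    insert (true ∷ p)  zero    = n≤1+n _
    insert (false ∷ p) (suc x) = insert p x
    insert (true ∷ p)  (suc x) = s≤s (insert p x)

  ∈-image⁺ : ∀ {n} k (f : Fin k → Fin n) i → f i ∈ image k f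
  ∈-image⁺ (suc k) f zero    = []≔-updates (image k (f ∘ suc)) (f zero)
  ∈-image⁺ (suc k) f (suc i) with f (suc i) ≟ f zero
  ... | yes e = subst (_∈ image (suc k) f) (sym e) ([]≔-updates (image k (f ∘ suc)) (f zero))
  ... | no ¬e = []≔-minimal (image k (f ∘ suc)) (f (suc i)) (f zero) ¬e (∈-image⁺ k (f ∘ suc) i)

  ∈-image⁻ : ∀ {n} k (f : Fin k → Fin n) {x} → x ∈ image k f → ∃[ i ] x ≡ f i
  ∈-image⁻ zero    f x∈ = ⊥-elim (∉⊥ x∈)
  ∈-image⁻ (suc k) f {x} x∈ with x ≟ f zero
  ... | yes e = zero , e
  ... | no ¬e = let i , e = ∈-image⁻ k (f ∘ suc) (remove (image k (f ∘ suc)) (f zero) ¬e x∈) in suc i , e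
    where
    remove : ∀ {n} (p : Subset n) y {x} → x ≢ y → x ∈ p [ y ]≔ true → x ∈ p
    remove (_ ∷ p) zero    x≢y here       = ⊥-elim (x≢y refl)
    remove (_ ∷ p) zero    x≢y (there x∈) = there x∈
    remove (_ ∷ p) (suc y) x≢y here       = here
    remove (_ ∷ p) (suc y) x≢y (there x∈) = there (remove p y (x≢y ∘ cong suc) x∈)

  data Kind (Γ : ℕ) : Set where
    trivial : Kind Γ
    element : Fin Γ → Kind Γ
    clause  : Kind Γ

  -- Pick one choice from each of Γ groups so that every clause admits a picked
  -- choice. Clauses and choices are both indexed by Fin R; a choice in no group
  -- is padding, and so is a clause of kind trivial. The clause element g is met
  -- by the choices of the group g.
  record Cover : Set where
    field
      R Γ      : ℕ
      kind     : Fin R → Kind Γ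
      grp      : Fin R → Maybe (Fin Γ)
      admits   : Fin R → Fin R → Bool
      i₀       : Fin R
      kind-i₀  : kind i₀ ≡ trivial
      grp-i₀   : grp i₀ ≡ nothing
      el       : Fin Γ → Fin R
      kind-el  : ∀ g → kind (el g) ≡ element g
      -- Taken for a group that a strong geodetic set serves by its element clause and not by a
      -- choice.
      deflt    : Fin Γ → Fin R
      grp-deflt : ∀ g → grp (deflt g) ≡ just g
      -- There must be at least one group, so that some chosen s_j is available to cover the trivial
      -- clauses.
      g₀       : Fin Γ

    Solution : Set
    Solution = Σ (Fin Γ → Fin R) λ f → (∀ g → grp (f g) ≡ just g) ×
               (∀ i → kind i ≡ clause → ∃[ g ] T (admits i (f g)))

    -- A choice in no group meets only trivial clauses. So s_{i₀} can be covered only with the help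
    -- of a trivial clause in the set, and this claims one vertex that serves no group.
    meets′ : Kind Γ → Maybe (Fin Γ) → Bool → Bool
    meets′ trivial     _        _ = true
    meets′ (element g) (just h) _ = does (g ≟ h)
    meets′ (element g) nothing  _ = false
    meets′ clause      (just _) b = b
    meets′ clause      nothing  _ = false

    meets : Fin R → Fin R → Bool
    meets i j = meets′ (kind i) (grp j) (admits i j)

  -- The classes of vertices: X, the clauses C and H form one clique, Z and the
  -- choices S the other. H and Z are joined by a perfect matching, and X to
  -- nothing in the other clique.
  pattern X = zero
  pattern C = suc zero
  pattern H = suc (suc zero)
  pattern Z = suc (suc (suc zero))
  pattern S = suc (suc (suc (suc zero)))

  module _ {R : ℕ} (meets : Fin R → Fin R → Bool) where

    adj : Fin 5 × Fin R → Fin 5 × Fin R → Bool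
    adj (X , i) (X , j) = not (does (i ≟ j))
    adj (X , i) (C , j) = true
    adj (X , i) (H , j) = true
    adj (X , i) (Z , j) = false
    adj (X , i) (S , j) = false
    adj (C , i) (X , j) = true
    adj (C , i) (C , j) = not (does (i ≟ j))
    adj (C , i) (H , j) = true
    adj (C , i) (Z , j) = false
    adj (C , i) (S , j) = meets i j
    adj (H , i) (X , j) = true
    adj (H , i) (C , j) = true
    adj (H , i) (H , j) = not (does (i ≟ j))
    adj (H , i) (Z , j) = does (i ≟ j)
    adj (H , i) (S , j) = false
    adj (Z , i) (X , j) = false
    adj (Z , i) (C , j) = false
    adj (Z , i) (H , j) = does (i ≟ j)
    adj (Z , i) (Z , j) = not (does (i ≟ j))
    adj (Z , i) (S , j) = true
    adj (S , i) (X , j) = false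
    adj (S , i) (C , j) = meets j i
    adj (S , i) (H , j) = false
    adj (S , i) (Z , j) = true
    adj (S , i) (S , j) = not (does (i ≟ j))

    ≟-swap : (i j : Fin R) → does (i ≟ j) ≡ does (j ≟ i)
    ≟-swap i j with i ≟ j
    ... | yes refl = sym (dec-true (i ≟ i) refl)
    ... | no  i≢j  = sym (dec-false (j ≟ i) (i≢j ∘ sym))

    adj-sym : ∀ p q → adj p q ≡ adj q p
    adj-sym (X , i) (X , j) = cong not (≟-swap i j)
    adj-sym (X , i) (C , j) = refl
    adj-sym (X , i) (H , j) = refl
    adj-sym (X , i) (Z , j) = refl
    adj-sym (X , i) (S , j) = refl
    adj-sym (C , i) (X , j) = refl
    adj-sym (C , i) (C , j) = cong not (≟-swap i j)
    adj-sym (C , i) (H , j) = refl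
    adj-sym (C , i) (Z , j) = refl
    adj-sym (C , i) (S , j) = refl
    adj-sym (H , i) (X , j) = refl
    adj-sym (H , i) (C , j) = refl
    adj-sym (H , i) (H , j) = cong not (≟-swap i j)
    adj-sym (H , i) (Z , j) = ≟-swap i j
    adj-sym (H , i) (S , j) = refl
    adj-sym (Z , i) (X , j) = refl
    adj-sym (Z , i) (C , j) = refl
    adj-sym (Z , i) (H , j) = ≟-swap i j
    adj-sym (Z , i) (Z , j) = cong not (≟-swap i j)
    adj-sym (Z , i) (S , j) = refl
    adj-sym (S , i) (X , j) = refl
    adj-sym (S , i) (C , j) = refl
    adj-sym (S , i) (H , j) = refl
    adj-sym (S , i) (Z , j) = refl
    adj-sym (S , i) (S , j) = cong not (≟-swap i j)

    adj-irrefl : ∀ p → adj p p ≡ false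
    adj-irrefl (X , i) = cong not (dec-true (i ≟ i) refl)
    adj-irrefl (C , i) = cong not (dec-true (i ≟ i) refl)
    adj-irrefl (H , i) = cong not (dec-true (i ≟ i) refl)
    adj-irrefl (Z , i) = cong not (dec-true (i ≟ i) refl)
    adj-irrefl (S , i) = cong not (dec-true (i ≟ i) refl)

    coverGraph : Graph (5 * R)
    coverGraph = record
      { adjacent    = λ u v → adj (remQuot R u) (remQuot R v)
      ; symmetric   = λ u v → adj-sym (remQuot R u) (remQuot R v)
      ; irreflexive = λ v → adj-irrefl (remQuot R v) }

  module CoverGraph (P : Cover) where
    open Cover P

    G : Graph (5 * R)
    G = coverGraph meets

    V : Set
    V = Fin 5 × Fin R

    infix 4 _~_
    _~_ : V → V → Set
    p ~ q = T (adj meets p q)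

    -- Abstract, so that a vertex determines its coordinates in unification.
    abstract
      vertex : V → Fin (5 * R)
      vertex = uncurry combine

      coords : Fin (5 * R) → V
      coords = remQuot R

      coords-vertex : ∀ p → coords (vertex p) ≡ p
      coords-vertex (c , i) = remQuot-combine {5} {R} c i

      vertex-coords : ∀ u → vertex (coords u) ≡ u
      vertex-coords = combine-remQuot {5} R

      Adj≡~ : ∀ p q → Adj G (vertex p) (vertex q) ≡ (p ~ q)
      Adj≡~ p q = cong₂ _~_ (coords-vertex p) (coords-vertex q)

      vertex-mono : ∀ p q → proj₁ p Fin.< proj₁ q → vertex p Fin.< vertex q
      vertex-mono (c , i) (d , j) = combine-monoˡ-< i j

    vertex-injective : ∀ {p q} → vertex p ≡ vertex q → p ≡ q
    vertex-injective {p} {q} e = trans (sym (coords-vertex p)) (trans (cong coords e) (coords-vertex q))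

    vertex-onto : ∀ u → ∃[ p ] u ≡ vertex p
    vertex-onto u = coords u , sym (vertex-coords u)

    ~⇒Adj : ∀ {p q} → p ~ q → Adj G (vertex p) (vertex q)
    ~⇒Adj {p} {q} = subst id (sym (Adj≡~ p q))

    Adj⇒~ : ∀ {p q} → Adj G (vertex p) (vertex q) → p ~ q
    Adj⇒~ {p} {q} = subst id (Adj≡~ p q)

    ≢⇒T : ∀ {i j : Fin R} → i ≢ j → T (not (does (i ≟ j)))
    ≢⇒T {i} {j} i≢j rewrite dec-false (i ≟ j) i≢j = tt

    T-refl : ∀ (i : Fin R) → T (does (i ≟ i))
    T-refl i rewrite dec-true (i ≟ i) refl = tt

    T⇒≡ : ∀ {k} {i j : Fin k} → T (does (i ≟ j)) → i ≡ j
    T⇒≡ {i = i} {j} t with i ≟ j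
    ... | yes e = e

    meets-i₀ : ∀ j → T (meets i₀ j)
    meets-i₀ j rewrite kind-i₀ = tt

    data Side : Fin 5 → Bool → Set where
      Xₛ : Side X true
      Cₛ : Side C true
      Hₛ : Side H true
      Zₛ : Side Z false
      Sₛ : Side S false

    side : ∀ c → ∃[ b ] Side c b
    side X = _ , Xₛ
    side C = _ , Cₛ
    side H = _ , Hₛ
    side Z = _ , Zₛ
    side S = _ , Sₛ

    same-side : ∀ {c d b} → Side c b → Side d b → ∀ i j → (c , i) ≢ (d , j) → (c , i) ~ (d , j)
    same-side Xₛ Xₛ i j ≢ = ≢⇒T (≢ ∘ cong (X ,_))
    same-side Xₛ Cₛ i j ≢ = tt
    same-side Xₛ Hₛ i j ≢ = tt
    same-side Cₛ Xₛ i j ≢ = tt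
    same-side Cₛ Cₛ i j ≢ = ≢⇒T (≢ ∘ cong (C ,_))
    same-side Cₛ Hₛ i j ≢ = tt
    same-side Hₛ Xₛ i j ≢ = tt
    same-side Hₛ Cₛ i j ≢ = tt
    same-side Hₛ Hₛ i j ≢ = ≢⇒T (≢ ∘ cong (H ,_))
    same-side Zₛ Zₛ i j ≢ = ≢⇒T (≢ ∘ cong (Z ,_))
    same-side Zₛ Sₛ i j ≢ = tt
    same-side Sₛ Zₛ i j ≢ = tt
    same-side Sₛ Sₛ i j ≢ = ≢⇒T (≢ ∘ cong (S ,_))

    -- Here c_{i₀}, which every choice meets, and the matching of H with Z ensure diameter at most
    -- 2.
    partner : ∀ {c} → Side c false → ∀ i → ∃[ d ] ∃[ j ] Side d true × (d , j) ~ (c , i)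
    partner Zₛ i = H , i , Hₛ , T-refl i
    partner Sₛ i = C , i₀ , Cₛ , meets-i₀ i

    ~-sym : ∀ p q → p ~ q → q ~ p
    ~-sym p q = subst T (adj-sym meets p q)

    -- For vertices of different cliques, the partner of the one in Z ∪ S lies in the clique of the
    -- other. It is not the other one itself, because the two are not adjacent.
    common : ∀ p q → p ≢ q → ¬ p ~ q → ∃[ m ] p ~ m × m ~ q
    common (c , i) (d , j) p≢q ¬p~q with side c | side d
    ... | true  , s | true  , t = ⊥-elim (¬p~q (same-side s t i j p≢q))
    ... | false , s | false , t = ⊥-elim (¬p~q (same-side s t i j p≢q))
    ... | true  , s | false , t = let e , k , r , m~q = partner t j in
      (e , k) , same-side s r i k (λ { refl → ¬p~q m~q }) , m~q
    ... | false , s | true  , t = let e , k , r , m~p = partner s i in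
      (e , k) , ~-sym (e , k) (c , i) m~p ,
      same-side r t k j (λ { refl → ¬p~q (~-sym (d , j) (c , i) m~p) })

    common-vertex : ∀ u v → u ≢ v → ¬ Adj G u v → ∃[ m ] Adj G u m × Adj G m v
    common-vertex u v u≢v ¬a with vertex-onto u | vertex-onto v
    ... | p , refl | q , refl = let m , x , y = common p q (u≢v ∘ cong vertex) (¬a ∘ ~⇒Adj)
                                in vertex m , ~⇒Adj x , ~⇒Adj y

    G-connected : Connected G
    G-connected u v with u ≟ v
    ... | yes refl = proj₁ (shortcut G ε)
    ... | no  u≢v with T? (adjacent G u v)
    ...   | yes a = proj₁ (path₁ G a)
    ...   | no ¬a = let m , x , y = common-vertex u v u≢v ¬a in proj₁ (path₂ G u≢v ¬a x y)

    sideOf : Fin (5 * R) → Bool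
    sideOf u = proj₁ (side (proj₁ (coords u)))

    left-clique : Subset (5 * R)
    left-clique = Vec.tabulate sideOf

    clique : ∀ {u v b} → sideOf u ≡ b → sideOf v ≡ b → u ≢ v → Adj G u v
    clique {u} {v} e refl u≢v with vertex-onto u | vertex-onto v
    ... | (c , i) , refl | (d , j) , refl rewrite coords-vertex (c , i) | coords-vertex (d , j) =
      ~⇒Adj (same-side (subst (Side c) e (proj₂ (side c))) (proj₂ (side d)) i j (u≢v ∘ cong vertex))

    G-coBipartite : CoBipartite G
    G-coBipartite = left-clique , (λ u∈ v∈ → clique (∈-left u∈) (∈-left v∈)) ,
                    (λ u∈ v∈ → clique (∈-right u∈) (∈-right v∈))
      where
      ∈-left : ∀ {u} → u ∈ left-clique → sideOf u ≡ true
      ∈-left {u} u∈ = trans (sym (lookup∘tabulate _ u)) ([]=⇒lookup u∈)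
      ∈-right : ∀ {u} → u ∈ ∁ left-clique → sideOf u ≡ false
      ∈-right {u} u∈ with sideOf u in eq
      ... | false = refl
      ... | true  = ⊥-elim (x∈∁p⇒x∉p u∈ (lookup⇒[]= u left-clique (trans (lookup∘tabulate _ u) eq)))

    -- A strong geodetic set meets every slot: x_i; z_i or h_i; the padding s_{i₀}
    -- or a trivial clause; the element clause of the group g or one of its choices.
    Slot : Set
    Slot = Fin R ⊎ Fin R ⊎ ⊤ ⊎ Fin Γ

    pattern at-x i = inj₁ i
    pattern at-z i = inj₂ (inj₁ i)
    pattern at-0   = inj₂ (inj₂ (inj₁ tt))
    pattern at-g g = inj₂ (inj₂ (inj₂ g))

    Slot-finite : Finite Slot
    Slot-finite = ⊎-finite (R , ↔-id _) (⊎-finite (R , ↔-id _) (⊎-finite ⊤-finite (Γ , ↔-id _)))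

    budget : ℕ
    budget = R + (R + (1 + Γ))

    private module SF = Inverse (proj₂ Slot-finite)

    slot# : Fin budget → Slot
    slot# = SF.from

    slot#-injective : ∀ {i j} → slot# i ≡ slot# j → i ≡ j
    slot#-injective {i} {j} e =
      trans (sym (SF.strictlyInverseˡ i)) (trans (cong SF.to e) (SF.strictlyInverseˡ j))

    module Forward (f : Fin Γ → Fin R) (grp-f : ∀ g → grp (f g) ≡ just g)
                   (sat : ∀ i → kind i ≡ clause → ∃[ g ] T (admits i (f g))) where

      base : Slot → V
      base (at-x i) = X , i
      base (at-z i) = Z , i
      base at-0     = C , i₀
      base (at-g g) = S , f g

      A : Subset (5 * R)
      A = image budget (vertex ∘ base ∘ slot#)

      ∈A⁺ : ∀ s → vertex (base s) ∈ A
      ∈A⁺ s = subst (λ s → vertex (base s) ∈ A) (SF.strictlyInverseʳ s)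
                (∈-image⁺ budget (vertex ∘ base ∘ slot#) (SF.to s))

      ∈A⁻ : ∀ {u} → u ∈ A → ∃[ s ] u ≡ vertex (base s)
      ∈A⁻ u∈ = let k , e = ∈-image⁻ budget (vertex ∘ base ∘ slot#) u∈ in slot# k , e

      -- The path from x_i to s_j takes c_i if this is possible and otherwise c_{i₀}. Apart from
      -- pairs starting in X only c_{i₀} and z_j are not adjacent; the last line sends their path
      -- through s_j.
      mid : V → V → V
      mid (X , i) (Z , j) = H , j
      mid (X , i) (S , j) = C , (if meets i j then i else i₀)
      mid (_ , i) (_ , j) = S , j

      -- Vertices are numbered class by class, so with u < v the classes come in the order X, C, H,
      -- Z, S and `mid` need not be symmetric.
      mid-ok : ∀ a b → toℕ (proj₁ (base a)) ≤ toℕ (proj₁ (base b)) → base a ≢ base b → ¬ base a ~ base b →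
               base a ~ mid (base a) (base b) × mid (base a) (base b) ~ base b
      mid-ok (at-x i) (at-x j) _ ≢ ≁ = ⊥-elim (≁ (same-side Xₛ Xₛ i j ≢))
      mid-ok (at-x i) at-0     _ ≢ ≁ = ⊥-elim (≁ tt)
      mid-ok (at-x i) (at-z j) _ ≢ ≁ = tt , T-refl j
      mid-ok (at-x i) (at-g g) _ ≢ ≁ = tt , meets-if
        where
        meets-if : T (meets (if meets i (f g) then i else i₀) (f g))
        meets-if with meets i (f g) in eq
        ... | true  = subst T (sym eq) tt
        ... | false = meets-i₀ (f g)
      mid-ok at-0     (at-x j) () ≢ ≁
      mid-ok at-0     at-0     _ ≢ ≁ = ⊥-elim (≢ refl)
      mid-ok at-0     (at-z j) _ ≢ ≁ = meets-i₀ j , tt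
      mid-ok at-0     (at-g g) _ ≢ ≁ = ⊥-elim (≁ (meets-i₀ (f g)))
      mid-ok (at-z i) (at-x j) () ≢ ≁
      mid-ok (at-z i) at-0     (s≤s ()) ≢ ≁
      mid-ok (at-z i) (at-z j) _ ≢ ≁ = ⊥-elim (≁ (same-side Zₛ Zₛ i j ≢))
      mid-ok (at-z i) (at-g g) _ ≢ ≁ = ⊥-elim (≁ tt)
      mid-ok (at-g g) (at-x j) () ≢ ≁
      mid-ok (at-g g) at-0     (s≤s ()) ≢ ≁
      mid-ok (at-g g) (at-z j) _ ≢ ≁ = ⊥-elim (≁ tt)
      mid-ok (at-g g) (at-g h) _ ≢ ≁ = ⊥-elim (≁ (same-side Sₛ Sₛ (f g) (f h) ≢))

      class-mono : ∀ p q → vertex p Fin.< vertex q → toℕ (proj₁ p) ≤ toℕ (proj₁ q)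
      class-mono p q u<v = ≮⇒≥ λ d<c → <-asym u<v (vertex-mono q p d<c)

      midᵛ : Fin (5 * R) → Fin (5 * R) → Fin (5 * R)
      midᵛ u v = vertex (mid (coords u) (coords v))

      midᵛ-vertex : ∀ p q → midᵛ (vertex p) (vertex q) ≡ vertex (mid p q)
      midᵛ-vertex p q = cong₂ (λ p q → vertex (mid p q)) (coords-vertex p) (coords-vertex q)

      midᵛ-ok : ∀ {u v} → u ∈ A → v ∈ A → u Fin.< v → ¬ Adj G u v → Adj G u (midᵛ u v) × Adj G (midᵛ u v) v
      midᵛ-ok u∈ v∈ u<v ¬a with ∈A⁻ u∈ | ∈A⁻ v∈
      ... | a , refl | b , refl rewrite midᵛ-vertex (base a) (base b) =
        let x , y = mid-ok a b (class-mono (base a) (base b) u<v)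
                      (λ e → <-irrefl (cong (toℕ ∘ vertex) e) u<v) (¬a ∘ ~⇒Adj)
        in ~⇒Adj x , ~⇒Adj y

      I : PathAssignment G A
      I {u} {v} u∈ v∈ u<v with T? (adjacent G u v)
      ... | yes a = path₁ G a
      ... | no ¬a = let x , y = midᵛ-ok u∈ v∈ u<v ¬a in path₂ G (λ { refl → <-irrefl refl u<v }) ¬a x y

      on-path : ∀ a b → proj₁ (base a) Fin.< proj₁ (base b) → ¬ base a ~ base b →
                LiesOn G {A} (vertex (mid (base a) (base b))) I
      on-path a b c<d ≁ = vertex (base a) , vertex (base b) , ∈A⁺ a , ∈A⁺ b , u<v ,
          subst (_∈ˡ vertices (proj₁ (I (∈A⁺ a) (∈A⁺ b) u<v))) (midᵛ-vertex (base a) (base b)) (middle (∈A⁺ a) (∈A⁺ b) u<v (≁ ∘ Adj⇒~))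
        where
        u<v = vertex-mono (base a) (base b) c<d
        middle : ∀ {u v} (u∈ : u ∈ A) (v∈ : v ∈ A) (u<v : u Fin.< v) → ¬ Adj G u v →
                 midᵛ u v ∈ˡ vertices (proj₁ (I u∈ v∈ u<v))
        middle {u} {v} u∈ v∈ u<v ¬a with T? (adjacent G u v)
        ... | yes a = ⊥-elim (¬a a)
        ... | no _  = there (here refl)

      met : ∀ i → ∃[ g ] T (meets i (f g))
      met i with kind i in eq
      ... | trivial   = g₀ , tt
      ... | element g = g , ok
        where
        ok : T (meets′ (element g) (grp (f g)) (admits i (f g)))
        ok rewrite grp-f g | dec-true (g ≟ g) refl = tt
      ... | clause    = let g , t = sat i eq in g , ok g t
        where
        ok : ∀ g → T (admits i (f g)) → T (meets′ clause (grp (f g)) (admits i (f g)))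
        ok g t rewrite grp-f g = t

      covers : ∀ p → LiesOn G {A} (vertex p) I ⊎ vertex p ∈ A
      covers (X , i) = inj₂ (∈A⁺ (at-x i))
      -- The pairs with first member x_i are reserved for c_i and h_i, and one chosen s_j that meets
      -- c_i is enough, so different clauses never compete for a path.
      covers (C , i) = inj₁ (let g , t = met i in
        subst (λ k → LiesOn G {A} (vertex (C , k)) I) (cong (if_then i else i₀) (Equivalence.to T-≡ t))
              (on-path (at-x i) (at-g g) (s≤s z≤n) (λ ())))
      covers (H , i) = inj₁ (on-path (at-x i) (at-z i) (s≤s z≤n) λ ())
      covers (Z , i) = inj₂ (∈A⁺ (at-z i))
      covers (S , i) = inj₁ (on-path at-0 (at-z i) (s≤s (s≤s z≤n)) λ ())

      strongGeodetic : IsStrongGeodetic G A × ∣ A ∣ ≤ budget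
      strongGeodetic = (I , λ w w∉ → covered w w∉ (vertex-onto w)) , ∣image∣≤ budget _
        where
        covered : ∀ w → w ∉ A → (∃[ p ] w ≡ vertex p) → LiesOn G {A} w I
        covered w w∉ (p , refl) with covers p
        ... | inj₁ on = on
        ... | inj₂ w∈ = ⊥-elim (w∉ w∈)

    module Backward (A : Subset (5 * R)) (geodetic : IsStrongGeodetic G A) (small : ∣ A ∣ ≤ budget) where

      neighbours : ∀ p → vertex p ∉ A → ∃[ q ] ∃[ r ]
        vertex q ∈ A × vertex r ∈ A × q ≢ r × ¬ q ~ r × q ~ p × p ~ r
      neighbours p p∉ with between G common-vertex (proj₁ geodetic) p∉ (proj₂ geodetic _ p∉)
      ... | u , v , u∈ , v∈ , u≢v , ¬a , x , y with vertex-onto u | vertex-onto v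
      ...   | q , refl | r , refl = q , r , u∈ , v∈ , u≢v ∘ cong vertex , ¬a ∘ ~⇒Adj , Adj⇒~ x , Adj⇒~ y

      -- The ends of the path that covers the vertex are not adjacent, so they lie in different
      -- cliques. Both are neighbours of the covered vertex, and one of them is in the clique
      -- opposite to it.
      across : ∀ {c b} → Side c b → ∀ i → vertex (c , i) ∉ A →
               ∃[ d ] ∃[ j ] Side d (not b) × vertex (d , j) ∈ A × (c , i) ~ (d , j)
      across {c} {b} s i p∉ with neighbours (c , i) p∉
      ... | (d , j) , (e , k) , q∈ , r∈ , q≢r , ≁ , x , y with side d | side e | b
      ...   | true  , t | true  , t′ | _     = ⊥-elim (≁ (same-side t t′ j k q≢r))
      ...   | false , t | false , t′ | _     = ⊥-elim (≁ (same-side t t′ j k q≢r))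
      ...   | true  , t | false , t′ | true  = e , k , t′ , r∈ , y
      ...   | false , t | true  , t′ | true  = d , j , t , q∈ , ~-sym (d , j) (c , i) x
      ...   | true  , t | false , t′ | false = d , j , t , q∈ , ~-sym (d , j) (c , i) x
      ...   | false , t | true  , t′ | false = e , k , t′ , r∈ , y

      x∈A : ∀ i → vertex (X , i) ∈ A
      x∈A i with vertex (X , i) ∈? A
      ... | yes x∈ = x∈
      ... | no  x∉ with across Xₛ i x∉
      ...   | _ , _ , Zₛ , _ , ()
      ...   | _ , _ , Sₛ , _ , ()

      z-or-h : ∀ i → Σ (Fin 5) λ c → vertex (c , i) ∈ A × (c ≡ Z ⊎ c ≡ H)
      z-or-h i with vertex (Z , i) ∈? A
      ... | yes z∈ = Z , z∈ , inj₁ refl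
      ... | no  z∉ with across Zₛ i z∉
      ...   | _ , j , Hₛ , h∈ , t = H , subst (λ j → vertex (H , j) ∈ A) (sym (T⇒≡ t)) h∈ , inj₂ refl

      meets-padding : ∀ i {j} → grp j ≡ nothing → T (meets i j) → kind i ≡ trivial
      meets-padding i {j} e t with kind i
      ... | trivial = refl
      ... | element g rewrite e = ⊥-elim t
      ... | clause  rewrite e = ⊥-elim t

      i₀-or-trivial : (vertex (S , i₀) ∈ A) ⊎ (∃[ i ] vertex (C , i) ∈ A × kind i ≡ trivial)
      i₀-or-trivial with vertex (S , i₀) ∈? A
      ... | yes s∈ = inj₁ s∈
      ... | no  s∉ with across Sₛ i₀ s∉
      ...   | _ , i , Cₛ , c∈ , t = inj₂ (i , c∈ , meets-padding i grp-i₀ t)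

      element-meets : ∀ g j → T (meets (el g) j) → grp j ≡ just g
      element-meets g j t rewrite kind-el g with grp j
      ... | just h  = cong just (sym (T⇒≡ t))

      picked : ∀ g → (vertex (C , el g) ∈ A) ⊎ (∃[ j ] vertex (S , j) ∈ A × grp j ≡ just g)
      picked g with vertex (C , el g) ∈? A
      ... | yes c∈ = inj₁ c∈
      ... | no  c∉ with across Cₛ (el g) c∉
      ...   | _ , j , Sₛ , s∈ , t = inj₂ (j , s∈ , element-meets g j t)

      group-slot : Maybe (Fin Γ) → Slot
      group-slot nothing  = at-0
      group-slot (just g) = at-g g

      kind-slot : Kind Γ → Maybe Slot
      kind-slot trivial     = just at-0
      kind-slot (element g) = just (at-g g)
      kind-slot clause      = nothing

      -- The only slot that a vertex can fill. As this is a function, vertices filling different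
      -- slots are different, which gives the lower bound. A proper clause fills none, so a set of
      -- the least size cannot contain it.
      slot : V → Maybe Slot
      slot (X , i) = just (at-x i)
      slot (C , i) = kind-slot (kind i)
      slot (H , i) = just (at-z i)
      slot (Z , i) = just (at-z i)
      slot (S , j) = just (group-slot (grp j))

      filled : ∀ s → ∃[ p ] vertex p ∈ A × slot p ≡ just s
      filled (at-x i) = _ , x∈A i , refl
      filled (at-z i) with z-or-h i
      ... | _ , v∈ , inj₁ refl = _ , v∈ , refl
      ... | _ , v∈ , inj₂ refl = _ , v∈ , refl
      filled at-0 with i₀-or-trivial
      ... | inj₁ s∈           = _ , s∈ , cong (just ∘ group-slot) grp-i₀
      ... | inj₂ (_ , c∈ , e) = _ , c∈ , cong kind-slot e
      filled (at-g g) with picked g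
      ... | inj₁ c∈           = _ , c∈ , cong kind-slot (kind-el g)
      ... | inj₂ (_ , s∈ , e) = _ , s∈ , cong (just ∘ group-slot) e

      base : Slot → V
      base s = proj₁ (filled s)

      base-slot : ∀ {s t} → base s ≡ base t → s ≡ t
      base-slot {s} {t} e = just-injective (trans (sym (proj₂ (proj₂ (filled s))))
                              (trans (cong slot e) (proj₂ (proj₂ (filled t)))))

      -- There are as many slots as the set may have vertices, so nothing else is in it.
      only-base : ∀ {p} → vertex p ∈ A → ∃[ s ] p ≡ base s × slot p ≡ just s
      only-base {p} p∈ = let k , e = exhausts (vertex ∘ base ∘ slot#)
                                       (λ e → slot#-injective (base-slot (vertex-injective e)))
                                       (λ k → proj₁ (proj₂ (filled (slot# k)))) small p∈
                             p≡    = vertex-injective {p} {base (slot# k)} e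
                         in slot# k , p≡ , trans (cong slot p≡) (proj₂ (proj₂ (filled (slot# k))))

      -- If the element clause of `g` fills the slot, the set contains no choice of `g`. Then no
      -- clause relies on this group, and any choice of `g` will do.
      choice-of : V → Fin Γ → Fin R
      choice-of (S , j) g = j
      choice-of (_ , _) g = deflt g

      f : Fin Γ → Fin R
      f g = choice-of (base (at-g g)) g

      grp-f : ∀ g → grp (f g) ≡ just g
      grp-f g with picked g
      ... | inj₁ _           = grp-deflt g
      ... | inj₂ (_ , _ , e) = e

      unpicked : ∀ i → kind i ≡ clause → vertex (C , i) ∉ A
      unpicked i e c∈ with trans (sym (cong kind-slot e)) (proj₂ (proj₂ (only-base c∈)))
      ... | ()

      -- Such a vertex fills the slot of `g`, and by `only-base` each slot is filled by just one
      -- vertex of the set.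
      f-picks : ∀ {j g} → vertex (S , j) ∈ A → grp j ≡ just g → f g ≡ j
      f-picks {j} {g} s∈ e =
        let s , p≡ , e′ = only-base s∈
            s≡ = just-injective (trans (sym (cong (just ∘ group-slot) e)) e′)
        in cong (λ p → choice-of p g) (sym (trans p≡ (cong base (sym s≡))))

      clause-meets : ∀ {i j} → kind i ≡ clause → T (meets i j) → ∃[ g ] grp j ≡ just g × T (admits i j)
      clause-meets {i} {j} e t rewrite e with grp j
      ... | just g = g , refl , t

      solution : Solution
      solution = f , grp-f , satisfied
        where
        satisfied : ∀ i → kind i ≡ clause → ∃[ g ] T (admits i (f g))
        satisfied i e = pick (across Cₛ i (unpicked i e))
          where
          pick : (∃[ d ] ∃[ j ] Side d false × vertex (d , j) ∈ A × (C , i) ~ (d , j)) →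
                 ∃[ g ] T (admits i (f g))
          pick (_ , j , Sₛ , s∈ , t) =
            let g , eq , t′ = clause-meets e t
            in g , subst (λ j → T (admits i j)) (sym (f-picks s∈ eq)) t′

    reduction : (∃[ A ] IsStrongGeodetic G A × ∣ A ∣ ≤ budget) ⇔ Solution
    reduction = mk⇔ (λ (A , geo , small) → Backward.solution A geo small)
                    (λ (f , grp-f , sat) → _ , Forward.strongGeodetic f grp-f sat)

-- Computation tableaux relative to the head

module Tableaux where

  open import Data.Bool.Base as Bool using (Bool; true; false; if_then_else_)
  open import Data.Empty using (⊥-elim)
  open import Data.Fin.Base using (zero; suc)
  open import Data.List.Base as List using (List; []; _∷_; [_]; length)
  open import Data.Maybe.Base using (just; nothing; maybe′; fromMaybe)
  open import Data.Nat.Base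
  open import Data.Nat.Properties
  open import Data.Product.Base using (_×_; _,_; proj₁; proj₂)
  open import Data.Sum.Base using (_⊎_; inj₁; inj₂)
  open import Data.Unit.Base using (tt)
  open import Data.Vec.Base as Vec using (Vec; []; _∷_)
  open import Function.Base using (_∘_)
  open import Relation.Nullary using (yes; no; ¬_)
  open import Relation.Binary.PropositionalEquality hiding ([_])

  open Terms using (bitAt; code)

  nth : List Symbol → ℕ → Symbol
  nth []       _       = nothing
  nth (s ∷ _)  zero    = s
  nth (_ ∷ ss) (suc k) = nth ss k

  -- The cell at position j when the head is at position W.
  at-pos : ℕ → Tape → ℕ → Symbol
  at-pos zero    tp j       = nth (scanned tp ∷ right tp) j
  at-pos (suc W) tp zero    = nth (left tp) W
  at-pos (suc W) tp (suc j) = at-pos W tp j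

  written : ℕ → Symbol → Tape → ℕ → Symbol
  written W w tp j = if j ≡ᵇ W then w else at-pos W tp j

  at-written : ∀ W w tp j → at-pos W (tape (left tp) w (right tp)) j ≡ written W w tp j
  at-written zero    w tp zero    = refl
  at-written zero    w tp (suc j) = refl
  at-written (suc W) w tp zero    = refl
  at-written (suc W) w tp (suc j) = at-written W w tp j

  at-goRight : ∀ W tp j → at-pos W (moveHead goRight tp) j ≡ at-pos W tp (suc j)
  at-goRight zero          (tape ls a [])       zero    = refl
  at-goRight zero          (tape ls a [])       (suc j) = refl
  at-goRight zero          (tape ls a (r ∷ rs)) zero    = refl
  at-goRight zero          (tape ls a (r ∷ rs)) (suc j) = refl
  at-goRight (suc zero)    (tape ls a [])       zero    = refl
  at-goRight (suc zero)    (tape ls a (r ∷ rs)) zero    = refl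
  at-goRight (suc (suc W)) (tape ls a [])       zero    = refl
  at-goRight (suc (suc W)) (tape ls a (r ∷ rs)) zero    = refl
  at-goRight (suc W)       tp                   (suc j) = at-goRight W tp j

  at-goLeft : ∀ W tp j → at-pos W (moveHead goLeft tp) (suc j) ≡ at-pos W tp j
  at-goLeft zero          (tape [] a rs)       j       = refl
  at-goLeft zero          (tape (l ∷ ls) a rs) j       = refl
  at-goLeft (suc zero)    (tape [] a rs)       zero    = refl
  at-goLeft (suc (suc W)) (tape [] a rs)       zero    = refl
  at-goLeft (suc zero)    (tape (l ∷ ls) a rs) zero    = refl
  at-goLeft (suc (suc W)) (tape (l ∷ ls) a rs) zero    = refl
  at-goLeft (suc W)       tp                   (suc j) = at-goLeft W tp j

  pick : ∀ {A : Set} → Move → A → A → A → A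
  pick goLeft  l c r = l
  pick stay    l c r = c
  pick goRight l c r = r

  -- As the head stays at position `W`, its move appears as a shift of the whole tape by one cell in
  -- the opposite direction.
  at-writeMove : ∀ W w m tp j → at-pos W (writeMove (w , m) tp) (suc j) ≡
    pick m (written W w tp j) (written W w tp (suc j)) (written W w tp (suc (suc j)))
  at-writeMove W w goLeft  tp j = trans (at-goLeft W _ j) (at-written W w tp j)
  at-writeMove W w stay    tp j = at-written W w tp (suc j)
  at-writeMove W w goRight tp j = trans (at-goRight W _ (suc j)) (at-written W w tp (suc (suc j)))

  at-head : ∀ W tp → at-pos W tp W ≡ scanned tp
  at-head zero    tp = refl
  at-head (suc W) tp = at-head W tp

  at-right : ∀ W tp → at-pos W tp (suc W) ≡ nth (right tp) 0
  at-right zero    tp = refl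
  at-right (suc W) tp = at-right W tp

  symbolAt : BitString → ℕ → Symbol
  symbolAt []       _       = nothing
  symbolAt (b ∷ _)  zero    = just b
  symbolAt (_ ∷ bs) (suc k) = symbolAt bs k

  symbolAt-past : ∀ x {k} → length x ≤ k → symbolAt x k ≡ nothing
  symbolAt-past []      _         = refl
  symbolAt-past (_ ∷ x) (s≤s l≤k) = symbolAt-past x l≤k

  symbolAt-chain : ∀ x k → symbolAt x k ≡ nothing → symbolAt x (suc k) ≡ nothing
  symbolAt-chain []      k       e = refl
  symbolAt-chain (b ∷ x) (suc k) e = symbolAt-chain x k e

  at-blank : ∀ W j → at-pos W blankTape j ≡ nothing
  at-blank zero    zero    = refl
  at-blank zero    (suc j) = refl
  at-blank (suc W) zero    = refl
  at-blank (suc W) (suc j) = at-blank W j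

  at-input-left : ∀ {W} x {j} → j < W → at-pos W (inputTape x) j ≡ nothing
  at-input-left {suc W} []      {zero}  _   = refl
  at-input-left {suc W} (b ∷ x) {zero}  _   = refl
  at-input-left {suc W} x       {suc j} j<W = at-input-left x (s≤s⁻¹ j<W)

  at-input : ∀ W x i → at-pos W (inputTape x) (W + i) ≡ symbolAt x i
  at-input zero    []      zero    = refl
  at-input zero    []      (suc i) = refl
  at-input zero    (b ∷ x) zero    = refl
  at-input zero    (b ∷ x) (suc i) = lemma x i
    where
    lemma : ∀ x i → nth (List.map just x) i ≡ symbolAt x i
    lemma []      i       = refl
    lemma (b ∷ x) zero    = refl
    lemma (b ∷ x) (suc i) = lemma x i
  at-input (suc W) x       i       = at-input W x i

  symbolCode : Symbol → ℕ
  symbolCode nothing  = 0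
  symbolCode (just b) = code b

  symbolCode-at : ∀ x k → symbolCode (symbolAt x k) ≡ bitAt x k
  symbolCode-at []      k       = refl
  symbolCode-at (b ∷ x) zero    = refl
  symbolCode-at (b ∷ x) (suc k) = symbolCode-at x k

  symbolCode-injective : ∀ {r s} → symbolCode r ≡ symbolCode s → r ≡ s
  symbolCode-injective {nothing}    {nothing}    e = refl
  symbolCode-injective {nothing}    {just false} ()
  symbolCode-injective {nothing}    {just true}  ()
  symbolCode-injective {just false} {nothing}    ()
  symbolCode-injective {just true}  {nothing}    ()
  symbolCode-injective {just false} {just false} e = refl
  symbolCode-injective {just true}  {just true}  e = refl

  bitsFrom : ℕ → (ℕ → Symbol) → BitString
  bitsFrom zero    s = []
  bitsFrom (suc n) s = maybe′ (λ b → b ∷ bitsFrom n (s ∘ suc)) [] (s 0)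

  length-bitsFrom : ∀ n s → length (bitsFrom n s) ≤ n
  length-bitsFrom zero    s = z≤n
  length-bitsFrom (suc n) s with s 0
  ... | nothing = z≤n
  ... | just b  = s≤s (length-bitsFrom n (s ∘ suc))

  symbolAt-bitsFrom : ∀ n s → (∀ i → suc i < n → s i ≡ nothing → s (suc i) ≡ nothing) →
                      ∀ i → i < n → symbolAt (bitsFrom n s) i ≡ s i
  symbolAt-bitsFrom (suc n) s chain i i<n with s 0 in eq
  ... | nothing = sym (blank i i<n)
    where
    blank : ∀ i → i < suc n → s i ≡ nothing
    blank zero    _   = eq
    blank (suc i) i<n = chain i i<n (blank i (<⇒≤ i<n))
  symbolAt-bitsFrom (suc n) s chain zero    i<n | just b = sym eq
  symbolAt-bitsFrom (suc n) s chain (suc i) i<n | just b =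
    symbolAt-bitsFrom n (s ∘ suc) (λ i i<n → chain (suc i) (s≤s i<n)) i (s≤s⁻¹ i<n)

  module Tableau (M : TM 2) where
    open TM M

    -- A cell records whether it is in the head column, the state, and the symbols of all tapes in
    -- its column. Every tape is drawn relative to its own head, so the cell at `W` alone determines
    -- the transition, wherever the heads have moved.
    Val : Set
    Val = Bool × State × Vec Symbol tapes

    isHead : Val → Bool
    isHead = proj₁

    out xsym ysym : Val → Symbol
    out  (_ , _ , o ∷ _)         = o
    xsym (_ , _ , _ ∷ s ∷ _)     = s
    ysym (_ , _ , _ ∷ _ ∷ s ∷ _) = s

    column : ∀ {m} → ℕ → Vec Tape m → ℕ → Vec Symbol m
    column W ts j = Vec.map (λ tp → at-pos W tp j) ts

    cellOf : ℕ → Config → ℕ → Val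
    cellOf W (q , ts) j = (j ≡ᵇ W) , q , column W ts j

    -- The Booleans tell which of the three neighbouring cells is the head cell; there the written
    -- symbol replaces the old one before the shift.
    shift : ∀ {m} → Bool → Bool → Bool → Vec (Symbol × Move) m →
            Vec Symbol m → Vec Symbol m → Vec Symbol m → Vec Symbol m
    shift l c r []             _        _        _        = []
    shift l c r ((w , m) ∷ as) (a ∷ as₁) (b ∷ bs) (d ∷ ds) =
      pick m (if l then w else a) (if c then w else b) (if r then w else d) ∷ shift l c r as as₁ bs ds

    -- The new contents of a cell, from the old contents of the head cell and of
    -- the three cells around it.
    successor : Val → Val → Val → Val → Val
    successor (_ , q , scan) (hl , _ , l) (hc , _ , c) (hr , _ , r) =
      maybe′ (λ (q′ , as) → hc , q′ , shift hl hc hr as l c r) (hc , q , c) (δ q scan)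

    -- A halted configuration repeats itself, so that a table of fixed height also records shorter
    -- runs.
    stepOrStay : Config → Config
    stepOrStay c = fromMaybe c (step c)

    conf : Config → ℕ → Config
    conf c zero    = c
    conf c (suc t) = stepOrStay (conf c t)

    column-head : ∀ {m} W (ts : Vec Tape m) → column W ts W ≡ Vec.map scanned ts
    column-head W []       = refl
    column-head W (t ∷ ts) = cong₂ _∷_ (at-head W t) (column-head W ts)

    column-shift : ∀ {m} W (as : Vec (Symbol × Move) m) (ts : Vec Tape m) j →
      column W (Vec.zipWith writeMove as ts) (suc j) ≡
      shift (j ≡ᵇ W) (suc j ≡ᵇ W) (suc (suc j) ≡ᵇ W) as (column W ts j) (column W ts (suc j)) (column W ts (suc (suc j)))
    column-shift W []             []       j = refl
    column-shift W ((w , m) ∷ as) (t ∷ ts) j = cong₂ _∷_ (at-writeMove W w m t j) (column-shift W as ts j)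

    cell-step : ∀ W c j → cellOf W (stepOrStay c) (suc j) ≡
      successor (cellOf W c W) (cellOf W c j) (cellOf W c (suc j)) (cellOf W c (suc (suc j)))
    cell-step W (q , ts) j rewrite column-head W ts with δ q (Vec.map scanned ts)
    ... | nothing       = refl
    ... | just (q′ , as) = cong (λ v → (suc j ≡ᵇ W) , q′ , v) (column-shift W as ts j)

    conf-shift : ∀ c t → conf c (suc t) ≡ conf (stepOrStay c) t
    conf-shift c zero    = refl
    conf-shift c (suc t) = cong stepOrStay (conf-shift c t)

    conf-halted : ∀ {c t d} T → HaltsIn c t d → t ≤ T → conf c T ≡ d
    conf-halted zero    (halted e) _ = refl
    conf-halted {c} (suc T) (halted e) _ = trans (cong stepOrStay (conf-halted T (halted e) z≤n)) (cong (fromMaybe c) e)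
    conf-halted {c} (suc T) (steps {c′ = c′} e h) (s≤s t≤T) =
      trans (conf-shift c T) (trans (cong (λ s → conf (fromMaybe c s) T) e) (conf-halted T h t≤T))

    startVal : Bool → Symbol → Symbol → Val
    startVal h r s = h , start , nothing ∷ r ∷ s ∷ Vec.replicate workTapes nothing

    initialFor : BitString → BitString → Config
    initialFor x y = initial (x ∷ y ∷ [])

    cell-initial : ∀ W x y j → cellOf W (initialFor x y) j ≡
      startVal (j ≡ᵇ W) (at-pos W (inputTape x) j) (at-pos W (inputTape y) j)
    cell-initial W x y j = cong₂ (λ o ws → (j ≡ᵇ W) , start , o ∷ at-pos W (inputTape x) j ∷ at-pos W (inputTape y) j ∷ ws)
      (at-blank W j) (blanks workTapes)
      where
      blanks : ∀ w → column W (Vec.replicate w blankTape) j ≡ Vec.replicate w nothing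
      blanks zero    = refl
      blanks (suc w) = cong₂ _∷_ (at-blank W j) (blanks w)

    module _ (T P : ℕ) (x : BitString) where

      -- Light cones: what happens outside the window of width H cannot reach the
      -- two cells right of the head that are read off in row T.
      W H : ℕ
      W = suc T
      H = suc (W + W)

      -- The condition on a cell of row 0, in terms of its left neighbour u.
      record Initial (j : ℕ) (u v : Val) : Set where
        field
          start-shape : v ≡ startVal (isHead v) (xsym v) (ysym v)
          head-here   : (j ≡ W × isHead v ≡ true) ⊎ (j ≢ W × isHead v ≡ false)
          x-here      : (j < W × symbolCode (xsym v) ≡ 0) ⊎ (¬ j < W × symbolCode (xsym v) ≡ bitAt x (j ∸ W))
          y-left      : ¬ j < W ⊎ ysym v ≡ nothing
          y-right     : j < W + P ⊎ ysym v ≡ nothing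
          -- From the head on, a blank is followed only by blanks, so the guessed symbols form one
          -- string.
          y-chain     : ¬ W < j ⊎ ysym u ≢ nothing ⊎ ysym v ≡ nothing
      open Initial

      record Accepting (cell : ℕ → ℕ → Val) : Set where
        field
          row-0  : ∀ j → j < H → Initial j (cell 0 (pred j)) (cell 0 j)
          rows   : ∀ t j → t < T → suc (suc j) < H → cell (suc t) (suc j) ≡
                     successor (cell t W) (cell t j) (cell t (suc j)) (cell t (suc (suc j)))
          -- The output is `[ true ]` exactly if the head of the output tape reads 1 and the next
          -- cell is blank.
          reads-true  : out (cell T W) ≡ just true
          reads-blank : out (cell T (suc W)) ≡ nothing
      open Accepting

      out-cell : ∀ c j → out (cellOf W c j) ≡ at-pos W (Vec.head (proj₂ c)) j
      out-cell (q , t ∷ ts) j = refl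

      accepted⇒ : ∀ y → length y ≤ P → output (conf (initialFor x y) T) ≡ [ true ] →
                  Accepting (λ t → cellOf W (conf (initialFor x y) t))
      row-0 (accepted⇒ y y≤P acc) j j<H = subst₂ (Initial j) (sym (cell-initial W x y (pred j))) (sym (cell-initial W x y j)) (record
        { start-shape = refl
        ; head-here   = here
        ; x-here      = xs
        ; y-left      = ys
        ; y-right     = yr
        ; y-chain     = yc j })
        where
        Y : ℕ → Symbol
        Y = at-pos W (inputTape y)
        here : (j ≡ W × (j ≡ᵇ W) ≡ true) ⊎ (j ≢ W × (j ≡ᵇ W) ≡ false)
        here with j ≡ᵇ W in eq
        ... | true  = inj₁ (≡ᵇ⇒≡ j W (subst Bool.T (sym eq) tt) , refl)
        ... | false = inj₂ ((λ e → subst Bool.T eq (≡⇒≡ᵇ j W e)) , refl)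
        right-of : ¬ j < W → j ≡ W + (j ∸ W)
        right-of j≮W = sym (m+[n∸m]≡n (≮⇒≥ j≮W))
        xs : (j < W × symbolCode (at-pos W (inputTape x) j) ≡ 0) ⊎
             (¬ j < W × symbolCode (at-pos W (inputTape x) j) ≡ bitAt x (j ∸ W))
        xs with j <? W
        ... | yes j<W = inj₁ (j<W , cong symbolCode (at-input-left x j<W))
        ... | no  j≮W = inj₂ (j≮W , trans (cong symbolCode (trans (cong (at-pos W (inputTape x)) (right-of j≮W)) (at-input W x (j ∸ W))))
                                          (symbolCode-at x (j ∸ W)))
        ys : ¬ j < W ⊎ Y j ≡ nothing
        ys with j <? W
        ... | yes j<W = inj₂ (at-input-left y j<W)
        ... | no  j≮W = inj₁ j≮W
        yr : j < W + P ⊎ Y j ≡ nothing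
        yr with j <? W + P
        ... | yes j< = inj₁ j<
        ... | no  j≮ = inj₂ (trans (cong Y (right-of j≮W)) (trans (at-input W y (j ∸ W))
                         (symbolAt-past y (≤-trans y≤P (≤-trans (≤-reflexive (sym (m+n∸m≡n W P))) (∸-monoˡ-≤ W (≮⇒≥ j≮)))))))
          where
          j≮W : ¬ j < W
          j≮W j<W = j≮ (<-≤-trans j<W (m≤m+n W P))
        yc : ∀ j → ¬ W < j ⊎ Y (pred j) ≢ nothing ⊎ Y j ≡ nothing
        yc zero    = inj₁ λ ()
        yc (suc j) with W <? suc j
        ... | no  W≮ = inj₁ W≮
        ... | yes W≤j with Y j in eq
        ...   | just _  = inj₂ (inj₁ λ ())
        ...   | nothing = inj₂ (inj₂ (trans (cong Y (sym j≡)) (trans (at-input W y (suc (j ∸ W)))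
                            (symbolAt-chain y (j ∸ W) (trans (sym (at-input W y (j ∸ W))) (trans (cong Y (m+[n∸m]≡n (s≤s⁻¹ W≤j))) eq))))))
          where
          j≡ : W + suc (j ∸ W) ≡ suc j
          j≡ = trans (+-suc W (j ∸ W)) (cong suc (m+[n∸m]≡n (s≤s⁻¹ W≤j)))
      rows (accepted⇒ y y≤P acc) t j t<T j<H = cell-step W (conf (initialFor x y) t) j
      reads-true (accepted⇒ y y≤P acc) = trans (out-cell c W) (trans (at-head W t₀) (scans t₀ acc))
        where
        c  = conf (initialFor x y) T
        t₀ = Vec.head (proj₂ c)
        scans : ∀ tp → tapeContents tp ≡ [ true ] → scanned tp ≡ just true
        scans (tape _ (just true) _) e = refl
      reads-blank (accepted⇒ y y≤P acc) = trans (out-cell c (suc W)) (trans (at-right W t₀) (blank t₀ acc))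
        where
        c  = conf (initialFor x y) T
        t₀ = Vec.head (proj₂ c)
        blank : ∀ tp → tapeContents tp ≡ [ true ] → nth (right tp) 0 ≡ nothing
        blank (tape _ (just true) [])            e = refl
        blank (tape _ (just true) (nothing ∷ _)) e = refl

      module _ (cell : ℕ → ℕ → Val) (A : Accepting cell) where

        guessed : ℕ → Symbol
        guessed i = ysym (cell 0 (W + i))

        -- The window shows `suc W` cells from the head on, so no more than this can be read off.
        -- The string obtained is a certificate in its own right, and row 0 agrees with its initial
        -- configuration on the whole window.
        n : ℕ
        n = P ⊓ suc W

        certificate : BitString
        certificate = bitsFrom n guessed

        certificate-≤ : length certificate ≤ P
        certificate-≤ = ≤-trans (length-bitsFrom n guessed) (m⊓n≤m P (suc W))

        in-window : ∀ {i} → i < suc W → W + i < H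
        in-window i<n = s≤s (+-monoʳ-≤ W (s≤s⁻¹ i<n))

        guessed-chain : ∀ i → suc i < n → guessed i ≡ nothing → guessed (suc i) ≡ nothing
        guessed-chain i i<n e with y-chain (row-0 A (W + suc i) (in-window (≤-trans i<n (m⊓n≤n P (suc W)))))
        ... | inj₁ W≮        = ⊥-elim (W≮ (m<m+n W z<s))
        ... | inj₂ (inj₂ e′) = e′
        ... | inj₂ (inj₁ ≢)  = ⊥-elim (≢ (trans (cong (λ k → ysym (cell 0 (pred k))) (+-suc W i)) e))

        guessed-right : ∀ i → i < suc W → symbolAt certificate i ≡ guessed i
        guessed-right i i≤W with i <? P
        ... | yes i<P = symbolAt-bitsFrom n guessed guessed-chain i (⊓-pres-m< i<P i≤W)
        ... | no  i≮P with y-right (row-0 A (W + i) (in-window i≤W))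
        ...   | inj₁ i<  = ⊥-elim (i≮P (+-cancelˡ-< W i P i<))
        ...   | inj₂ e   = trans (symbolAt-past certificate (≤-trans certificate-≤ (≮⇒≥ i≮P))) (sym e)

        row-0-correct : ∀ j → j < H → cell 0 j ≡ cellOf W (initialFor x certificate) j
        row-0-correct j j<H = trans (start-shape I) (trans
          (cong₂ (λ h (r , s) → startVal h r s) head≡ (cong₂ _,_ x≡ y≡)) (sym (cell-initial W x certificate j)))
          where
          I = row-0 A j j<H
          head≡ : isHead (cell 0 j) ≡ (j ≡ᵇ W)
          head≡ with head-here I | j ≡ᵇ W in eq
          ... | inj₁ (e , h) | true  = h
          ... | inj₁ (e , h) | false = ⊥-elim (subst Bool.T eq (≡⇒≡ᵇ j W e))
          ... | inj₂ (e , h) | true  = ⊥-elim (e (≡ᵇ⇒≡ j W (subst Bool.T (sym eq) tt)))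
          ... | inj₂ (e , h) | false = h
          right-of : ¬ j < W → W + (j ∸ W) ≡ j
          right-of j≮W = m+[n∸m]≡n (≮⇒≥ j≮W)
          x≡ : xsym (cell 0 j) ≡ at-pos W (inputTape x) j
          x≡ with x-here I
          ... | inj₁ (j<W , e) = trans (symbolCode-injective e) (sym (at-input-left x j<W))
          ... | inj₂ (j≮W , e) = trans (symbolCode-injective (trans e (sym (symbolCode-at x (j ∸ W)))))
                                   (trans (sym (at-input W x (j ∸ W))) (cong (at-pos W (inputTape x)) (right-of j≮W)))
          y≡ : ysym (cell 0 j) ≡ at-pos W (inputTape certificate) j
          y≡ with j <? W
          ... | yes j<W with y-left I
          ...   | inj₁ j≮W = ⊥-elim (j≮W j<W)
          ...   | inj₂ e   = trans e (sym (at-input-left certificate j<W))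
          y≡ | no j≮W = trans (cong (ysym ∘ cell 0) (sym (right-of j≮W)))
            (trans (sym (guessed-right (j ∸ W) (+-cancelˡ-< W _ _ (≤-trans (s≤s (≤-reflexive (right-of j≮W)))
                      (≤-trans j<H (≤-reflexive (sym (+-suc W W))))))))
            (trans (sym (at-input W certificate (j ∸ W))) (cong (at-pos W (inputTape certificate)) (right-of j≮W))))

        -- The outermost cells of a row have no rule, so every step loses one column on either side.
        -- As H = 2T + 3, row T keeps the columns T, T + 1 and T + 2, and the last two are `W` and
        -- `suc W`, which are read off.
        row-correct : ∀ t j → t ≤ T → t ≤ j → j + t < H → cell t j ≡ cellOf W (conf (initialFor x certificate) t) j
        row-correct zero    j       _   _         j< = row-0-correct j (subst (_< H) (+-identityʳ j) j<)
        row-correct (suc t) (suc j) t<T (s≤s t≤j) j< = trans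
          (rows A t j t<T (≤-trans (s≤s (m≤m+n _ t)) j+2+t<H))
          (trans (cong₂ (λ a (b , c , d) → successor a b c d)
                   (row-correct t W t≤T (m≤n⇒m≤1+n t≤T) (s≤s (+-monoʳ-≤ W (m≤n⇒m≤1+n t≤T))))
                   (cong₂ _,_ (row-correct t j t≤T t≤j (<⇒≤ (<⇒≤ j+2+t<H)))
                     (cong₂ _,_ (row-correct t (suc j) t≤T (m≤n⇒m≤1+n t≤j) (<⇒≤ j+2+t<H))
                                (row-correct t (suc (suc j)) t≤T (m≤n⇒m≤1+n (m≤n⇒m≤1+n t≤j)) j+2+t<H))))
                 (sym (cell-step W (conf (initialFor x certificate) t) j)))
          where
          t≤T = <⇒≤ t<T
          j+2+t<H : suc (suc j) + t < H
          j+2+t<H = subst (λ k → suc k < H) (+-suc j t) j<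

        accepted : output (conf (initialFor x certificate) T) ≡ [ true ]
        accepted = contents-true t₀
          (trans (sym (trans (out-cell c W) (at-head W t₀)))
            (trans (cong out (sym (row-correct T W ≤-refl (n≤1+n T) (s≤s (+-monoʳ-≤ W (n≤1+n T)))))) (reads-true A)))
          (trans (sym (trans (out-cell c (suc W)) (at-right W t₀)))
            (trans (cong out (sym (row-correct T (suc W) ≤-refl (m≤n⇒m≤1+n (n≤1+n T)) (s≤s (≤-reflexive (sym (+-suc W T)))))))
                   (reads-blank A)))
          where
          c  = conf (initialFor x certificate) T
          t₀ = Vec.head (proj₂ c)
          contents-true : ∀ tp → scanned tp ≡ just true → nth (right tp) 0 ≡ nothing → tapeContents tp ≡ [ true ]
          contents-true (tape _ (just true) [])            refl refl = refl
          contents-true (tape _ (just true) (nothing ∷ _)) refl refl = refl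

-- Reflection of formulas, printing of lists and binary numerals

module Formulas where

  open import Data.Bool.Base using (Bool; true; false; T)
  open import Data.Empty using (⊥-elim)
  open import Data.Fin.Base using (Fin; zero; suc; toℕ; combine; _↑ˡ_; _↑ʳ_)
  open import Data.Fin.Properties using (toℕ-injective)
  open import Data.List.Base using (List; []; _∷_; [_]; _++_; concat; tabulate)
  open import Data.List.Properties using (++-assoc; ++-identityʳ; tabulate-cong)
  open import Data.Nat.Base hiding (_⊔_)
  open import Data.Nat.Binary.Base using (zero; 2[1+_]; 1+[2_]; fromℕ) renaming (toℕ to toℕᵇ)
  open import Data.Nat.Binary.Properties using () renaming (toℕ-fromℕ to toℕᵇ-fromℕ; toℕ-injective to toℕᵇ-injective)
  open import Data.Nat.Properties
  open import Data.Nat.Tactic.RingSolver using (solve-∀)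
  open import Data.Product.Base using (∃; ∃-syntax; _×_; _,_)
  open import Data.Sum.Base using (_⊎_; inj₁; inj₂)
  open import Data.Unit.Base using (tt)
  open import Data.Vec.Base using (Vec; []; _∷_)
  open import Function.Base using (_∘_)
  open import Relation.Nullary using (Dec; does; proof)
  open import Relation.Nullary.Reflects
  open import Relation.Binary.PropositionalEquality hiding ([_])

  open Terms

  T⇒ : ∀ {P : Set} {b} → Reflects P b → T b → P
  T⇒ (ofʸ p) _ = p

  ⇒T : ∀ {P : Set} {b} → Reflects P b → P → T b
  ⇒T (ofʸ _)  _ = tt
  ⇒T (ofⁿ ¬p) p = ⊥-elim (¬p p)

  reflects-map : ∀ {P Q : Set} {b} → (P → Q) → (Q → P) → Reflects P b → Reflects Q b
  reflects-map f g (ofʸ p)  = ofʸ (f p)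
  reflects-map f g (ofⁿ ¬p) = ofⁿ (¬p ∘ g)

  reflects-≡ : ∀ {P : Set} {b b′} → b′ ≡ b → Reflects P b → Reflects P b′
  reflects-≡ refl r = r

  allTo-reflects : ∀ {P : ℕ → Set} n {f} → (∀ k → k < n → Reflects (P k) (f k)) →
                   Reflects (∀ k → k < n → P k) (allTo n f)
  allTo-reflects zero    h = ofʸ λ k ()
  allTo-reflects (suc n) h = reflects-map
    (λ (p , ps) k k≤n → helper p ps (m≤n⇒m<n∨m≡n (s≤s⁻¹ k≤n)))
    (λ ps → ps n ≤-refl , λ k k<n → ps k (m<n⇒m<1+n k<n))
    (h n ≤-refl ×-reflects allTo-reflects n (λ k k<n → h k (m<n⇒m<1+n k<n)))
    where
    helper : ∀ {P : ℕ → Set} {k} → P n → (∀ k → k < n → P k) → k < n ⊎ k ≡ n → P k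
    helper p ps (inj₁ k<n)  = ps _ k<n
    helper p ps (inj₂ refl) = p

  anyTo-reflects : ∀ {P : ℕ → Set} n {f} → (∀ k → k < n → Reflects (P k) (f k)) →
                   Reflects (∃[ k ] k < n × P k) (anyTo n f)
  anyTo-reflects zero    h = ofⁿ λ (k , k<0 , _) → n≮0 k<0
  anyTo-reflects {P} (suc n) h = reflects-map
    (λ { (inj₁ p) → n , ≤-refl , p ; (inj₂ (k , k<n , p)) → k , m<n⇒m<1+n k<n , p })
    (λ (k , k≤n , p) → helper p (m≤n⇒m<n∨m≡n (s≤s⁻¹ k≤n)))
    (h n ≤-refl ⊎-reflects anyTo-reflects n (λ k k<n → h k (m<n⇒m<1+n k<n)))
    where
    helper : ∀ {k} → P k → k < n ⊎ k ≡ n → P n ⊎ (∃[ k ] k < n × P k)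
    helper p (inj₁ k<n)  = inj₂ (_ , k<n , p)
    helper p (inj₂ refl) = inj₁ p

  ≡ᵇ-reflects : ∀ {a b m n} → a ≡ m → b ≡ n → Reflects (m ≡ n) (a ≡ᵇ b)
  ≡ᵇ-reflects {a} {b} refl refl = fromEquivalence (≡ᵇ⇒≡ a b) (≡⇒≡ᵇ a b)

  <ᵇ-reflects : ∀ {a b m n} → a ≡ m → b ≡ n → Reflects (m < n) (a <ᵇ b)
  <ᵇ-reflects {a} {b} refl refl = <ᵇ-reflects-< a b

  module _ {i n : ℕ} where

    constᶠ : Bool → Fm i n
    constᶠ true  = lit 0 ≐ lit 0
    constᶠ false = lit 0 ≐ lit 1

    anyᶠ : ∀ {m} → (Fin m → Fm i n) → Fm i n
    anyᶠ {zero}  f = constᶠ false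
    anyᶠ {suc m} f = f zero ∨ᶠ anyᶠ (f ∘ suc)

    -- A relation between finite sets is spelled out as a disjunction over all pairs. The size of
    -- the formula depends on the machine only and not on the input.
    table : ∀ {m k} {P : Fin m → Fin k → Set} → (∀ a b → Dec (P a b)) → Tm i n → Tm i n → Fm i n
    table P? s t = anyᶠ λ a → (s ≐ lit (toℕ a)) ∧ᶠ anyᶠ λ b → (t ≐ lit (toℕ b)) ∧ᶠ constᶠ (does (P? a b))

    _*ᵗ_ : Tm i n → Tm i n → Tm i n
    a *ᵗ b = sum a (wk b)

    polyᵗ : Polynomial → Tm i n → Tm i n
    polyᵗ []      t = lit 0
    polyᵗ (a ∷ p) t = lit a ⊕ (t *ᵗ polyᵗ p t)

    module _ {xs : Vec BitString i} {ρ : Vec ℕ n} where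

      constᶠ-value : ∀ b → ⟦ constᶠ b ⟧ᶠ xs ρ ≡ b
      constᶠ-value true  = refl
      constᶠ-value false = refl

      anyᶠ-reflects : ∀ {m} {P : Fin m → Set} {f : Fin m → Fm i n} → (∀ a → Reflects (P a) (⟦ f a ⟧ᶠ xs ρ)) →
                      Reflects (∃ P) (⟦ anyᶠ f ⟧ᶠ xs ρ)
      anyᶠ-reflects {zero}  h = ofⁿ λ ()
      anyᶠ-reflects {suc m} h = reflects-map
        (λ { (inj₁ p) → zero , p ; (inj₂ (a , p)) → suc a , p })
        (λ { (zero , p) → inj₁ p ; (suc a , p) → inj₂ (a , p) })
        (h zero ⊎-reflects anyᶠ-reflects (h ∘ suc))

      table-reflects : ∀ {m k} {P : Fin m → Fin k → Set} (P? : ∀ a b → Dec (P a b)) {s t a b} →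
                       ⟦ s ⟧ xs ρ ≡ toℕ a → ⟦ t ⟧ xs ρ ≡ toℕ b → Reflects (P a b) (⟦ table P? s t ⟧ᶠ xs ρ)
      table-reflects P? {a = a} {b} s≡ t≡ = reflects-map
        (λ { (a′ , e , b′ , e′ , p) → subst₂ _ (sym (toℕ-injective e)) (sym (toℕ-injective e′)) p })
        (λ p → a , refl , b , refl , p)
        (anyᶠ-reflects λ a′ → ≡ᵇ-reflects s≡ refl ×-reflects anyᶠ-reflects λ b′ →
          ≡ᵇ-reflects t≡ refl ×-reflects reflects-≡ (constᶠ-value _) (proof (P? a′ b′)))

      sumTo-const : ∀ m c → sumTo m (λ _ → c) ≡ m * c
      sumTo-const zero    c = refl
      sumTo-const (suc m) c = cong (c +_) (sumTo-const m c)

      *ᵗ-value : ∀ a b → ⟦ a *ᵗ b ⟧ xs ρ ≡ ⟦ a ⟧ xs ρ * ⟦ b ⟧ xs ρ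
      *ᵗ-value a b = sumTo-const (⟦ a ⟧ xs ρ) (⟦ b ⟧ xs ρ)

      polyᵗ-value : ∀ p t → ⟦ polyᵗ p t ⟧ xs ρ ≡ eval p (⟦ t ⟧ xs ρ)
      polyᵗ-value []      t = refl
      polyᵗ-value (a ∷ p) t = cong (a +_) (trans (*ᵗ-value t (polyᵗ p t)) (cong (⟦ t ⟧ xs ρ *_) (polyᵗ-value p t)))

  module _ {A : Set} where

    concatTo-suc : ∀ n (f : ℕ → List A) → concatTo (suc n) f ≡ f 0 ++ concatTo n (f ∘ suc)
    concatTo-suc zero    f = sym (++-identityʳ (f 0))
    concatTo-suc (suc n) f = trans (cong (_++ f (suc n)) (concatTo-suc n f)) (++-assoc (f 0) _ _)

    concatTo-cong : ∀ n {f g : ℕ → List A} → (∀ k → f k ≡ g k) → concatTo n f ≡ concatTo n g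
    concatTo-cong zero    e = refl
    concatTo-cong (suc n) e = cong₂ _++_ (concatTo-cong n e) (e n)

    -- Abstract, as its unfolding at numerals defeats unification.
    abstract
      gather : ∀ n → (Fin n → List A) → List A
      gather n f = concat (tabulate f)

      concat≡gather : ∀ {n} (f : Fin n → List A) → concat (tabulate f) ≡ gather n f
      concat≡gather f = refl

      gather-cong : ∀ {n} {f g : Fin n → List A} → (∀ i → f i ≡ g i) → gather n f ≡ gather n g
      gather-cong e = cong concat (tabulate-cong e)

      gather-↑ : ∀ m {n} (f : Fin (m + n) → List A) → gather (m + n) f ≡ gather m (f ∘ (_↑ˡ n)) ++ gather n (f ∘ (m ↑ʳ_))
      gather-↑ zero    f = refl
      gather-↑ (suc m) f = trans (cong (f zero ++_) (gather-↑ m (f ∘ suc))) (sym (++-assoc (f zero) _ _))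

      gather-combine : ∀ m {n} (f : Fin (m * n) → List A) →
                       gather (m * n) f ≡ gather m λ i → gather n λ j → f (combine i j)
      gather-combine zero        f = refl
      gather-combine (suc m) {n} f = trans (gather-↑ n f) (cong (gather n (f ∘ (_↑ˡ (m * n))) ++_) (gather-combine m (f ∘ (n ↑ʳ_))))

      tabulate≡gather : ∀ {n} (f : Fin n → A) → tabulate f ≡ gather n λ i → [ f i ]
      tabulate≡gather {zero}  f = refl
      tabulate≡gather {suc n} f = cong (f zero ∷_) (tabulate≡gather (f ∘ suc))

      concatTo≡gather : ∀ n (g : ℕ → List A) (f : Fin n → List A) → (∀ i → g (toℕ i) ≡ f i) → concatTo n g ≡ gather n f
      concatTo≡gather zero    g f e = refl
      concatTo≡gather (suc n) g f e = trans (concatTo-suc n g) (cong₂ _++_ (e zero) (concatTo≡gather n (g ∘ suc) (f ∘ suc) (e ∘ suc)))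

      gather-suc : ∀ {n} (f : Fin (suc n) → List A) → gather (suc n) f ≡ f zero ++ gather n (f ∘ suc)
      gather-suc f = refl

      gather-1 : (f : Fin 1 → List A) → gather 1 f ≡ f zero
      gather-1 f = ++-identityʳ (f zero)

    gather-combine₂ : ∀ l m n (f : Fin (l * (m * n)) → List A) → gather (l * (m * n)) f ≡
                      gather l λ i → gather m λ j → gather n λ k → f (combine i (combine j k))
    gather-combine₂ l m n f = trans (gather-combine l f) (gather-cong λ i → gather-combine m (f ∘ combine i))

    gather-matrix : ∀ m n (f : Fin (m * n) → Fin (m * n) → A) → concat (tabulate λ u → tabulate (f u)) ≡
      gather m λ c → gather n λ i → gather m λ d → gather n λ j → [ f (combine c i) (combine d j) ]
    gather-matrix m n f = trans (concat≡gather (λ u → tabulate (f u))) (trans (gather-combine m (λ u → tabulate (f u)))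
      (gather-cong λ c → gather-cong λ i →
        trans (tabulate≡gather (f (combine c i))) (gather-combine m (λ v → [ f (combine c i) v ]))))

  sumTo-cong : ∀ n {f g : ℕ → ℕ} → (∀ k → f k ≡ g k) → sumTo n f ≡ sumTo n g
  sumTo-cong zero    e = refl
  sumTo-cong (suc n) e = cong₂ _+_ (e n) (sumTo-cong n e)

  sumTo-suc : ∀ n f → sumTo (suc n) f ≡ f 0 + sumTo n (f ∘ suc)
  sumTo-suc zero    f = refl
  sumTo-suc (suc n) f = trans (cong (f (suc n) +_) (sumTo-suc n f)) (lemma (f (suc n)) (f 0) _)
    where
    lemma : ∀ x y z → x + (y + z) ≡ y + (x + z)
    lemma = solve-∀

  -- Division by counting: the numbers k with 2k + 1 < a are exactly those below ⌊a/2⌋.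
  halfᵗ : ∀ {i n} → Tm i n → Tm i n
  halfᵗ a = sum a (truth (var zero ⊕ var zero ⊕ lit 1 ≺ wk a))

  half-value : ∀ {i n} (a : Tm i n) xs ρ → ⟦ halfᵗ a ⟧ xs ρ ≡ ⌊ ⟦ a ⟧ xs ρ /2⌋
  half-value a xs ρ = trans (sumTo-cong m (λ k → truth-value (var zero ⊕ var zero ⊕ lit 1 ≺ wk a) xs (k ∷ ρ))) (below m)
    where
    m = ⟦ a ⟧ xs ρ
    term : ℕ → ℕ → ℕ
    term m k = indicator (k + k + 1 <ᵇ m)
    too-big : ∀ m → term m m ≡ 0
    too-big m with m + m + 1 <ᵇ m in eq
    ... | false = refl
    ... | true  = ⊥-elim (<-irrefl refl (<-≤-trans (<ᵇ⇒< (m + m + 1) m (subst T (sym eq) tt))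
                    (≤-trans (m≤m+n m m) (m≤m+n (m + m) 1))))
    below : ∀ m → sumTo m (term m) ≡ ⌊ m /2⌋
    below zero          = refl
    below (suc zero)    = refl
    -- The term for index 0 gives the `suc`. The others shift to the terms for `m`, with one term
    -- too many, which `too-big` removes.
    below (suc (suc m)) = trans (sumTo-suc (suc m) (term (suc (suc m))))
      (cong suc (trans (sumTo-cong (suc m) (λ k → cong (λ z → indicator (z <ᵇ suc (suc m))) (lemma k)))
        (trans (cong (_+ sumTo m (term m)) (too-big m)) (below m))))
      where
      lemma : ∀ k → suc k + suc k + 1 ≡ 2 + (k + k + 1)
      lemma = solve-∀

  digits-of : ℕ → BitString
  digits-of k = binaryDigits (fromℕ k)

  -- The remaining part of a bijective numeral after its first digit is removed.
  rest : ℕ → ℕ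
  rest k = ⌊ k ∸ 1 /2⌋

  even : ℕ → Bool
  even k = ⌊ k /2⌋ + ⌊ k /2⌋ ≡ᵇ k

  -- A positive number is 2m + 2 or 2m + 1, where m is the number formed by the remaining digits.
  -- The first digit is 2 exactly in the even case, and m is half the predecessor, rounded down.
  digits-suc : ∀ k → digits-of (suc k) ≡ even (suc k) ∷ digits-of (rest (suc k))
  digits-suc k with fromℕ (suc k) in eq
  ... | zero = case (trans (sym (toℕᵇ-fromℕ (suc k))) (cong toℕᵇ eq))
    where
    case : ∀ {A : Set} → suc k ≡ 0 → A
    case ()
  ... | 2[1+ b ] = cong₂ _∷_ (sym isEven) (cong binaryDigits (sym rest≡))
    where
    m = toℕᵇ b
    k≡ : k ≡ m + suc m
    k≡ = suc-injective (trans (sym (toℕᵇ-fromℕ (suc k))) (trans (cong toℕᵇ eq) (cong (λ z → suc (m + suc z)) (+-identityʳ m))))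
    half : ∀ m → ⌊ m + suc m /2⌋ ≡ m
    half zero    = refl
    half (suc m) = trans (cong ⌊_/2⌋ (cong suc (+-suc m (suc m)))) (cong suc (half m))
    half′ : ∀ m → ⌊ suc (m + suc m) /2⌋ ≡ suc m
    half′ zero    = refl
    half′ (suc m) = trans (cong ⌊_/2⌋ (cong (λ z → suc (suc z)) (+-suc m (suc m)))) (cong suc (half′ m))
    isEven : even (suc k) ≡ true
    isEven rewrite k≡ | half′ m = refl-≡ᵇ (m + suc m)
      where
      refl-≡ᵇ : ∀ n → (n ≡ᵇ n) ≡ true
      refl-≡ᵇ zero    = refl
      refl-≡ᵇ (suc n) = refl-≡ᵇ n
    rest≡ : fromℕ ⌊ k /2⌋ ≡ b
    rest≡ = toℕᵇ-injective (trans (toℕᵇ-fromℕ ⌊ k /2⌋) (trans (cong ⌊_/2⌋ k≡) (half m)))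
  ... | 1+[2 b ] = cong₂ _∷_ (sym isOdd) (cong binaryDigits (sym rest≡))
    where
    m = toℕᵇ b
    k≡ : k ≡ m + m
    k≡ = suc-injective (trans (sym (toℕᵇ-fromℕ (suc k))) (trans (cong toℕᵇ eq) (cong (λ z → suc (m + z)) (+-identityʳ m))))
    half : ∀ m → ⌊ m + m /2⌋ ≡ m
    half zero    = refl
    half (suc m) = trans (cong ⌊_/2⌋ (cong suc (+-suc m m))) (cong suc (half m))
    half′ : ∀ m → ⌊ suc (m + m) /2⌋ ≡ m
    half′ zero    = refl
    half′ (suc m) = trans (cong ⌊_/2⌋ (cong (λ z → suc (suc z)) (+-suc m m))) (cong suc (half′ m))
    isOdd : even (suc k) ≡ false
    isOdd rewrite k≡ | half′ m = n≢1+n (m + m)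
      where
      n≢1+n : ∀ n → (n ≡ᵇ suc n) ≡ false
      n≢1+n zero    = refl
      n≢1+n (suc n) = n≢1+n n
    rest≡ : fromℕ ⌊ k /2⌋ ≡ b
    rest≡ = toℕᵇ-injective (trans (toℕᵇ-fromℕ ⌊ k /2⌋) (trans (cong ⌊_/2⌋ k≡) (half m)))

  iterate : ℕ → ℕ → ℕ
  iterate zero    k = k
  iterate (suc i) k = iterate i (rest k)

  first-digit : ℕ → BitString
  first-digit k = concatTo (indicator (0 <ᵇ k)) λ _ → [ even k ]

  iterate-0 : ∀ i → iterate i 0 ≡ 0
  iterate-0 zero    = refl
  iterate-0 (suc i) = iterate-0 i

  -- Each round lowers a positive number, so `n` rounds reach 0, and from then on rounds print
  -- nothing. Thus the number of digits need not be known beforehand.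
  digits-iterate : ∀ n k → k ≤ n → concatTo n (λ i → first-digit (iterate i k)) ≡ digits-of k
  digits-iterate zero    zero    _   = refl
  digits-iterate (suc n) zero    _   = empty (suc n)
    where
    empty : ∀ n → concatTo n (λ i → first-digit (iterate i 0)) ≡ []
    empty zero    = refl
    empty (suc n) rewrite iterate-0 n = trans (++-identityʳ _) (empty n)
  digits-iterate (suc n) (suc k) k≤n = trans (concatTo-suc n (λ i → first-digit (iterate i (suc k))))
    (trans (cong (even (suc k) ∷_) (digits-iterate n (rest (suc k)) (≤-trans (⌊n/2⌋≤n k) (s≤s⁻¹ k≤n))))
           (sym (digits-suc k)))

  digitsᵒ : ∀ {i n} → Tm i n → Out i n
  digitsᵒ k = for k (for (truth (lit 0 ≺ it)) (emit (wk (halfᵗ it ⊕ halfᵗ it) ≐ wk it)))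
    where
    -- `dec` can only subtract, so the accumulator a is turned into `rest a` by taking a ∸ `rest a`
    -- away from it.
    it = dec (var zero) (wk k) (var (suc zero) ⊖ halfᵗ (var (suc zero) ⊖ lit 1))

  digits-value : ∀ {i n} (k : Tm i n) xs ρ → ⟦ digitsᵒ k ⟧ᵒ xs ρ ≡ digits-of (⟦ k ⟧ xs ρ)
  digits-value k xs ρ = trans (concatTo-cong m λ i → trans
    (cong (λ c → concatTo c (λ _ → [ ⟦ halfᵗ it ⟧ xs (i ∷ ρ) + ⟦ halfᵗ it ⟧ xs (i ∷ ρ) ≡ᵇ ⟦ it ⟧ xs (i ∷ ρ) ])) (truth-value (lit 0 ≺ it) xs (i ∷ ρ)))
    (trans (cong (λ h → concatTo (indicator (0 <ᵇ ⟦ it ⟧ xs (i ∷ ρ))) (λ _ → [ h + h ≡ᵇ ⟦ it ⟧ xs (i ∷ ρ) ])) (half-value it xs (i ∷ ρ)))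
           (cong first-digit (it-value i m))))
    (digits-iterate m m ≤-refl)
    where
    m = ⟦ k ⟧ xs ρ
    step = var (suc zero) ⊖ halfᵗ (var (suc zero) ⊖ lit 1)
    it = dec (var zero) (wk k) step
    removed : ∀ j a i → a ∸ ⟦ step ⟧ xs (j ∷ a ∷ i ∷ ρ) ≡ rest a
    removed j a i = trans (cong (λ h → a ∸ (a ∸ h)) (half-value (var (suc zero) ⊖ lit 1) xs (j ∷ a ∷ i ∷ ρ)))
      (m∸[m∸n]≡n (≤-trans (⌊n/2⌋≤n (a ∸ 1)) (m∸n≤m a 1)))
    it-value : ∀ i m → decTo i (λ j a → ⟦ step ⟧ xs (j ∷ a ∷ i ∷ ρ)) m ≡ iterate i m
    it-value i = go i
      where
      go : ∀ c m → decTo c (λ j a → ⟦ step ⟧ xs (j ∷ a ∷ i ∷ ρ)) m ≡ iterate c m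
      go zero    m = refl
      go (suc c) m = trans (cong (decTo c _) (removed c m i)) (go c (rest m))

-- The covering problem of a verifier and an input

module TableauCovers where

  open import Data.Bool.Base using (Bool; true; false; T)
  import Data.Bool.Properties as Bool
  open import Data.Empty using (⊥-elim)
  open import Data.Fin.Base as Fin using (Fin; zero; suc; toℕ; combine; remQuot; fromℕ<)
  open import Data.Fin.Properties as Fin using (toℕ-injective; toℕ<n; toℕ-fromℕ<; remQuot-combine; combine-remQuot)
  open import Data.List.Base using (List; []; _∷_; [_]; length)
  open import Data.Maybe.Base as Maybe using (Maybe; just; nothing)
  import Data.Maybe.Properties as Maybe
  open import Data.Nat.Base
  open import Data.Nat.DivMod using (_mod_; m<n⇒m%n≡m)
  open import Data.Nat.Properties
  open import Data.Product.Base using (∃-syntax; _×_; _,_; proj₁; proj₂; uncurry)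
  open import Data.Sum.Base using (_⊎_; inj₁; inj₂)
  open import Data.Vec.Base using (Vec; []; _∷_)
  open import Function.Base using (_∘_)
  open import Function.Bundles using (_⇔_; mk⇔; _↔_; Inverse)
  open import Relation.Nullary using (Dec; yes; no; ¬_; ¬?)
  open import Relation.Nullary.Decidable using (map′)
  open import Relation.Nullary.Reflects
  open import Relation.Binary.Definitions using (DecidableEquality)
  open import Relation.Binary.PropositionalEquality hiding ([_])

  open Terms
  open Covers using (Kind; trivial; element; clause; Cover)
  open Tableaux
  open Formulas

  -- Only a retraction is required: several codes for the same value do no harm in a table or among
  -- the choices.
  record Enum (A : Set) : Set where
    field
      size          : ℕ
      decode        : Fin size → A
      encode        : A → Fin size
      decode-encode : ∀ a → decode (encode a) ≡ a
  open Enum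

  enum-≟ : ∀ {A} → Enum A → DecidableEquality A
  enum-≟ E a b = map′ (λ e → trans (sym (decode-encode E a)) (trans (cong (decode E) e) (decode-encode E b)))
                      (cong (encode E)) (encode E a Fin.≟ encode E b)

  enum-↔ : ∀ {A n} → A ↔ Fin n → Enum A
  enum-↔ {n = n} f = record
    { size = n ; decode = Inverse.from f ; encode = Inverse.to f ; decode-encode = Inverse.strictlyInverseʳ f }

  enum-Bool : Enum Bool
  enum-Bool = record
    { size = 2 ; decode = λ { zero → false ; (suc _) → true } ; encode = λ { false → zero ; true → suc zero }
    ; decode-encode = λ { false → refl ; true → refl } }

  enum-Maybe : ∀ {A} → Enum A → Enum (Maybe A)
  enum-Maybe E = record
    { size = suc (size E) ; decode = λ { zero → nothing ; (suc i) → just (decode E i) }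
    ; encode = λ { nothing → zero ; (just a) → suc (encode E a) }
    ; decode-encode = λ { nothing → refl ; (just a) → cong just (decode-encode E a) } }

  enum-× : ∀ {A B} → Enum A → Enum B → Enum (A × B)
  enum-× E F = record
    { size = size E * size F
    ; decode = λ i → let j , k = remQuot {size E} (size F) i in decode E j , decode F k
    ; encode = λ (a , b) → combine (encode E a) (encode F b)
    ; decode-encode = λ (a , b) → trans
        (cong (λ (j , k) → decode E j , decode F k) (remQuot-combine {size E} {size F} (encode E a) (encode F b)))
        (cong₂ _,_ (decode-encode E a) (decode-encode F b)) }

  enum-Vec : ∀ {A} → Enum A → ∀ n → Enum (Vec A n)
  enum-Vec E zero    = record
    { size = 1 ; decode = λ _ → [] ; encode = λ _ → zero ; decode-encode = λ { [] → refl } }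
  enum-Vec E (suc n) = record
    { size = size F ; decode = λ i → let a , v = decode F i in a ∷ v
    ; encode = λ { (a ∷ v) → encode F (a , v) }
    ; decode-encode = λ { (a ∷ v) → cong (λ (a , v) → a ∷ v) (decode-encode F (a , v)) } }
    where F = enum-× E (enum-Vec E n)

  _≟ˢ_ : DecidableEquality Symbol
  _≟ˢ_ = Maybe.≡-dec Bool._≟_

  module TableauCover (M : TM 2) (p q : Polynomial) where
    open TM M hiding (δ)
    open Tableau M

    enum-Val : Enum Val
    enum-Val = enum-× enum-Bool (enum-× (enum-↔ (proj₂ finite)) (enum-Vec (enum-Maybe enum-Bool) tapes))

    Window : Set
    Window = Val × Val × Val × Val

    above-head above-left above-mid above-right : Window → Val
    above-head  (a , _ , _ , _) = a
    above-left  (_ , a , _ , _) = a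
    above-mid   (_ , _ , a , _) = a
    above-right (_ , _ , _ , a) = a

    next : Window → Val
    next (a , l , c , r) = successor a l c r

    opaque
      Q : ℕ
      Q = size (enum-× enum-Val (enum-× enum-Val (enum-× enum-Val enum-Val)))

      window : Fin Q → Window
      window = decode (enum-× enum-Val (enum-× enum-Val (enum-× enum-Val enum-Val)))

      window# : Window → Fin Q
      window# = encode (enum-× enum-Val (enum-× enum-Val (enum-× enum-Val enum-Val)))

      window-window# : ∀ w → window (window# w) ≡ w
      window-window# = decode-encode (enum-× enum-Val (enum-× enum-Val (enum-× enum-Val enum-Val)))

    -- As a choice, a window stands for its first component.
    val : Fin Q → Val
    val = above-head ∘ window

    abstract
      _≟ⱽ_ : DecidableEquality Val
      _≟ⱽ_ = enum-≟ enum-Val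

    certBound timeBound : BitString → ℕ
    certBound x = eval p (length x)
    timeBound x = eval q (length x + certBound x)

    certᵗ timeᵗ widthᵗ heightᵗ posᵗ : ∀ {n} → Tm 1 n
    certᵗ   = polyᵗ p (len zero)
    timeᵗ   = polyᵗ q (len zero ⊕ certᵗ)
    posᵗ    = lit 1 ⊕ timeᵗ
    widthᵗ  = lit 1 ⊕ (posᵗ ⊕ posᵗ)
    heightᵗ = lit 1 ⊕ posᵗ

    module _ (x : BitString) where

      -- There is one row more than the run has configurations: rows 0 to `T-max` hold the run, and
      -- the clauses of row `pos` state acceptance in terms of the row above.
      T-max P-max pos width height : ℕ
      T-max  = timeBound x
      P-max  = certBound x
      pos    = suc T-max
      width  = suc (pos + pos)
      height = suc pos

      -- The condition that the window above imposes on a cell in row t.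
      Own : ℕ → ℕ → Window → Val → Set
      Own t j w b =
        (t ≡ 0 × Initial T-max P-max x j (above-head w) b) ⊎
        ((0 < t × t < pos) × (j ≡ 0 ⊎ ¬ j < pos + pos ⊎ b ≡ next w)) ⊎
        (¬ t < pos × (¬ j ≡ pos ⊎ out (above-mid w) ≡ just true) × (¬ j ≡ suc pos ⊎ out (above-mid w) ≡ nothing))

      -- Putting b in cell (t′ , j′) satisfies the clause (t , j , w): either it is
      -- the cell of the clause and b is right for w, or b contradicts w. In row 0
      -- the first component of w is the left neighbour.
      Admits : ℕ → ℕ → Window → ℕ → ℕ → Val → Set
      Admits t j w t′ j′ b =
        ((t′ ≡ t × j′ ≡ j) × Own t j w b) ⊎
        (suc t′ ≡ t × ((j′ ≡ pos × ¬ b ≡ above-head w) ⊎ (suc j′ ≡ j × ¬ b ≡ above-left w) ⊎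
                       (j′ ≡ j × ¬ b ≡ above-mid w) ⊎ (j′ ≡ suc j × ¬ b ≡ above-right w))) ⊎
        ((t ≡ 0 × t′ ≡ 0) × suc j′ ≡ j × ¬ b ≡ above-head w)

    -- The six coordinates are arbitrary terms, because the adjacency matrix needs the relation with
    -- the clause first and also with the choice first.
    module ClauseFormula {n} (t j r t′ j′ r′ : Tm 1 n) where

      lookupᶠ : {P : Window → Val → Set} → (∀ w b → Dec (P w b)) → Fm 1 n
      lookupᶠ P? = table (λ a b → P? (window a) (val b)) (r ⊖ lit 2) (r′ ⊖ lit 2)

      -- The input symbol is the value of a term and the cell is an entry of a finite table. They
      -- are compared through the three codes that a symbol can have.
      x-code-is : Fin 3 → Fm 1 n
      x-code-is c = (bit zero (j ⊖ posᵗ) ≐ lit (toℕ c)) ∧ᶠ lookupᶠ (λ w b → symbolCode (xsym b) ≟ toℕ c)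

      initial-φ own-φ admits-φ : Fm 1 n
      initial-φ =
        lookupᶠ (λ w b → b ≟ⱽ startVal (isHead b) (xsym b) (ysym b)) ∧ᶠ
        (((j ≐ posᵗ) ∧ᶠ lookupᶠ (λ w b → isHead b Bool.≟ true)) ∨ᶠ
         ((¬ᶠ (j ≐ posᵗ)) ∧ᶠ lookupᶠ (λ w b → isHead b Bool.≟ false))) ∧ᶠ
        (((j ≺ posᵗ) ∧ᶠ lookupᶠ (λ w b → symbolCode (xsym b) ≟ 0)) ∨ᶠ
         ((¬ᶠ (j ≺ posᵗ)) ∧ᶠ anyᶠ x-code-is)) ∧ᶠ
        ((¬ᶠ (j ≺ posᵗ)) ∨ᶠ lookupᶠ (λ w b → ysym b ≟ˢ nothing)) ∧ᶠ
        ((j ≺ posᵗ ⊕ certᵗ) ∨ᶠ lookupᶠ (λ w b → ysym b ≟ˢ nothing)) ∧ᶠ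
        ((¬ᶠ (posᵗ ≺ j)) ∨ᶠ lookupᶠ (λ w b → ¬? (ysym (above-head w) ≟ˢ nothing)) ∨ᶠ lookupᶠ (λ w b → ysym b ≟ˢ nothing))

      own-φ =
        ((t ≐ lit 0) ∧ᶠ initial-φ) ∨ᶠ
        (((lit 0 ≺ t) ∧ᶠ (t ≺ posᵗ)) ∧ᶠ ((j ≐ lit 0) ∨ᶠ (¬ᶠ (j ≺ posᵗ ⊕ posᵗ)) ∨ᶠ lookupᶠ (λ w b → b ≟ⱽ next w))) ∨ᶠ
        ((¬ᶠ (t ≺ posᵗ)) ∧ᶠ ((¬ᶠ (j ≐ posᵗ)) ∨ᶠ lookupᶠ (λ w b → out (above-mid w) ≟ˢ just true)) ∧ᶠ
                            ((¬ᶠ (j ≐ lit 1 ⊕ posᵗ)) ∨ᶠ lookupᶠ (λ w b → out (above-mid w) ≟ˢ nothing)))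

      admits-φ =
        (((t′ ≐ t) ∧ᶠ (j′ ≐ j)) ∧ᶠ own-φ) ∨ᶠ
        ((lit 1 ⊕ t′ ≐ t) ∧ᶠ
          (((j′ ≐ posᵗ) ∧ᶠ lookupᶠ (λ w b → ¬? (b ≟ⱽ above-head w))) ∨ᶠ
           ((lit 1 ⊕ j′ ≐ j) ∧ᶠ lookupᶠ (λ w b → ¬? (b ≟ⱽ above-left w))) ∨ᶠ
           ((j′ ≐ j) ∧ᶠ lookupᶠ (λ w b → ¬? (b ≟ⱽ above-mid w))) ∨ᶠ
           ((j′ ≐ lit 1 ⊕ j) ∧ᶠ lookupᶠ (λ w b → ¬? (b ≟ⱽ above-right w))))) ∨ᶠ
        (((t ≐ lit 0) ∧ᶠ (t′ ≐ lit 0)) ∧ᶠ (lit 1 ⊕ j′ ≐ j) ∧ᶠ lookupᶠ (λ w b → ¬? (b ≟ⱽ above-head w)))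

      module _ (x : BitString) {ρ : Vec ℕ n} where

        private
          xs : Vec BitString 1
          xs = x ∷ []

        certᵗ-value : ⟦ certᵗ ⟧ xs ρ ≡ P-max x
        certᵗ-value = polyᵗ-value p (len zero)

        posᵗ-value : ⟦ posᵗ ⟧ xs ρ ≡ pos x
        posᵗ-value = cong suc (trans (polyᵗ-value q (len zero ⊕ certᵗ)) (cong (λ c → eval q (length x + c)) certᵗ-value))

        module _ {tn jn tn′ jn′ : ℕ} {a b : Fin Q}
                 (et : ⟦ t ⟧ xs ρ ≡ tn) (ej : ⟦ j ⟧ xs ρ ≡ jn) (er : ⟦ r ⟧ xs ρ ≡ suc (suc (toℕ a)))
                 (et′ : ⟦ t′ ⟧ xs ρ ≡ tn′) (ej′ : ⟦ j′ ⟧ xs ρ ≡ jn′) (er′ : ⟦ r′ ⟧ xs ρ ≡ suc (suc (toℕ b))) where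

          looked-up : ∀ {P : Window → Val → Set} (P? : ∀ w b → Dec (P w b)) →
                      Reflects (P (window a) (val b)) (⟦ lookupᶠ P? ⟧ᶠ xs ρ)
          looked-up P? = table-reflects (λ a b → P? (window a) (val b)) (cong (_∸ 2) er) (cong (_∸ 2) er′)

          x-code : Reflects (symbolCode (xsym (val b)) ≡ bitAt x (jn ∸ pos x)) (⟦ anyᶠ x-code-is ⟧ᶠ xs ρ)
          x-code = reflects-map
            (λ (c , e , e′) → trans e′ (sym e))
            (λ e → fromℕ< c≤2 , sym (toℕ-fromℕ< c≤2) , trans e (sym (toℕ-fromℕ< c≤2)))
            (anyᶠ-reflects {f = x-code-is} λ c → ≡ᵇ-reflects (cong (bitAt x) (cong₂ _∸_ ej posᵗ-value)) refl ×-reflects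
                                 looked-up (λ w b → symbolCode (xsym b) ≟ toℕ c))
            where c≤2 = s≤s (bitAt-≤ x (jn ∸ pos x))

          initial-reflects : Reflects (Initial (T-max x) (P-max x) x jn (above-head (window a)) (val b)) (⟦ initial-φ ⟧ᶠ xs ρ)
          initial-reflects = reflects-map
            (λ (s , h , c , l , r , ch) → record
              { start-shape = s ; head-here = h ; x-here = c ; y-left = l ; y-right = r ; y-chain = ch })
            (λ I → let open Initial I in start-shape , head-here , x-here , y-left , y-right , y-chain)
            (looked-up (λ w b → b ≟ⱽ startVal (isHead b) (xsym b) (ysym b)) ×-reflects
             ((≡ᵇ-reflects ej posᵗ-value ×-reflects looked-up (λ w b → isHead b Bool.≟ true)) ⊎-reflects
              (¬-reflects (≡ᵇ-reflects ej posᵗ-value) ×-reflects looked-up (λ w b → isHead b Bool.≟ false))) ×-reflects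
             ((<ᵇ-reflects ej posᵗ-value ×-reflects looked-up (λ w b → symbolCode (xsym b) ≟ 0)) ⊎-reflects
              (¬-reflects (<ᵇ-reflects ej posᵗ-value) ×-reflects x-code)) ×-reflects
             (¬-reflects (<ᵇ-reflects ej posᵗ-value) ⊎-reflects looked-up (λ w b → ysym b ≟ˢ nothing)) ×-reflects
             (<ᵇ-reflects ej (cong₂ _+_ posᵗ-value certᵗ-value) ⊎-reflects looked-up (λ w b → ysym b ≟ˢ nothing)) ×-reflects
             (¬-reflects (<ᵇ-reflects posᵗ-value ej) ⊎-reflects
              looked-up (λ w b → ¬? (ysym (above-head w) ≟ˢ nothing)) ⊎-reflects looked-up (λ w b → ysym b ≟ˢ nothing)))

          own-reflects : Reflects (Own x tn jn (window a) (val b)) (⟦ own-φ ⟧ᶠ xs ρ)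
          own-reflects =
            (≡ᵇ-reflects et refl ×-reflects initial-reflects) ⊎-reflects
            (((<ᵇ-reflects refl et ×-reflects <ᵇ-reflects et posᵗ-value) ×-reflects
               (≡ᵇ-reflects ej refl ⊎-reflects ¬-reflects (<ᵇ-reflects ej (cong₂ _+_ posᵗ-value posᵗ-value)) ⊎-reflects
                looked-up (λ w b → b ≟ⱽ next w))) ⊎-reflects
             (¬-reflects (<ᵇ-reflects et posᵗ-value) ×-reflects
               (¬-reflects (≡ᵇ-reflects ej posᵗ-value) ⊎-reflects looked-up (λ w b → out (above-mid w) ≟ˢ just true)) ×-reflects
               (¬-reflects (≡ᵇ-reflects ej (cong suc posᵗ-value)) ⊎-reflects looked-up (λ w b → out (above-mid w) ≟ˢ nothing))))

          admits-reflects : Reflects (Admits x tn jn (window a) tn′ jn′ (val b)) (⟦ admits-φ ⟧ᶠ xs ρ)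
          admits-reflects =
            ((≡ᵇ-reflects et′ et ×-reflects ≡ᵇ-reflects ej′ ej) ×-reflects own-reflects) ⊎-reflects
            ((≡ᵇ-reflects (cong suc et′) et ×-reflects
              ((≡ᵇ-reflects ej′ posᵗ-value ×-reflects looked-up (λ w b → ¬? (b ≟ⱽ above-head w))) ⊎-reflects
               (≡ᵇ-reflects (cong suc ej′) ej ×-reflects looked-up (λ w b → ¬? (b ≟ⱽ above-left w))) ⊎-reflects
               (≡ᵇ-reflects ej′ ej ×-reflects looked-up (λ w b → ¬? (b ≟ⱽ above-mid w))) ⊎-reflects
               (≡ᵇ-reflects ej′ (cong suc ej) ×-reflects looked-up (λ w b → ¬? (b ≟ⱽ above-right w))))) ⊎-reflects
             ((≡ᵇ-reflects et refl ×-reflects ≡ᵇ-reflects et′ refl) ×-reflects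
              ≡ᵇ-reflects (cong suc ej′) ej ×-reflects looked-up (λ w b → ¬? (b ≟ⱽ above-head w))))

    -- In (t , j , r), 0 and 1 for r are the trivial and the element clause of the
    -- cell, and padding as choices; from 2 on r is a window.
    Index : BitString → Set
    Index x = Fin (height x) × Fin (width x) × Fin (suc (suc Q))

    opaque
      size-of groups-of : BitString → ℕ
      size-of   x = height x * (width x * suc (suc Q))
      groups-of x = height x * width x

      size-of-value : ∀ x → size-of x ≡ height x * (width x * suc (suc Q))
      size-of-value x = refl

      groups-of-value : ∀ x → groups-of x ≡ height x * width x
      groups-of-value x = refl

    module ForInput (x : BitString) where

      -- Opaque, so that an index determines its coordinates in unification.
      opaque
        unfolding size-of groups-of

        index : Index x → Fin (size-of x)
        index (t , j , r) = combine t (combine j r)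

        coords : Fin (size-of x) → Index x
        coords i = let t , s = remQuot {height x} (width x * suc (suc Q)) i in t , remQuot {width x} (suc (suc Q)) s

        coords-index : ∀ c → coords (index c) ≡ c
        coords-index (t , j , r) = trans
          (cong (λ (t , s) → t , remQuot {width x} (suc (suc Q)) s) (remQuot-combine {height x} t (combine j r)))
          (cong (t ,_) (remQuot-combine {width x} j r))

        index-coords : ∀ i → index (coords i) ≡ i
        index-coords i = trans
          (cong (combine (proj₁ (coords i))) (combine-remQuot {width x} (suc (suc Q)) (proj₂ (remQuot {height x} (width x * suc (suc Q)) i))))
          (combine-remQuot {height x} (width x * suc (suc Q)) i)

        gather-index : ∀ {A : Set} (f : Fin (size-of x) → List A) → gather (size-of x) f ≡
                       gather (height x) λ t → gather (width x) λ j → gather (suc (suc Q)) λ r → f (index (t , j , r))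
        gather-index f = gather-combine₂ (height x) (width x) (suc (suc Q)) f

        group : Fin (height x) → Fin (width x) → Fin (groups-of x)
        group = combine

        ungroup : Fin (groups-of x) → Fin (height x) × Fin (width x)
        ungroup = remQuot {height x} (width x)

        ungroup-group : ∀ t j → ungroup (group t j) ≡ (t , j)
        ungroup-group = remQuot-combine

        group-ungroup : ∀ g → uncurry group (ungroup g) ≡ g
        group-ungroup = combine-remQuot {height x} (width x)

      kindOf : Index x → Kind (groups-of x)
      kindOf (t , j , zero)        = trivial
      kindOf (t , j , suc zero)    = element (group t j)
      kindOf (t , j , suc (suc a)) = clause

      groupOf : Index x → Maybe (Fin (groups-of x))
      groupOf (t , j , suc (suc a)) = just (group t j)
      groupOf (t , j , _)           = nothing

      default-val : Val
      default-val = startVal false nothing nothing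

      choice# : Val → Fin (suc (suc Q))
      choice# v = suc (suc (window# (v , v , v , v)))

      vars : Index x → Index x → Vec ℕ 6
      vars (t , j , r) (t′ , j′ , r′) = toℕ r′ ∷ toℕ j′ ∷ toℕ t′ ∷ toℕ r ∷ toℕ j ∷ toℕ t ∷ []

    v₀ v₁ v₂ v₃ v₄ v₅ : Tm 1 6
    v₀ = var zero
    v₁ = var (suc zero)
    v₂ = var (suc (suc zero))
    v₃ = var (suc (suc (suc zero)))
    v₄ = var (suc (suc (suc (suc zero))))
    v₅ = var (suc (suc (suc (suc (suc zero)))))

    module Clauses = ClauseFormula v₅ v₄ v₃ v₂ v₁ v₀

    abstract
      admitsᵇ : ∀ x → Index x → Index x → Bool
      admitsᵇ x c d = ⟦ Clauses.admits-φ ⟧ᶠ (x ∷ []) (ForInput.vars x c d)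

      admitsᵇ-value : ∀ x c d → admitsᵇ x c d ≡ ⟦ Clauses.admits-φ ⟧ᶠ (x ∷ []) (ForInput.vars x c d)
      admitsᵇ-value x c d = refl

      admitsᵇ-reflects : ∀ x t j a t′ j′ b →
        Reflects (Admits x (toℕ t) (toℕ j) (window a) (toℕ t′) (toℕ j′) (val b))
                 (admitsᵇ x (t , j , suc (suc a)) (t′ , j′ , suc (suc b)))
      admitsᵇ-reflects x t j a t′ j′ b =
        Clauses.admits-reflects x {ForInput.vars x (t , j , suc (suc a)) (t′ , j′ , suc (suc b))}
          refl refl refl refl refl refl

    cover : BitString → Cover
    cover x = record
      { R = size-of x ; Γ = groups-of x
      ; kind = kindOf ∘ coords ; grp = groupOf ∘ coords
      ; admits = λ i j → admitsᵇ x (coords i) (coords j)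
      ; i₀ = index (zero , zero , zero)
      ; kind-i₀ = cong kindOf (coords-index _) ; grp-i₀ = cong groupOf (coords-index _)
      ; el = λ g → let t , j = ungroup g in index (t , j , suc zero)
      ; kind-el = λ g → trans (cong kindOf (coords-index _)) (cong element (group-ungroup g))
      ; deflt = λ g → let t , j = ungroup g in index (t , j , choice# default-val)
      ; grp-deflt = λ g → trans (cong groupOf (coords-index _)) (cong just (group-ungroup g))
      ; g₀ = group zero zero
      }
      where open ForInput x

    module Equivalence (x : BitString) where
      open ForInput x
      open Cover (cover x) using (Solution; kind; grp; admits)

      valueAt : Index x → Val
      valueAt (_ , _ , suc (suc a)) = val a
      valueAt (_ , _ , _)           = default-val

      module Decode (f : Fin (groups-of x) → Fin (size-of x)) (grp-f : ∀ g → grp (f g) ≡ just g)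
                    (sat : ∀ i → kind i ≡ clause → ∃[ g ] T (admits i (f g))) where

        clamp : ∀ {n} .{{_ : NonZero n}} {m} → m < n → toℕ (m mod n) ≡ m
        clamp m<n = trans (toℕ-fromℕ< _) (m<n⇒m%n≡m m<n)

        clamp-toℕ : ∀ {n} .{{_ : NonZero n}} (i : Fin n) → toℕ i mod n ≡ i
        clamp-toℕ i = toℕ-injective (clamp (toℕ<n i))

        chosen : ∀ i g → groupOf i ≡ just g → ∃[ b ] i ≡ (proj₁ (ungroup g) , proj₂ (ungroup g) , suc (suc b))
        chosen (t , j , suc (suc b)) g e = b , cong (λ (t , j) → t , j , suc (suc b))
          (trans (sym (ungroup-group t j)) (cong ungroup (Maybe.just-injective e)))

        abstract
          -- Reduction modulo the dimensions makes the table total; at positions inside it nothing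
          -- changes, by `clamp`.
          cell : ℕ → ℕ → Val
          cell t j = valueAt (coords (f (group (t mod height x) (j mod width x))))

          satisfied : ∀ t j w → t < height x → j < width x →
                      ∃[ t′ ] ∃[ j′ ] t′ < height x × j′ < width x × Admits x t j w t′ j′ (cell t′ j′)
          satisfied t j w t<h j<w = toℕ t′ , toℕ j′ , toℕ<n t′ , toℕ<n j′ , moved
            where
            τ : Fin (height x)
            τ = t mod height x
            ι : Fin (width x)
            ι = j mod width x
            c : Index x
            c = τ , ι , suc (suc (window# w))
            met : ∃[ g ] T (admits (index c) (f g))
            met = sat (index c) (cong kindOf (coords-index c))
            g : Fin (groups-of x)
            g = proj₁ met
            t′ : Fin (height x)
            t′ = proj₁ (ungroup g)
            j′ : Fin (width x)
            j′ = proj₂ (ungroup g)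
            b : Fin Q
            b = proj₁ (chosen (coords (f g)) g (grp-f g))
            f≡ : coords (f g) ≡ (t′ , j′ , suc (suc b))
            f≡ = proj₂ (chosen (coords (f g)) g (grp-f g))
            holds : T (admitsᵇ x c (t′ , j′ , suc (suc b)))
            holds = subst₂ (λ i k → T (admitsᵇ x i k)) (coords-index c) f≡ (proj₂ met)
            adm : Admits x (toℕ τ) (toℕ ι) (window (window# w)) (toℕ t′) (toℕ j′) (val b)
            adm = T⇒ (admitsᵇ-reflects x τ ι (window# w) t′ j′ b) holds
            cell≡ : val b ≡ cell (toℕ t′) (toℕ j′)
            cell≡ = trans (cong valueAt (sym f≡)) (cong (λ g → valueAt (coords (f g))) (sym
              (trans (cong₂ group (clamp-toℕ t′) (clamp-toℕ j′)) (group-ungroup g))))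
            moved : Admits x t j w (toℕ t′) (toℕ j′) (cell (toℕ t′) (toℕ j′))
            moved = subst (Admits x t j w (toℕ t′) (toℕ j′)) cell≡
              (subst₂ (λ t j → Admits x t j w (toℕ t′) (toℕ j′) (val b)) (clamp t<h) (clamp j<w)
                (subst (λ w → Admits x (toℕ τ) (toℕ ι) w (toℕ t′) (toℕ j′) (val b)) (window-window# w) adm))

        window-above : ℕ → ℕ → Window
        window-above t j = cell t (pos x) , cell t (pred j) , cell t j , cell t (suc j)

        -- Among the clauses of the cell there is one for the window that really stands above it. No
        -- cell above contradicts that window, so the clause is met by the cell itself.
        own : ∀ t j → suc t < height x → j < width x → Own x (suc t) j (window-above t j) (cell (suc t) j)
        own t j t<h j<w with satisfied (suc t) j (window-above t j) t<h j<w
        ... | _ , _ , _ , _ , inj₁ ((refl , refl) , o)                          = o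
        ... | _ , _ , _ , _ , inj₂ (inj₁ (refl , inj₁ (refl , ≢)))              = ⊥-elim (≢ refl)
        ... | _ , _ , _ , _ , inj₂ (inj₁ (refl , inj₂ (inj₁ (refl , ≢))))       = ⊥-elim (≢ refl)
        ... | _ , _ , _ , _ , inj₂ (inj₁ (refl , inj₂ (inj₂ (inj₁ (refl , ≢))))) = ⊥-elim (≢ refl)
        ... | _ , _ , _ , _ , inj₂ (inj₁ (refl , inj₂ (inj₂ (inj₂ (refl , ≢))))) = ⊥-elim (≢ refl)

        final : ∀ j → j < width x → (¬ j ≡ pos x ⊎ out (cell (T-max x) j) ≡ just true) ×
                                    (¬ j ≡ suc (pos x) ⊎ out (cell (T-max x) j) ≡ nothing)
        final j j<w with own (T-max x) j ≤-refl j<w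
        ... | inj₂ (inj₁ ((_ , t<pos) , _)) = ⊥-elim (<-irrefl refl t<pos)
        ... | inj₂ (inj₂ (_ , finals))      = finals

        accepting : Accepting (T-max x) (P-max x) x cell
        accepting = record
          { row-0       = row-0
          ; rows        = rows
          ; reads-true  = reads-true
          ; reads-blank = reads-blank }
          where
          row-0 : ∀ j → j < width x → Initial (T-max x) (P-max x) x j (cell 0 (pred j)) (cell 0 j)
          row-0 j j<w with satisfied 0 j (cell 0 (pred j) , default-val , default-val , default-val) z<s j<w
          ... | _ , _ , _ , _ , inj₁ ((refl , refl) , inj₁ (_ , I))        = I
          ... | _ , _ , _ , _ , inj₁ ((refl , refl) , inj₂ (inj₂ (t≮ , _))) = ⊥-elim (t≮ z<s)
          ... | _ , _ , _ , _ , inj₂ (inj₂ ((_ , refl) , refl , ≢))        = ⊥-elim (≢ refl)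
          rows : ∀ t j → t < T-max x → suc (suc j) < width x → cell (suc t) (suc j) ≡
                 successor (cell t (pos x)) (cell t j) (cell t (suc j)) (cell t (suc (suc j)))
          rows t j t<T j<w with own t (suc j) (m<n⇒m<1+n (s≤s t<T)) (<⇒≤ j<w)
          ... | inj₂ (inj₁ (_ , inj₂ (inj₁ j≮))) = ⊥-elim (j≮ (s≤s⁻¹ j<w))
          ... | inj₂ (inj₁ (_ , inj₂ (inj₂ e)))  = e
          ... | inj₂ (inj₂ (t≮ , _))             = ⊥-elim (t≮ (s≤s t<T))
          reads-true : out (cell (T-max x) (pos x)) ≡ just true
          reads-true with proj₁ (final (pos x) (s≤s (m≤m+n (pos x) (pos x))))
          ... | inj₁ ≢ = ⊥-elim (≢ refl)
          ... | inj₂ e = e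
          reads-blank : out (cell (T-max x) (suc (pos x))) ≡ nothing
          reads-blank with proj₂ (final (suc (pos x)) (s≤s (s≤s (m≤n+m (pos x) (T-max x)))))
          ... | inj₁ ≢ = ⊥-elim (≢ refl)
          ... | inj₂ e = e

      module Encode (cell : ℕ → ℕ → Val) (acc : Accepting (T-max x) (P-max x) x cell) where
        open Accepting acc

        f : Fin (groups-of x) → Fin (size-of x)
        f g = let t , j = ungroup g in index (t , j , choice# (cell (toℕ t) (toℕ j)))

        grp-f : ∀ g → grp (f g) ≡ just g
        grp-f g = trans (cong groupOf (coords-index _)) (cong just (group-ungroup g))

        Satisfiable : ℕ → ℕ → Window → Set
        Satisfiable t j w = ∃[ t′ ] ∃[ j′ ] t′ < height x × j′ < width x × Admits x t j w t′ j′ (cell t′ j′)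

        -- The left neighbour occurs in `y-chain` only, and at the left edge that condition is void.
        initial-first : ∀ {u u′ v} → Initial (T-max x) (P-max x) x 0 u v → Initial (T-max x) (P-max x) x 0 u′ v
        initial-first I = record
          { start-shape = start-shape ; head-here = head-here ; x-here = x-here
          ; y-left = y-left ; y-right = y-right ; y-chain = inj₁ λ () }
          where open Initial I

        first-row : ∀ j w → j < width x → Satisfiable 0 j w
        first-row zero    w j<w = 0 , 0 , z<s , j<w , inj₁ ((refl , refl) , inj₁ (refl , initial-first (row-0 0 j<w)))
        first-row (suc j) w j<w with cell 0 j ≟ⱽ above-head w
        ... | no  ≢ = 0 , j , z<s , <⇒≤ j<w , inj₂ (inj₂ ((refl , refl) , refl , ≢))
        ... | yes e = 0 , suc j , z<s , j<w , inj₁ ((refl , refl) , inj₁ (refl ,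
                        subst (λ u → Initial (T-max x) (P-max x) x (suc j) u (cell 0 (suc j))) e (row-0 (suc j) j<w)))

        pos<width : pos x < width x
        pos<width = s≤s (m≤m+n (pos x) (pos x))

        -- The four cells above are compared with `w` one by one. The first that differs meets the
        -- clause; if all agree, the transition rule applies to this cell.
        middle-row : ∀ t j w → t < T-max x → j < width x → Satisfiable (suc t) j w
        middle-row t zero    w t<T j<w = suc t , 0 , m<n⇒m<1+n (s≤s t<T) , j<w ,
          inj₁ ((refl , refl) , inj₂ (inj₁ ((z<s , s≤s t<T) , inj₁ refl)))
        middle-row t (suc j) w t<T j<w with suc j <? pos x + pos x
        ... | no  j≮ = suc t , suc j , m<n⇒m<1+n (s≤s t<T) , j<w ,
          inj₁ ((refl , refl) , inj₂ (inj₁ ((z<s , s≤s t<T) , inj₂ (inj₁ j≮))))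
        ... | yes j< with cell t (pos x) ≟ⱽ above-head w
        ...   | no ≢ = t , pos x , t<h , pos<width , inj₂ (inj₁ (refl , inj₁ (refl , ≢)))
          where t<h = m<n⇒m<1+n (m<n⇒m<1+n t<T)
        ...   | yes e₁ with cell t j ≟ⱽ above-left w
        ...     | no ≢ = t , j , t<h , <⇒≤ j<w , inj₂ (inj₁ (refl , inj₂ (inj₁ (refl , ≢))))
          where t<h = m<n⇒m<1+n (m<n⇒m<1+n t<T)
        ...     | yes e₂ with cell t (suc j) ≟ⱽ above-mid w
        ...       | no ≢ = t , suc j , t<h , j<w , inj₂ (inj₁ (refl , inj₂ (inj₂ (inj₁ (refl , ≢)))))
          where t<h = m<n⇒m<1+n (m<n⇒m<1+n t<T)
        ...       | yes e₃ with cell t (suc (suc j)) ≟ⱽ above-right w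
        ...         | no ≢ = t , suc (suc j) , t<h , s≤s j< , inj₂ (inj₁ (refl , inj₂ (inj₂ (inj₂ (refl , ≢)))))
          where t<h = m<n⇒m<1+n (m<n⇒m<1+n t<T)
        ...         | yes e₄ = suc t , suc j , m<n⇒m<1+n (s≤s t<T) , j<w ,
          inj₁ ((refl , refl) , inj₂ (inj₁ ((z<s , s≤s t<T) , inj₂ (inj₂
            (trans (rows t j t<T (s≤s j<)) (cong₂ (λ a (l , c , r) → successor a l c r) e₁ (cong₂ _,_ e₂ (cong₂ _,_ e₃ e₄))))))))

        -- If the cell above differs from `w`, it meets the clause. Otherwise `w` shows the true
        -- output symbol, and the two tests of acceptance hold for it.
        last-row : ∀ j w → j < width x → Satisfiable (pos x) j w
        last-row j w j<w with cell (T-max x) j ≟ⱽ above-mid w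
        ... | no  ≢ = T-max x , j , m<n⇒m<1+n ≤-refl , j<w , inj₂ (inj₁ (refl , inj₂ (inj₂ (inj₁ (refl , ≢)))))
        ... | yes e = pos x , j , ≤-refl , j<w ,
          inj₁ ((refl , refl) , inj₂ (inj₂ (<-irrefl refl , head-true , right-blank)))
          where
          head-true : ¬ j ≡ pos x ⊎ out (above-mid w) ≡ just true
          head-true with j ≟ pos x
          ... | no  ≢    = inj₁ ≢
          ... | yes refl = inj₂ (trans (cong out (sym e)) reads-true)
          right-blank : ¬ j ≡ suc (pos x) ⊎ out (above-mid w) ≡ nothing
          right-blank with j ≟ suc (pos x)
          ... | no  ≢    = inj₁ ≢
          ... | yes refl = inj₂ (trans (cong out (sym e)) reads-blank)

        satisfiable : ∀ t j w → t < height x → j < width x → Satisfiable t j w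
        satisfiable zero    j w _   j<w = first-row j w j<w
        satisfiable (suc t) j w t<h j<w with m≤n⇒m<n∨m≡n (s≤s⁻¹ (s≤s⁻¹ t<h))
        ... | inj₁ t<T  = middle-row t j w t<T j<w
        ... | inj₂ refl = last-row j w j<w

        clause-met : ∀ c → kindOf c ≡ clause →
                     ∃[ g ] T (admitsᵇ x c (coords (f g)))
        clause-met (t , j , suc (suc a)) _ =
          let t′ , j′ , t′<h , j′<w , adm = satisfiable (toℕ t) (toℕ j) (window a) (toℕ<n t) (toℕ<n j)
              τ = fromℕ< t′<h
              ι = fromℕ< j′<w
              v = cell (toℕ τ) (toℕ ι)
          in group τ ι ,
             subst (λ c′ → T (admitsᵇ x (t , j , suc (suc a)) c′))
               (sym (trans (coords-index _) (cong (λ (t , j) → t , j , choice# (cell (toℕ t) (toℕ j))) (ungroup-group τ ι))))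
               (⇒T (admitsᵇ-reflects x t j a τ ι (window# (v , v , v , v)))
                 (subst (Admits x (toℕ t) (toℕ j) (window a) (toℕ τ) (toℕ ι)) (sym (cong above-head (window-window# (v , v , v , v))))
                   (subst₂ (λ t′ j′ → Admits x (toℕ t) (toℕ j) (window a) t′ j′ (cell t′ j′))
                     (sym (toℕ-fromℕ< t′<h)) (sym (toℕ-fromℕ< j′<w)) adm)))

        solution : Solution
        solution = f , grp-f , λ i e → clause-met (coords i) e

      solution⇔ : Solution ⇔ (∃[ cell ] Accepting (T-max x) (P-max x) x cell)
      solution⇔ = mk⇔ (λ (f , grp-f , sat) → _ , Decode.accepting f grp-f sat)
                      (λ (cell , acc) → Encode.solution cell acc)

-- Injectivity of the encoding

module Encodings where

  open import Data.Bool.Base using (true; false; T)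
  open import Data.Fin.Base using (Fin; zero; suc)
  open import Data.List.Base using (List; _∷_; [_]; _++_; concat; tabulate; replicate)
  open import Data.List.Properties using (∷-injective; ++-assoc)
  open import Data.List.Membership.Propositional using () renaming (_∈_ to _∈ˡ_)
  open import Data.List.Relation.Unary.Unique.Propositional using (Unique)
  open import Data.Nat.Base using (ℕ; zero; suc; _≤_)
  open import Data.Nat.Binary.Base using (zero; 2[1+_]; 1+[2_])
  open import Data.Nat.Binary.Properties using (fromℕ-injective)
  open import Data.Product.Base using (_×_; _,_; proj₁; proj₂)
  open import Function.Base using (_∘_)
  open import Relation.Binary.Construct.Closure.ReflexiveTransitive using (ε; _◅_)
  open import Relation.Binary.PropositionalEquality hiding ([_])

  open Path

  module _ {n} {G G′ : Graph n} (same : ∀ u v → adjacent G u v ≡ adjacent G′ u v) where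

    walk-transport : ∀ {u v} → Walk G u v → Walk G′ u v
    walk-transport ε       = ε
    walk-transport (a ◅ w) = subst T (same _ _) a ◅ walk-transport w

    walk-transport-vertices : ∀ {u v} (w : Walk G u v) → walkVertices G′ (walk-transport w) ≡ walkVertices G w
    walk-transport-vertices ε           = refl
    walk-transport-vertices {u} (_ ◅ w) = cong (u ∷_) (walk-transport-vertices w)

    walk-transport-length : ∀ {u v} (w : Walk G u v) → walkLength G′ (walk-transport w) ≡ walkLength G w
    walk-transport-length ε       = refl
    walk-transport-length (_ ◅ w) = cong suc (walk-transport-length w)

    path-transport : ∀ {u v} → Path G u v → Path G′ u v
    path-transport P = record
      { walk   = walk-transport (walk P)
      ; simple = subst Unique (sym (walk-transport-vertices (walk P))) (simple P) }

  module _ {n} {G G′ : Graph n} (same : ∀ u v → adjacent G u v ≡ adjacent G′ u v) where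

    shortest-transport : ∀ {u v} → ShortestPath G u v → ShortestPath G′ u v
    shortest-transport (P , shortest) = path-transport {G′ = G′} same P , λ R →
      subst₂ _≤_ (sym (walk-transport-length {G′ = G′} same (walk P)))
                 (walk-transport-length {G = G′} {G′ = G} back (walk R))
                 (shortest (path-transport {G = G′} {G′ = G} back R))
      where
      back : ∀ u v → adjacent G′ u v ≡ adjacent G u v
      back u v = sym (same u v)

    -- Equal encodings make two adjacency functions agree pointwise, which is less than equality of
    -- the two graphs, so walks, shortest paths and assignments are carried over explicitly.
    geodetic-transport : ∀ {S} → IsStrongGeodetic G S → IsStrongGeodetic G′ S
    geodetic-transport (I , covers) =
      (λ u∈ v∈ u<v → shortest-transport (I u∈ v∈ u<v)) ,
      λ w w∉ → let u , v , u∈ , v∈ , u<v , w∈ = covers w w∉ in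
        u , v , u∈ , v∈ , u<v ,
        subst (w ∈ˡ_) (sym (walk-transport-vertices {G′ = G′} same (walk (proj₁ (I u∈ v∈ u<v))))) w∈

  module _ {A : Set} where

    tabulate-++-injective : ∀ {n} (f g : Fin n → A) {xs ys} → tabulate f ++ xs ≡ tabulate g ++ ys →
                            (∀ i → f i ≡ g i) × xs ≡ ys
    tabulate-++-injective {zero}  f g e = (λ ()) , e
    tabulate-++-injective {suc n} f g e =
      let e₀ , es = ∷-injective e
          fs , r  = tabulate-++-injective (f ∘ suc) (g ∘ suc) es
      in (λ { zero → e₀ ; (suc i) → fs i }) , r

    concat-tabulate-injective : ∀ {m n} (f g : Fin m → Fin n → A) {xs ys} →
      concat (tabulate λ i → tabulate (f i)) ++ xs ≡ concat (tabulate λ i → tabulate (g i)) ++ ys →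
      (∀ i j → f i j ≡ g i j) × xs ≡ ys
    concat-tabulate-injective {zero}  f g e = (λ ()) , e
    concat-tabulate-injective {suc m} f g {xs} {ys} e =
      let f₀ , es = tabulate-++-injective (f zero) (g zero)
                      (trans (sym (++-assoc (tabulate (f zero)) _ xs)) (trans e (++-assoc (tabulate (g zero)) _ ys)))
          fs , r  = concat-tabulate-injective (f ∘ suc) (g ∘ suc) es
      in (λ { zero → f₀ ; (suc i) → fs i }) , r

  binaryDigits-injective : ∀ {a b} → binaryDigits a ≡ binaryDigits b → a ≡ b
  binaryDigits-injective {zero}     {zero}     e = refl
  binaryDigits-injective {2[1+ a ]} {2[1+ b ]} e = cong 2[1+_] (binaryDigits-injective (proj₂ (∷-injective e)))
  binaryDigits-injective {1+[2 a ]} {1+[2 b ]} e = cong 1+[2_] (binaryDigits-injective (proj₂ (∷-injective e)))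

  replicate-injective : ∀ m n {xs ys} → replicate m true ++ false ∷ xs ≡ replicate n true ++ false ∷ ys → m ≡ n × xs ≡ ys
  replicate-injective zero    zero    e = refl , proj₂ (∷-injective e)
  replicate-injective (suc m) (suc n) e =
    let m≡n , r = replicate-injective m n (proj₂ (∷-injective e)) in cong suc m≡n , r

  data SameInstance {m} (G : Graph m) (k : ℕ) : ∀ {n} → Graph n → ℕ → Set where
    same : ∀ {G′} → (∀ u v → adjacent G u v ≡ adjacent G′ u v) → SameInstance G k G′ k

  -- The prefix 1ⁿ0 delimits itself and gives the order; then the length of the matrix is known, and
  -- the digits are what remains.
  encode-injective : ∀ {m n} {G : Graph m} {G′ : Graph n} {k l} →
                     encodeGraphNumber G k ≡ encodeGraphNumber G′ l → SameInstance G k G′ l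
  encode-injective {m} {n} {G} {G′} {k} e with replicate-injective m n e
  ... | refl , e′ = let adj≡ , r = concat-tabulate-injective (adjacent G) (adjacent G′) e′
                    in subst (SameInstance G k G′) (fromℕ-injective (binaryDigits-injective r)) (same adj≡)

-- The reduction and its correctness

module Hardness where

  open import Data.Bool.Base using (Bool; true; false; not; _∧_; _∨_)
  open import Data.Bool.Properties using (∨-identityʳ)
  open import Data.Fin.Base using (Fin; zero; suc; toℕ; combine)
  open import Data.Fin.Properties using (_≟_; toℕ-injective; remQuot-combine)
  open import Data.Fin.Subset using (∣_∣)
  open import Data.List.Base using ([]; _∷_; [_]; _++_; concat; tabulate; replicate; length)
  open import Data.Nat.Base hiding (_⊔_; ∣_-_∣)
  open import Data.Nat.Properties hiding (_≟_)
  open import Data.Product.Base using (∃-syntax; _×_; _,_; proj₁; proj₂)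
  open import Data.Vec.Base as Vec using (Vec; []; _∷_)
  open import Function.Base using (_∘_)
  open import Function.Bundles using (_⇔_; mk⇔; Equivalence)
  open import Relation.Nullary using (does; proof)
  open import Relation.Nullary.Reflects
  open import Relation.Binary.PropositionalEquality hiding ([_])

  open Bounds
  open Terms
  open Covers
  open Tableaux
  open Formulas
  open TableauCovers
  open Encodings

  instanceᵒ : ∀ {i} → Tm i 0 → Out i 0 → Tm i 0 → Out i 0
  instanceᵒ order matrix bound =
    for order (emit (constᶠ true)) ▹ emit (constᶠ false) ▹ matrix ▹ digitsᵒ bound

  instanceᵒ-value : ∀ {i} (order : Tm i 0) matrix bound {xs n bits k} → ⟦ order ⟧ xs [] ≡ n → ⟦ matrix ⟧ᵒ xs [] ≡ bits →
    ⟦ bound ⟧ xs [] ≡ k → ⟦ instanceᵒ order matrix bound ⟧ᵒ xs [] ≡ replicate n true ++ false ∷ bits ++ digits-of k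
  instanceᵒ-value order matrix bound {xs} refl refl refl = cong₂ _++_ (ones (⟦ order ⟧ xs []))
    (cong (λ ds → false ∷ ⟦ matrix ⟧ᵒ xs [] ++ ds) (digits-value bound xs []))
    where
    ones : ∀ n → concatTo n (λ _ → [ true ]) ≡ replicate n true
    ones zero    = refl
    ones (suc n) = trans (concatTo-suc n (λ _ → [ true ])) (cong (true ∷_) (ones n))

  module Emit (M : TM 2) (p q : Polynomial) where
    open TM M using (tapes)
    open TableauCover M p q

    module MeetsFormula (t j r t′ j′ r′ : Tm 1 6) where

      meets-φ : Fm 1 6
      meets-φ = (r ≐ lit 0) ∨ᶠ
                (((r ≐ lit 1) ∧ᶠ (lit 1 ≺ r′) ∧ᶠ (t ≐ t′) ∧ᶠ (j ≐ j′)) ∨ᶠ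
                 ((lit 1 ≺ r) ∧ᶠ (lit 1 ≺ r′) ∧ᶠ ClauseFormula.admits-φ t j r t′ j′ r′))

    module Forwards  = MeetsFormula v₅ v₄ v₃ v₂ v₁ v₀
    module Backwards = MeetsFormula v₂ v₁ v₀ v₅ v₄ v₃

    same-φ : Fm 1 6
    same-φ = (v₅ ≐ v₂) ∧ᶠ (v₄ ≐ v₁) ∧ᶠ (v₃ ≐ v₀)

    adj-φ : Fin 5 → Fin 5 → Fm 1 6
    adj-φ X X = ¬ᶠ same-φ
    adj-φ X C = constᶠ true
    adj-φ X H = constᶠ true
    adj-φ X Z = constᶠ false
    adj-φ X S = constᶠ false
    adj-φ C X = constᶠ true
    adj-φ C C = ¬ᶠ same-φ
    adj-φ C H = constᶠ true
    adj-φ C Z = constᶠ false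
    adj-φ C S = Forwards.meets-φ
    adj-φ H X = constᶠ true
    adj-φ H C = constᶠ true
    adj-φ H H = ¬ᶠ same-φ
    adj-φ H Z = same-φ
    adj-φ H S = constᶠ false
    adj-φ Z X = constᶠ false
    adj-φ Z C = constᶠ false
    adj-φ Z H = same-φ
    adj-φ Z Z = ¬ᶠ same-φ
    adj-φ Z S = constᶠ true
    adj-φ S X = constᶠ false
    adj-φ S C = Backwards.meets-φ
    adj-φ S H = constᶠ false
    adj-φ S Z = constᶠ true
    adj-φ S S = ¬ᶠ same-φ

    -- The nesting follows `index`, which combines t, j and r in this order, so the bits come out in
    -- the order of the vertex numbers.
    loop : ∀ {n} → Out 1 (suc (suc (suc n))) → Out 1 n
    loop e = for heightᵗ (for widthᵗ (for (lit (suc (suc Q))) e))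

    each-class : ∀ {n} → (Fin 5 → Out 1 n) → Out 1 n
    each-class e = e X ▹ e C ▹ e H ▹ e Z ▹ e S

    rowᵒ : Fin 5 → Out 1 3
    rowᵒ c = each-class λ d → loop (emit (adj-φ c d))

    indicesᵗ groupsᵗ orderᵗ budgetᵗ : Tm 1 0
    indicesᵗ = heightᵗ *ᵗ (widthᵗ *ᵗ lit (suc (suc Q)))
    groupsᵗ  = heightᵗ *ᵗ widthᵗ
    orderᵗ   = indicesᵗ ⊕ (indicesᵗ ⊕ (indicesᵗ ⊕ (indicesᵗ ⊕ (indicesᵗ ⊕ lit 0))))
    budgetᵗ  = indicesᵗ ⊕ (indicesᵗ ⊕ (lit 1 ⊕ groupsᵗ))

    matrixᵒ : Out 1 0
    matrixᵒ = each-class λ c → loop (rowᵒ c)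

    module Correct (x : BitString) where
      open ForInput x
      open Cover (cover x) using (meets; meets′; R; Γ; kind; grp; admits)
      open CoverGraph (cover x) using (G; budget)

      meetsᵇ : (t j r t′ j′ r′ : ℕ) → Bool → Bool
      meetsᵇ t j r t′ j′ r′ a = (r ≡ᵇ 0) ∨ (((r ≡ᵇ 1) ∧ (1 <ᵇ r′) ∧ (t ≡ᵇ t′) ∧ (j ≡ᵇ j′)) ∨ ((1 <ᵇ r) ∧ (1 <ᵇ r′) ∧ a))

      group-≟ : ∀ t j t′ j′ → does (group t j ≟ group t′ j′) ≡ (toℕ t ≡ᵇ toℕ t′) ∧ (toℕ j ≡ᵇ toℕ j′)
      group-≟ t j t′ j′ = det (proof (group t j ≟ group t′ j′)) (reflects-map
        (λ (e , e′) → cong₂ group (toℕ-injective e) (toℕ-injective e′))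
        (λ e → let e′ = trans (sym (ungroup-group t j)) (trans (cong ungroup e) (ungroup-group t′ j′))
               in cong (toℕ ∘ proj₁) e′ , cong (toℕ ∘ proj₂) e′)
        (≡ᵇ-reflects refl refl ×-reflects ≡ᵇ-reflects refl refl))

      -- The value a only matters when both indices stand for windows.
      meetsᵇ-value : ∀ t j r t′ j′ r′ {a} →
        (∀ {b c} → r ≡ suc (suc b) → r′ ≡ suc (suc c) → a ≡ admitsᵇ x (t , j , r) (t′ , j′ , r′)) →
        meetsᵇ (toℕ t) (toℕ j) (toℕ r) (toℕ t′) (toℕ j′) (toℕ r′) a ≡
        meets′ (kindOf (t , j , r)) (groupOf (t′ , j′ , r′)) (admitsᵇ x (t , j , r) (t′ , j′ , r′))
      meetsᵇ-value t j zero          t′ j′ r′            h = refl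
      meetsᵇ-value t j (suc zero)    t′ j′ zero          h = refl
      meetsᵇ-value t j (suc zero)    t′ j′ (suc zero)    h = refl
      meetsᵇ-value t j (suc zero)    t′ j′ (suc (suc c)) h =
        trans (∨-identityʳ _) (sym (group-≟ t j t′ j′))
      meetsᵇ-value t j (suc (suc b)) t′ j′ zero          h = refl
      meetsᵇ-value t j (suc (suc b)) t′ j′ (suc zero)    h = refl
      meetsᵇ-value t j (suc (suc b)) t′ j′ (suc (suc c)) h = h refl refl

      env : Fin R → Fin R → Vec ℕ 6
      env i j = vars (coords i) (coords j)

      coords-injective : ∀ {i j} → coords i ≡ coords j → i ≡ j
      coords-injective {i} {j} e = trans (sym (index-coords i)) (trans (cong index e) (index-coords j))

      same-value : ∀ i j → ⟦ same-φ ⟧ᶠ (x ∷ []) (env i j) ≡ does (i ≟ j)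
      same-value i j = det
        (≡ᵇ-reflects refl refl ×-reflects (≡ᵇ-reflects refl refl ×-reflects ≡ᵇ-reflects refl refl))
        (reflects-map
          (λ e → cong (toℕ ∘ proj₁ ∘ coords) e , cong (toℕ ∘ proj₁ ∘ proj₂ ∘ coords) e , cong (toℕ ∘ proj₂ ∘ proj₂ ∘ coords) e)
          (λ (e₁ , e₂ , e₃) → coords-injective (cong₂ _,_ (toℕ-injective e₁) (cong₂ _,_ (toℕ-injective e₂) (toℕ-injective e₃))))
          (proof (i ≟ j)))

      forwards-value : ∀ i j → ⟦ Forwards.meets-φ ⟧ᶠ (x ∷ []) (env i j) ≡ meets i j
      forwards-value i j = meetsᵇ-value _ _ _ _ _ _ λ _ _ → sym (admitsᵇ-value x (coords i) (coords j))

      -- The two formulas differ as terms, but their values reflect the same statement `Admits`, and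
      -- this determines a Boolean.
      backwards-admits : ∀ c d {b b′} → proj₂ (proj₂ c) ≡ suc (suc b) → proj₂ (proj₂ d) ≡ suc (suc b′) →
        ⟦ ClauseFormula.admits-φ v₂ v₁ v₀ v₅ v₄ v₃ ⟧ᶠ (x ∷ []) (vars c d) ≡ admitsᵇ x d c
      backwards-admits (t , j , .(suc (suc b))) (t′ , j′ , .(suc (suc b′))) {b} {b′} refl refl = det
        (ClauseFormula.admits-reflects v₂ v₁ v₀ v₅ v₄ v₃ x {vars (t , j , suc (suc b)) (t′ , j′ , suc (suc b′))}
          refl refl refl refl refl refl)
        (admitsᵇ-reflects x t′ j′ b′ t j b)

      backwards-value : ∀ i j → ⟦ Backwards.meets-φ ⟧ᶠ (x ∷ []) (env i j) ≡ meets j i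
      backwards-value i j = meetsᵇ-value _ _ _ _ _ _ λ e e′ → backwards-admits (coords i) (coords j) e′ e

      adj-value : ∀ c d i j → ⟦ adj-φ c d ⟧ᶠ (x ∷ []) (env i j) ≡ adj meets (c , i) (d , j)
      adj-value X X i j = cong not (same-value i j)
      adj-value X C i j = refl
      adj-value X H i j = refl
      adj-value X Z i j = refl
      adj-value X S i j = refl
      adj-value C X i j = refl
      adj-value C C i j = cong not (same-value i j)
      adj-value C H i j = refl
      adj-value C Z i j = refl
      adj-value C S i j = forwards-value i j
      adj-value H X i j = refl
      adj-value H C i j = refl
      adj-value H H i j = cong not (same-value i j)
      adj-value H Z i j = same-value i j
      adj-value H S i j = refl
      adj-value Z X i j = refl
      adj-value Z C i j = refl
      adj-value Z H i j = same-value i j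
      adj-value Z Z i j = cong not (same-value i j)
      adj-value Z S i j = refl
      adj-value S X i j = refl
      adj-value S C i j = backwards-value i j
      adj-value S H i j = refl
      adj-value S Z i j = refl
      adj-value S S i j = cong not (same-value i j)

      pos-value : ∀ {n} {ρ : Vec ℕ n} → ⟦ posᵗ ⟧ (x ∷ []) ρ ≡ pos x
      pos-value {n} {ρ} = ClauseFormula.posᵗ-value {n} (lit 0) (lit 0) (lit 0) (lit 0) (lit 0) (lit 0) x {ρ}

      height-value : ∀ {n} {ρ : Vec ℕ n} → ⟦ heightᵗ ⟧ (x ∷ []) ρ ≡ height x
      height-value = cong suc pos-value

      width-value : ∀ {n} {ρ : Vec ℕ n} → ⟦ widthᵗ ⟧ (x ∷ []) ρ ≡ width x
      width-value = cong suc (cong₂ _+_ pos-value pos-value)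

      push-coords : ∀ {n} → Index x → Vec ℕ n → Vec ℕ (suc (suc (suc n)))
      push-coords (t , j , r) ρ = toℕ r ∷ toℕ j ∷ toℕ t ∷ ρ

      loop-value : ∀ {n} (e : Out 1 (suc (suc (suc n)))) ρ →
                   ⟦ loop e ⟧ᵒ (x ∷ []) ρ ≡ gather R λ i → ⟦ e ⟧ᵒ (x ∷ []) (push-coords (coords i) ρ)
      loop-value e ρ = trans (as-gather height-value λ t → as-gather width-value λ j → as-gather refl λ r → refl)
        (trans (gather-cong λ t → gather-cong λ j → gather-cong λ r →
                 cong (λ c → ⟦ e ⟧ᵒ (x ∷ []) (push-coords c ρ)) (sym (coords-index (t , j , r))))
        (sym (gather-index λ i → ⟦ e ⟧ᵒ (x ∷ []) (push-coords (coords i) ρ))))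
        where
        as-gather : ∀ {m n} {f : ℕ → BitString} {g : Fin n → BitString} → m ≡ n → (∀ i → f (toℕ i) ≡ g i) →
                    concatTo m f ≡ gather n g
        as-gather {f = f} refl h = concatTo≡gather _ f _ h

      each-class-value : ∀ {n} (e : Fin 5 → Out 1 n) ρ → ⟦ each-class e ⟧ᵒ (x ∷ []) ρ ≡ gather 5 λ c → ⟦ e c ⟧ᵒ (x ∷ []) ρ
      each-class-value e ρ = sym (trans (gather-suc f₀) (cong (f₀ zero ++_) (trans (gather-suc f₁) (cong (f₁ zero ++_)
        (trans (gather-suc f₂) (cong (f₂ zero ++_) (trans (gather-suc f₃) (cong (f₃ zero ++_) (gather-1 f₄)))))))))
        where
        f₀ : Fin 5 → BitString
        f₀ c = ⟦ e c ⟧ᵒ (x ∷ []) ρ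
        f₁ : Fin 4 → BitString
        f₁ = f₀ ∘ suc
        f₂ : Fin 3 → BitString
        f₂ = f₁ ∘ suc
        f₃ : Fin 2 → BitString
        f₃ = f₂ ∘ suc
        f₄ : Fin 1 → BitString
        f₄ = f₃ ∘ suc

      row-bits : Fin 5 → Fin R → BitString
      row-bits c i = gather 5 λ d → gather R λ j → [ adjacent G (combine c i) (combine d j) ]

      row-value : ∀ c i → ⟦ rowᵒ c ⟧ᵒ (x ∷ []) (push-coords (coords i) []) ≡ row-bits c i
      row-value c i = trans (each-class-value (λ d → loop (emit (adj-φ c d))) ρ)
        (gather-cong {n = 5} λ d → trans (loop-value (emit (adj-φ c d)) ρ) (gather-cong {n = R} λ j → cong [_]
          (trans (adj-value c d i j) (sym (cong₂ (adj meets) (remQuot-combine {5} {R} c i) (remQuot-combine {5} {R} d j))))))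
        where
        ρ : Vec ℕ 3
        ρ = push-coords (coords i) []

      rows-value : ∀ c → ⟦ loop (rowᵒ c) ⟧ᵒ (x ∷ []) [] ≡ gather R (row-bits c)
      rows-value c = trans (loop-value (rowᵒ c) []) (gather-cong {n = R} (row-value c))

      matrix-value : ∀ {m} → m ≡ matrixᵒ → ⟦ m ⟧ᵒ (x ∷ []) [] ≡ concat (tabulate λ u → tabulate (adjacent G u))
      matrix-value refl = trans (each-class-value (λ c → loop (rowᵒ c)) [])
        (trans (gather-cong {n = 5} {f = λ c → ⟦ loop (rowᵒ c) ⟧ᵒ (x ∷ []) []} {g = λ c → gather R (row-bits c)} rows-value)
               (sym (gather-matrix 5 R (adjacent G))))

      indices-value : ⟦ indicesᵗ ⟧ (x ∷ []) [] ≡ R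
      indices-value = trans (*ᵗ-value heightᵗ (widthᵗ *ᵗ lit (suc (suc Q))))
        (trans (cong₂ _*_ height-value (trans (*ᵗ-value widthᵗ (lit (suc (suc Q)))) (cong (_* suc (suc Q)) width-value)))
               (sym (size-of-value x)))

      groups-value : ⟦ groupsᵗ ⟧ (x ∷ []) [] ≡ Γ
      groups-value = trans (*ᵗ-value heightᵗ widthᵗ) (trans (cong₂ _*_ height-value width-value) (sym (groups-of-value x)))

      order-value : ⟦ orderᵗ ⟧ (x ∷ []) [] ≡ 5 * R
      order-value = cong₂ _+_ indices-value (cong₂ _+_ indices-value (cong₂ _+_ indices-value
        (cong₂ _+_ indices-value (cong (_+ 0) indices-value))))

      budget-value : ⟦ budgetᵗ ⟧ (x ∷ []) [] ≡ budget
      budget-value = cong₂ _+_ indices-value (cong₂ _+_ indices-value (cong suc groups-value))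

    -- Abstract, to keep the terms from being evaluated during unification.
    abstract
      orderᵃ budgetᵃ : Tm 1 0
      orderᵃ  = orderᵗ
      budgetᵃ = budgetᵗ

      matrixᵃ : Out 1 0
      matrixᵃ = matrixᵒ

      order≡ : orderᵃ ≡ orderᵗ
      order≡ = refl

      budget≡ : budgetᵃ ≡ budgetᵗ
      budget≡ = refl

      matrix≡ : matrixᵃ ≡ matrixᵒ
      matrix≡ = refl

    reduce : BitString → BitString
    reduce x = ⟦ instanceᵒ orderᵃ matrixᵃ budgetᵃ ⟧ᵒ (x ∷ []) []

    reduce-polyTime : PolyTime {1} (λ xs → reduce (Vec.head xs))
    reduce-polyTime = out-polyTime (instanceᵒ orderᵃ matrixᵃ budgetᵃ) λ { (x ∷ []) → refl }

    reduce-value : ∀ x → reduce x ≡ encodeGraphNumber (CoverGraph.G (cover x)) (CoverGraph.budget (cover x))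
    reduce-value x = instanceᵒ-value orderᵃ matrixᵃ budgetᵃ
      (trans (cong (λ t → ⟦ t ⟧ (x ∷ []) []) order≡) (Correct.order-value x))
      (Correct.matrix-value x matrix≡)
      (trans (cong (λ t → ⟦ t ⟧ (x ∷ []) []) budget≡) (Correct.budget-value x))

  StrongGeodeticCoBipartite : DecisionProblem
  StrongGeodeticCoBipartite = StrongGeodetic restrictedTo (λ i → CoBipartite (graph i))

  module _ (P : Cover) where
    open Cover P
    open CoverGraph P

    coverInstance : NonZero (5 * R) → StrongGeodeticInstance
    coverInstance nz = record
      { order = 5 * R ; graph = G ; bound = budget ; nonempty = nz ; connected = G-connected
      ; positive = subst NonZero (sym (trans (cong (R +_) (+-suc R Γ)) (+-suc R (R + Γ)))) _ }

    -- A word of the language comes from some instance, not necessarily from `coverInstance`. By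
    -- `encode-injective` that instance has the same adjacencies and bound, so its strong geodetic
    -- set carries over.
    cover-encoding : ∀ {w} → NonZero (5 * R) → w ≡ encodeGraphNumber G budget →
                     languageOf StrongGeodeticCoBipartite w ⇔ Solution
    cover-encoding nz refl = mk⇔
      (λ ((i , _) , (A , geodetic , small) , e) → backwards A geodetic small (encode-injective {G = G} {graph i} e))
      (λ s → (coverInstance nz , G-coBipartite) , Equivalence.from reduction s , refl)
      where
      backwards : ∀ {n k} {G′ : Graph n} A → IsStrongGeodetic G′ A → ∣ A ∣ ≤ k → SameInstance G budget G′ k → Solution
      backwards A geodetic small (same eq) =
        Equivalence.to reduction (A , geodetic-transport (λ u v → sym (eq u v)) geodetic , small)

  npHard : NPHard (languageOf StrongGeodeticCoBipartite)
  npHard A (V , (M , q , runs) , p , spec) =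
    reduce , reduce-polyTime , λ x → mk⇔
      (λ a → Equivalence.from (encoding x) (Equivalence.from (Equiv.solution⇔ x) (accept x (Equivalence.to (spec x) a))))
      (λ l → Equivalence.from (spec x) (certify x (Equivalence.to (Equiv.solution⇔ x) (Equivalence.to (encoding x) l))))
    where
    open TM M using (output; initial)
    open Tableau M
    open TableauCover M p q
    open Emit M p q
    module Equiv = TableauCover.Equivalence M p q

    encoding : ∀ x → languageOf StrongGeodeticCoBipartite (reduce x) ⇔ Cover.Solution (cover x)
    encoding x = cover-encoding (cover x) (subst (λ n → NonZero (5 * n)) (sym (size-of-value x)) _) (reduce-value x)

    time-enough : ∀ x y → length y ≤ certBound x → length x + (length y + 0) ≤ length x + certBound x
    time-enough x y y≤ = +-monoʳ-≤ (length x) (≤-trans (≤-reflexive (+-identityʳ (length y))) y≤)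

    -- One time bound serves all certificates: the polynomial is monotone and is taken at the
    -- greatest length, and a run that halts earlier stays in its last configuration.
    run : ∀ x y → length y ≤ certBound x → output (conf (initialFor x y) (timeBound x)) ≡ V (x ∷ y ∷ [])
    run x y y≤ = let t , c , halts , t≤ , out≡ = runs (x ∷ y ∷ []) in
      trans (cong output (conf-halted (timeBound x) halts (≤-trans t≤ (eval-mono q (time-enough x y y≤))))) out≡

    accept : ∀ x → (∃[ y ] length y ≤ certBound x × V (x ∷ y ∷ []) ≡ [ true ]) →
             ∃[ cell ] Accepting (timeBound x) (certBound x) x cell
    accept x (y , y≤ , e) = _ , accepted⇒ (timeBound x) (certBound x) x y y≤ (trans (run x y y≤) e)

    certify : ∀ x → (∃[ cell ] Accepting (timeBound x) (certBound x) x cell) →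
              ∃[ y ] length y ≤ certBound x × V (x ∷ y ∷ []) ≡ [ true ]
    certify x (cell , acc) = y , y≤ , trans (sym (run x y y≤)) (accepted (timeBound x) (certBound x) x cell acc)
      where
      y  = certificate (timeBound x) (certBound x) x cell acc
      y≤ = certificate-≤ (timeBound x) (certBound x) x cell acc

-- The conditions checked by the verifier, as a formula

module Verification where

  open import Data.Fin using (#_)
  open import Data.Fin.Base as Fin using (Fin; zero; suc; toℕ; fromℕ<)
  open import Data.Fin.Properties as Fin using (toℕ-injective; toℕ<n; toℕ-fromℕ<)
  open import Data.Nat.Base hiding (_⊔_; ∣_-_∣)
  open import Data.Nat.Properties
  open import Data.Product.Base using (Σ; ∃; ∃-syntax; _×_; _,_)
  open import Data.Sum.Base using (_⊎_)
  open import Data.Vec.Base using (Vec; []; _∷_)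
  open import Relation.Nullary using (¬_)
  open import Relation.Nullary.Decidable using (True)
  open import Relation.Nullary.Reflects
  open import Relation.Binary.PropositionalEquality hiding ([_])

  open Terms
  open Formulas

  -- The loop runs over numbers while `P` speaks of `Fin n`. The statement is moved along `fromℕ<`,
  -- whose value does not depend on the proof of `k < n`.
  all-reflects : ∀ {n} {P : Fin n → Set} {f} → (∀ i → Reflects (P i) (f (toℕ i))) → Reflects (∀ i → P i) (allTo n f)
  all-reflects {n} {P} {f} h = reflects-map
    (λ ps i → subst P (toℕ-injective (toℕ-fromℕ< (toℕ<n i))) (ps (toℕ i) (toℕ<n i) (toℕ<n i)))
    (λ ps k k<n k<n′ → ps (fromℕ< k<n′))
    (allTo-reflects {λ k → (k<n : k < n) → P (fromℕ< k<n)} n λ k k<n → reflects-map (λ p k<n′ → subst P (toℕ-injective (trans (toℕ-fromℕ< k<n) (sym (toℕ-fromℕ< k<n′)))) p)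
      (λ p → p k<n) (subst (λ k → Reflects (P (fromℕ< k<n)) (f k)) (toℕ-fromℕ< k<n) (h (fromℕ< k<n))))

  any-reflects : ∀ {n} {P : Fin n → Set} {f} → (∀ i → Reflects (P i) (f (toℕ i))) → Reflects (∃ P) (anyTo n f)
  any-reflects {n} {P} {f} h = reflects-map
    (λ (k , k<n , k<n′ , p) → fromℕ< k<n′ , p)
    (λ (i , p) → toℕ i , toℕ<n i , toℕ<n i , subst P (sym (toℕ-injective (toℕ-fromℕ< (toℕ<n i)))) p)
    (anyTo-reflects {λ k → Σ (k < n) λ k<n → P (fromℕ< k<n)} n λ k k<n → reflects-map (λ p → k<n , p)
      (λ (k<n′ , p) → subst P (toℕ-injective (trans (toℕ-fromℕ< k<n′) (sym (toℕ-fromℕ< k<n)))) p)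
      (subst (λ k → Reflects (P (fromℕ< k<n)) (f k)) (toℕ-fromℕ< k<n) (h (fromℕ< k<n))))

  ≟-reflects : ∀ {n} (i j : Fin n) → Reflects (i ≡ j) (toℕ i ≡ᵇ toℕ j)
  ≟-reflects i j = reflects-map toℕ-injective (cong toℕ) (≡ᵇ-reflects refl refl)

  -- What the verifier checks about a graph with edges E on n vertices, given a
  -- clique A, a set S and, for each pair of vertices, a set K of marked vertices.
  module Conditions {n : ℕ} (E : Fin n → Fin n → Set) (A S : Fin n → Set) (K : Fin n → Fin n → Fin n → Set) where

    -- u, a, b, v is a shortest path, possibly with repetitions.
    Short : Fin n → Fin n → Fin n → Fin n → Set
    Short u a b v =
      (E u v × a ≡ u × b ≡ u) ⊎
      (¬ E u v × E u a × E a v × b ≡ a) ⊎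
      (¬ E u v × (∀ m → ¬ (E u m × E m v)) × E u a × E a b × E b v)

    On : Fin n → Fin n → Fin n → Fin n → Fin n → Set
    On u a b v w = w ≡ u ⊎ w ≡ v ⊎ w ≡ a ⊎ w ≡ b

    Valid : Set
    Valid =
      (∀ u v → E u v → E v u) ×
      (∀ u → ¬ E u u) ×
      (∀ u v → ¬ u ≡ v → (A u × A v ⊎ ¬ A u × ¬ A v) → E u v) ×
      -- Required for all pairs and not only for those in S, so that connectedness is certified as
      -- well. The interior vertices a and b are searched for; the certificate only marks what the
      -- path has to contain.
      (∀ u v → u Fin.< v → ∃[ a ] ∃[ b ] Short u a b v × (∀ w → K u v w → On u a b v w)) ×
      (∀ w → ¬ S w → ∃[ u ] ∃[ v ] u Fin.< v × S u × S v × K u v w)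

  v# : ∀ k {n} {k<n : True (k <? n)} → Tm 2 n
  v# k {n} {k<n} = var (#_ k {n} {k<n})

  -- The matrix is stored row by row after the n + 1 bits of 1ⁿ0. A set bit has the code 2, so a
  -- position beyond the end of the word counts as no edge.
  edge-φ : ∀ {k} → Tm 2 k → Tm 2 k → Tm 2 k → Fm 2 k
  edge-φ n u v = bit zero (n ⊕ lit 1 ⊕ (u *ᵗ n ⊕ v)) ≐ lit 2

  clique-φ : ∀ {k} → Tm 2 k → Fm 2 k
  clique-φ u = bit (suc zero) u ≐ lit 2

  chosen-φ : ∀ {k} → Tm 2 k → Tm 2 k → Fm 2 k
  chosen-φ n u = bit (suc zero) (n ⊕ u) ≐ lit 2

  -- The marks follow the 2n bits for the clique and the set, as a matrix with n columns in which
  -- the pair (u , v) has the row u n + v.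
  mark-φ : ∀ {k} → Tm 2 k → Tm 2 k → Tm 2 k → Tm 2 k → Fm 2 k
  mark-φ n u v w = bit (suc zero) (n ⊕ n ⊕ ((u *ᵗ n ⊕ v) *ᵗ n ⊕ w)) ≐ lit 2

  infixr 2 _⇒ᶠ_
  _⇒ᶠ_ : ∀ {i k} → Fm i k → Fm i k → Fm i k
  φ ⇒ᶠ ψ = (¬ᶠ φ) ∨ᶠ ψ

  short-φ : Fm 2 5
  short-φ =
    (edge u v ∧ᶠ (a ≐ u) ∧ᶠ (b ≐ u)) ∨ᶠ
    ((¬ᶠ edge u v) ∧ᶠ edge u a ∧ᶠ edge a v ∧ᶠ (b ≐ a)) ∨ᶠ
    ((¬ᶠ edge u v) ∧ᶠ all n (¬ᶠ (edge-φ (v# 5) (v# 4) (v# 0) ∧ᶠ edge-φ (v# 5) (v# 0) (v# 3))) ∧ᶠ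
     edge u a ∧ᶠ edge a b ∧ᶠ edge b v)
    where
    n u v a b : Tm 2 5
    n = v# 4
    u = v# 3
    v = v# 2
    a = v# 1
    b = v# 0
    edge : Tm 2 5 → Tm 2 5 → Fm 2 5
    edge = edge-φ n

  on-φ : Fm 2 6
  on-φ = (v# 0 ≐ v# 4) ∨ᶠ (v# 0 ≐ v# 3) ∨ᶠ (v# 0 ≐ v# 2) ∨ᶠ (v# 0 ≐ v# 1)

  valid-φ : Fm 2 1
  valid-φ =
    all n (all (wk n) (edge-φ n₃ u₃ v₃ ⇒ᶠ edge-φ n₃ v₃ u₃)) ∧ᶠ
    all n (¬ᶠ edge-φ (v# 1) (v# 0) (v# 0)) ∧ᶠ
    all n (all (wk n) ((¬ᶠ (u₃ ≐ v₃)) ⇒ᶠ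
      ((clique-φ u₃ ∧ᶠ clique-φ v₃) ∨ᶠ ((¬ᶠ clique-φ u₃) ∧ᶠ (¬ᶠ clique-φ v₃))) ⇒ᶠ edge-φ n₃ u₃ v₃)) ∧ᶠ
    all n (all (wk n) ((u₃ ≺ v₃) ⇒ᶠ any n₃ (any (v# 3)
      (short-φ ∧ᶠ all (v# 4) (mark-φ (v# 5) (v# 4) (v# 3) (v# 0) ⇒ᶠ on-φ))))) ∧ᶠ
    all n ((¬ᶠ chosen-φ (v# 1) (v# 0)) ⇒ᶠ any (v# 1) (any (v# 2)
      ((v# 1 ≺ v# 0) ∧ᶠ chosen-φ (v# 3) (v# 1) ∧ᶠ chosen-φ (v# 3) (v# 0) ∧ᶠ mark-φ (v# 3) (v# 1) (v# 0) (v# 2))))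
    where
    n : Tm 2 1
    n = v# 0
    n₃ u₃ v₃ : Tm 2 3
    n₃ = v# 2
    u₃ = v# 1
    v₃ = v# 0

  module _ {w y : BitString} {n : ℕ}
           {E : Fin n → Fin n → Set} {A S : Fin n → Set} {K : Fin n → Fin n → Fin n → Set}
           (edge-bit : ∀ u v → Reflects (E u v) (bitAt w (n + 1 + (toℕ u * n + toℕ v)) ≡ᵇ 2))
           (clique-bit : ∀ u → Reflects (A u) (bitAt y (toℕ u) ≡ᵇ 2))
           (chosen-bit : ∀ u → Reflects (S u) (bitAt y (n + toℕ u) ≡ᵇ 2))
           (mark-bit : ∀ u v x → Reflects (K u v x) (bitAt y (n + n + ((toℕ u * n + toℕ v) * n + toℕ x)) ≡ᵇ 2)) where

    open Conditions E A S K

    private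
      xs : Vec BitString 2
      xs = w ∷ y ∷ []

    edge-reflects : ∀ {k} (ρ : Vec ℕ k) nᵗ uᵗ vᵗ u v → ⟦ nᵗ ⟧ xs ρ ≡ n → ⟦ uᵗ ⟧ xs ρ ≡ toℕ u → ⟦ vᵗ ⟧ xs ρ ≡ toℕ v →
                    Reflects (E u v) (⟦ edge-φ nᵗ uᵗ vᵗ ⟧ᶠ xs ρ)
    edge-reflects ρ nᵗ uᵗ vᵗ u v en eu ev = reflects-≡
      (cong (λ p → bitAt w p ≡ᵇ 2) (cong₂ _+_ (cong (_+ 1) en) (cong₂ _+_ (trans (*ᵗ-value uᵗ nᵗ) (cong₂ _*_ eu en)) ev)))
      (edge-bit u v)

    mark-reflects : ∀ {k} (ρ : Vec ℕ k) nᵗ uᵗ vᵗ xᵗ u v x → ⟦ nᵗ ⟧ xs ρ ≡ n → ⟦ uᵗ ⟧ xs ρ ≡ toℕ u → ⟦ vᵗ ⟧ xs ρ ≡ toℕ v →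
                    ⟦ xᵗ ⟧ xs ρ ≡ toℕ x → Reflects (K u v x) (⟦ mark-φ nᵗ uᵗ vᵗ xᵗ ⟧ᶠ xs ρ)
    mark-reflects ρ nᵗ uᵗ vᵗ xᵗ u v x en eu ev ex = reflects-≡
      (cong (λ p → bitAt y p ≡ᵇ 2) (cong₂ _+_ (cong₂ _+_ en en)
        (cong₂ _+_ (trans (*ᵗ-value (uᵗ *ᵗ nᵗ ⊕ vᵗ) nᵗ) (cong₂ _*_ (cong₂ _+_ (trans (*ᵗ-value uᵗ nᵗ) (cong₂ _*_ eu en)) ev) en)) ex)))
      (mark-bit u v x)

    short-reflects : ∀ u v a b → Reflects (Short u a b v)
                       (⟦ short-φ ⟧ᶠ xs (toℕ b ∷ toℕ a ∷ toℕ v ∷ toℕ u ∷ n ∷ []))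
    short-reflects u v a b =
      (uv ×-reflects (≟-reflects a u ×-reflects ≟-reflects b u)) ⊎-reflects
      ((¬-reflects uv ×-reflects (edge (v# 3) (v# 1) u a refl refl ×-reflects
        (edge (v# 1) (v# 2) a v refl refl ×-reflects ≟-reflects b a))) ⊎-reflects
       (¬-reflects uv ×-reflects
        (all-reflects (λ m → ¬-reflects
           (edge-reflects (toℕ m ∷ ρ) (v# 5) (v# 4) (v# 0) u m refl refl refl ×-reflects
            edge-reflects (toℕ m ∷ ρ) (v# 5) (v# 0) (v# 3) m v refl refl refl)) ×-reflects
         (edge (v# 3) (v# 1) u a refl refl ×-reflects
          (edge (v# 1) (v# 0) a b refl refl ×-reflects edge (v# 0) (v# 2) b v refl refl)))))
      where
      ρ : Vec ℕ 5
      ρ = toℕ b ∷ toℕ a ∷ toℕ v ∷ toℕ u ∷ n ∷ []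
      edge : ∀ sᵗ tᵗ s t → ⟦ sᵗ ⟧ xs ρ ≡ toℕ s → ⟦ tᵗ ⟧ xs ρ ≡ toℕ t → Reflects (E s t) (⟦ edge-φ (v# 4) sᵗ tᵗ ⟧ᶠ xs ρ)
      edge sᵗ tᵗ s t = edge-reflects ρ (v# 4) sᵗ tᵗ s t refl
      uv = edge (v# 3) (v# 2) u v refl refl

    valid-reflects : Reflects Valid (⟦ valid-φ ⟧ᶠ xs (n ∷ []))
    valid-reflects =
      all-reflects (λ u → all-reflects λ v → uv u v →-reflects vu u v) ×-reflects
      (all-reflects (λ u → ¬-reflects (edge-reflects (toℕ u ∷ n ∷ []) (v# 1) (v# 0) (v# 0) u u refl refl refl)) ×-reflects
      (all-reflects (λ u → all-reflects λ v → ¬-reflects (≟-reflects u v) →-reflects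
        (((clique-bit u ×-reflects clique-bit v) ⊎-reflects (¬-reflects (clique-bit u) ×-reflects ¬-reflects (clique-bit v)))
         →-reflects uv u v)) ×-reflects
      (all-reflects (λ u → all-reflects λ v → <ᵇ-reflects refl refl →-reflects
        (any-reflects λ a → any-reflects λ b → short-reflects u v a b ×-reflects
          (all-reflects λ x →
            mark-reflects (toℕ x ∷ toℕ b ∷ toℕ a ∷ toℕ v ∷ toℕ u ∷ n ∷ []) (v# 5) (v# 4) (v# 3) (v# 0) u v x refl refl refl refl →-reflects
            (≟-reflects x u ⊎-reflects (≟-reflects x v ⊎-reflects (≟-reflects x a ⊎-reflects ≟-reflects x b)))))) ×-reflects
      all-reflects (λ x → ¬-reflects (chosen-bit x) →-reflects
        (any-reflects λ u → any-reflects λ v → <ᵇ-reflects refl refl ×-reflects (chosen-bit u ×-reflects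
          (chosen-bit v ×-reflects
           mark-reflects (toℕ v ∷ toℕ u ∷ toℕ x ∷ n ∷ []) (v# 3) (v# 1) (v# 0) (v# 2) u v x refl refl refl refl)))))))
      where
      uv : ∀ u v → Reflects (E u v) (⟦ edge-φ (v# 2) (v# 1) (v# 0) ⟧ᶠ xs (toℕ v ∷ toℕ u ∷ n ∷ []))
      uv u v = edge-reflects (toℕ v ∷ toℕ u ∷ n ∷ []) (v# 2) (v# 1) (v# 0) u v refl refl refl
      vu : ∀ u v → Reflects (E v u) (⟦ edge-φ (v# 2) (v# 0) (v# 1) ⟧ᶠ xs (toℕ v ∷ toℕ u ∷ n ∷ []))
      vu u v = edge-reflects (toℕ v ∷ toℕ u ∷ n ∷ []) (v# 2) (v# 0) (v# 1) v u refl refl refl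

-- Soundness and completeness of the checked conditions

module Certificates where

  open import Data.Bool.Base using (Bool; true; false; T)
  open import Data.Bool.Properties using (T?)
  import Data.Bool.Properties as Bool
  open import Data.Empty using (⊥-elim)
  open import Data.Fin.Base as Fin using (Fin; suc)
  open import Data.Fin.Properties as Fin using (_≟_; any?; _<?_)
  open import Data.Fin.Subset using (Subset; _∈_; _∉_; ∁)
  open import Data.Fin.Subset.Properties using (_∈?_; x∉p⇒x∈∁p; x∈∁p⇒x∉p)
  open import Data.List.Membership.Propositional using () renaming (_∈_ to _∈ˡ_)
  open import Data.List.Relation.Unary.Any using (here; there)
  open import Data.Nat.Base hiding (_⊔_; ∣_-_∣)
  open import Data.Nat.Properties hiding (_≟_; _<?_)
  open import Data.Product.Base using (Σ; ∃-syntax; _×_; _,_; proj₁; proj₂)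
  open import Data.Sum.Base using (_⊎_; inj₁; inj₂)
  open import Data.Unit.Base using (tt)
  open import Data.Vec.Base using (Vec; lookup; here; there)
  open import Data.Vec.Properties using ([]=⇒lookup; lookup⇒[]=)
  open import Function.Base using (_∘_)
  open import Relation.Binary.Construct.Closure.ReflexiveTransitive using (ε; _◅_; reverse)
  open import Relation.Binary.Definitions using (tri<; tri≈; tri>)
  open import Relation.Nullary using (yes; no; ¬_; does)
  open import Relation.Nullary.Decidable using (_×-dec_)
  open import Relation.Binary.PropositionalEquality hiding ([_])

  open Covers using (Adj-sym; Adj⇒≢; shortcut; path₁; path₂; path₃)
  open Verification

  open Path

  -- A path assignment takes membership proofs as arguments. The proofs found by the decision
  -- procedure in `mark` must lead to the same path as those given with a covered vertex.
  ∈-irrelevant : ∀ {n} {p : Subset n} {x} (a b : x ∈ p) → a ≡ b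
  ∈-irrelevant here      here      = refl
  ∈-irrelevant (there a) (there b) = cong there (∈-irrelevant a b)

  module Sound {n} (G : Graph n) (A S : Subset n) (K : Fin n → Fin n → Fin n → Set)
               (valid : Conditions.Valid (Adj G) (_∈ A) (_∈ S) K) where

    open Conditions (Adj G) (_∈ A) (_∈ S) K

    short-path : ∀ {u a b v} → u ≢ v → Short u a b v →
                 Σ (ShortestPath G u v) λ P → ∀ w → On u a b v w → w ∈ˡ vertices (proj₁ P)
    short-path u≢v (inj₁ (uv , refl , refl)) = path₁ G uv , λ
      { w (inj₁ refl)               → here refl
      ; w (inj₂ (inj₁ refl))        → there (here refl)
      ; w (inj₂ (inj₂ (inj₁ refl))) → here refl
      ; w (inj₂ (inj₂ (inj₂ refl))) → here refl }
    short-path u≢v (inj₂ (inj₁ (¬uv , ua , av , refl))) = path₂ G u≢v ¬uv ua av , λ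
      { w (inj₁ refl)               → here refl
      ; w (inj₂ (inj₁ refl))        → there (there (here refl))
      ; w (inj₂ (inj₂ (inj₁ refl))) → there (here refl)
      ; w (inj₂ (inj₂ (inj₂ refl))) → there (here refl) }
    short-path u≢v (inj₂ (inj₂ (¬uv , ¬m , ua , ab , bv))) =
      path₃ G u≢v ¬uv (λ m um mv → ¬m m (um , mv)) ua ab bv , λ
      { w (inj₁ refl)               → here refl
      ; w (inj₂ (inj₁ refl))        → there (there (there (here refl)))
      ; w (inj₂ (inj₂ (inj₁ refl))) → there (here refl)
      ; w (inj₂ (inj₂ (inj₂ refl))) → there (there (here refl)) }

    marked-path : ∀ u v → u Fin.< v → Σ (ShortestPath G u v) λ P → ∀ w → K u v w → w ∈ˡ vertices (proj₁ P)
    marked-path u v u<v =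
      let a , b , short , marks = proj₁ (proj₂ (proj₂ (proj₂ valid))) u v u<v
          P , on = short-path (λ { refl → <-irrefl refl u<v }) short
      in P , λ w k → on w (marks w k)

    connected-by-paths : Connected G
    connected-by-paths u v with Fin.<-cmp u v
    ... | tri< u<v _ _  = proj₁ (proj₁ (marked-path u v u<v))
    ... | tri≈ _ refl _ = proj₁ (shortcut G ε)
    ... | tri> _ _ v<u  = proj₁ (shortcut G (reverse (Adj-sym G) (walk (proj₁ (proj₁ (marked-path v u v<u))))))

    coBipartite : CoBipartite G
    coBipartite = A ,
      (λ {u} {v} u∈ v∈ u≢v → clique u v u≢v (inj₁ (u∈ , v∈))) ,
      (λ {u} {v} u∈ v∈ u≢v → clique u v u≢v (inj₂ (x∈∁p⇒x∉p u∈ , x∈∁p⇒x∉p v∈)))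
      where clique = proj₁ (proj₂ (proj₂ valid))

    strongGeodetic : IsStrongGeodetic G S
    strongGeodetic = (λ {u} {v} _ _ u<v → proj₁ (marked-path u v u<v)) , λ w w∉ →
      let u , v , u<v , u∈ , v∈ , k = proj₂ (proj₂ (proj₂ (proj₂ valid))) w w∉
      in u , v , u∈ , v∈ , u<v , proj₂ (marked-path u v u<v) w k

  module Complete {n} (G : Graph n) (connected : Connected G) (A : Subset n)
                  (A-clique : IsClique G A) (∁A-clique : IsClique G (∁ A))
                  (S : Subset n) (I : PathAssignment G S) (covers : ∀ w → w ∉ S → LiesOn G {S} w I) where

    open import Data.List.Membership.DecPropositional (_≟_ {n}) using () renaming (_∈?_ to _∈ˡ?_)

    mark : Fin n → Fin n → Fin n → Bool
    mark u v w with u ∈? S | v ∈? S | u <? v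
    ... | yes u∈ | yes v∈ | yes u<v = does (w ∈ˡ? vertices (proj₁ (I u∈ v∈ u<v)))
    ... | _      | _      | _       = false

    mark⁺ : ∀ {u v w} (u∈ : u ∈ S) (v∈ : v ∈ S) (u<v : u Fin.< v) → w ∈ˡ vertices (proj₁ (I u∈ v∈ u<v)) → T (mark u v w)
    mark⁺ {u} {v} {w} u∈ v∈ u<v w∈ with u ∈? S | v ∈? S | u <? v
    ... | no u∉   | _       | _       = ⊥-elim (u∉ u∈)
    ... | yes _   | no v∉   | _       = ⊥-elim (v∉ v∈)
    ... | yes _   | yes _   | no u≮v  = ⊥-elim (u≮v u<v)
    ... | yes u∈′ | yes v∈′ | yes u<v′
      with refl ← ∈-irrelevant u∈ u∈′ | refl ← ∈-irrelevant v∈ v∈′ | refl ← <-irrelevant u<v u<v′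
      with w ∈ˡ? vertices (proj₁ (I u∈ v∈ u<v))
    ...   | yes _ = tt
    ...   | no w∉ = ⊥-elim (w∉ w∈)

    -- A pair without an assigned path has no marks, so that afterwards any shortest path between
    -- its members will do.
    mark⁻ : ∀ u v → (Σ (ShortestPath G u v) λ P → ∀ w → T (mark u v w) → w ∈ˡ vertices (proj₁ P)) ⊎ (∀ w → ¬ T (mark u v w))
    mark⁻ u v with u ∈? S | v ∈? S | u <? v
    ... | yes u∈ | yes v∈ | yes u<v = inj₁ (I u∈ v∈ u<v , λ w t → on w t)
      where
      on : ∀ w → T (does (w ∈ˡ? vertices (proj₁ (I u∈ v∈ u<v)))) → w ∈ˡ vertices (proj₁ (I u∈ v∈ u<v))
      on w t with w ∈ˡ? vertices (proj₁ (I u∈ v∈ u<v))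
      ... | yes w∈ = w∈
    ... | yes _ | yes _ | no _  = inj₂ λ _ ()
    ... | yes _ | no _  | _     = inj₂ λ _ ()
    ... | no _  | _     | _     = inj₂ λ _ ()

    open Conditions (Adj G) (_∈ A) (_∈ S) (λ u v w → T (mark u v w))

    side : Fin n → Bool
    side = lookup A

    same-side : ∀ {u v} → side u ≡ side v → u ≢ v → Adj G u v
    same-side {u} {v} e u≢v with side u in eq
    ... | true  = A-clique (lookup⇒[]= u A eq) (lookup⇒[]= v A (sym e)) u≢v
    ... | false = ∁A-clique (x∉p⇒x∈∁p (outside eq)) (x∉p⇒x∈∁p (outside (sym e))) u≢v
      where
      outside : ∀ {x} → side x ≡ false → x ∉ A
      outside e x∈ with () ← trans (sym e) ([]=⇒lookup x∈)

    -- The first edge of the walk that leaves the side of `u`. There are only two sides, so its far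
    -- end is on the side of `v`.
    crossing : ∀ {u v} → Walk G u v → side u ≢ side v →
               ∃[ a ] ∃[ b ] Adj G a b × side u ≡ side a × side b ≡ side v
    crossing ε h = ⊥-elim (h refl)
    crossing {u} {v} (_◅_ {j = x} a w) h with side u Bool.≟ side x
    ... | no h′ = u , x , a , refl , other h h′
      where
      other : ∀ {p q r : Bool} → p ≢ q → p ≢ r → r ≡ q
      other {false} {false} h _  = ⊥-elim (h refl)
      other {true}  {true}  h _  = ⊥-elim (h refl)
      other {false} {true}  {true}  _ _  = refl
      other {true}  {false} {false} _ _  = refl
      other {false} {true}  {false} _ h = ⊥-elim (h refl)
      other {true}  {false} {true}  _ h = ⊥-elim (h refl)
    ... | yes e with crossing w (h ∘ trans e)
    ...   | p , q , pq , e₁ , e₂ = p , q , pq , trans e e₁ , e₂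

    -- Two cliques joined by an edge have diameter at most 3.
    classify : ∀ u v → u ≢ v → ∃[ a ] ∃[ b ] Short u a b v
    classify u v u≢v with T? (adjacent G u v)
    ... | yes uv = u , u , inj₁ (uv , refl , refl)
    ... | no ¬uv with any? (λ m → T? (adjacent G u m) ×-dec T? (adjacent G m v))
    ...   | yes (m , um , mv) = m , m , inj₂ (inj₁ (¬uv , um , mv , refl))
    ...   | no ¬m with crossing (walk (connected u v)) (λ e → ¬uv (same-side e u≢v))
    ...     | a , b , ab , e₁ , e₂ = a , b , inj₂ (inj₂ (¬uv , (λ m p → ¬m (m , p)) , ua , ab , bv))
      where
      -- If `u` were the end `a` of the crossing edge, then `u` and `v` would be adjacent or would
      -- have the common neighbour `b`.
      ua : Adj G u a
      ua with u ≟ a | b ≟ v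
      ... | no u≢a   | _        = same-side e₁ u≢a
      ... | yes refl | yes refl = ⊥-elim (¬uv ab)
      ... | yes refl | no b≢v   = ⊥-elim (¬m (b , ab , same-side e₂ b≢v))
      bv : Adj G b v
      bv with b ≟ v
      ... | no b≢v   = same-side e₂ b≢v
      ... | yes refl = ⊥-elim (¬m (a , ua , ab))

    short-length : ∀ {u a b v} → Short u a b v → Σ (Path G u v) λ P → edgeCount P ≤ 3
    short-length (inj₁ (uv , _)) =
      let P , P≤ = shortcut G (uv ◅ ε) in P , ≤-trans P≤ (s≤s z≤n)
    short-length (inj₂ (inj₁ (_ , ua , av , _))) =
      let P , P≤ = shortcut G (ua ◅ av ◅ ε) in P , ≤-trans P≤ (s≤s (s≤s z≤n))
    short-length (inj₂ (inj₂ (_ , _ , ua , ab , bv))) =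
      shortcut G (ua ◅ ab ◅ bv ◅ ε)

    shortest-≤ : ∀ {u v} (P : ShortestPath G u v) (w : Walk G u v) → edgeCount (proj₁ P) ≤ walkLength G w
    shortest-≤ (P , shortest) w = let Q , Q≤ = shortcut G w in ≤-trans (shortest Q) Q≤

    -- With at most three edges the interior vertices are read off the path, and minimality gives
    -- the negative parts of `Short`. A longer path is not shortest, since `classify` provides a
    -- path of length at most 3.
    shorten : ∀ {u v} → u ≢ v → (P : ShortestPath G u v) →
              ∃[ a ] ∃[ b ] Short u a b v × (∀ w → w ∈ˡ vertices (proj₁ P) → On u a b v w)
    shorten {u} {v} u≢v P = go (walk (proj₁ P)) (shortest-≤ P)
      where
      go : (W : Walk G u v) → (∀ w → walkLength G W ≤ walkLength G w) →
           ∃[ a ] ∃[ b ] Short u a b v × (∀ w → w ∈ˡ walkVertices G W → On u a b v w)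
      go ε _ = ⊥-elim (u≢v refl)
      go (uv ◅ ε) _ = u , u , inj₁ (uv , refl , refl) , λ
        { w (here e) → inj₁ e ; w (there (here e)) → inj₂ (inj₁ e) }
      go (_◅_ {j = a} ua (av ◅ ε)) s = a , a , inj₂ (inj₁ ((λ uv → 2≰1 (s (uv ◅ ε))) , ua , av , refl)) , λ
        { w (here e) → inj₁ e ; w (there (here e)) → inj₂ (inj₂ (inj₁ e)) ; w (there (there (here e))) → inj₂ (inj₁ e) }
        where
        2≰1 : ¬ 2 ≤ 1
        2≰1 (s≤s ())
      go (_◅_ {j = a} ua (_◅_ {j = b} ab (bv ◅ ε))) s =
        a , b , inj₂ (inj₂ ((λ uv → 3≰1 (s (uv ◅ ε))) , (λ m (um , mv) → 3≰2 (s (um ◅ mv ◅ ε))) , ua , ab , bv)) , λ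
        { w (here e) → inj₁ e ; w (there (here e)) → inj₂ (inj₂ (inj₁ e))
        ; w (there (there (here e))) → inj₂ (inj₂ (inj₂ e)) ; w (there (there (there (here e)))) → inj₂ (inj₁ e) }
        where
        3≰1 : ¬ 3 ≤ 1
        3≰1 (s≤s ())
        3≰2 : ¬ 3 ≤ 2
        3≰2 (s≤s (s≤s ()))
      go (_ ◅ _ ◅ _ ◅ _ ◅ _) s =
        let a , b , short = classify u v u≢v
            Q , Q≤3 = short-length short
        in ⊥-elim (4≰3 (≤-trans (s (walk Q)) Q≤3))
        where
        4≰3 : ∀ {k} → ¬ suc (suc (suc (suc k))) ≤ 3
        4≰3 (s≤s (s≤s (s≤s ())))

    valid : Valid
    valid = (λ u v → Adj-sym G) , (λ u uu → Adj⇒≢ G uu refl) , cliques , paths , covered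
      where
      cliques : ∀ u v → ¬ u ≡ v → (u ∈ A × v ∈ A ⊎ ¬ u ∈ A × ¬ v ∈ A) → Adj G u v
      cliques u v u≢v (inj₁ (u∈ , v∈)) = A-clique u∈ v∈ u≢v
      cliques u v u≢v (inj₂ (u∉ , v∉)) = ∁A-clique (x∉p⇒x∈∁p u∉) (x∉p⇒x∈∁p v∉) u≢v
      paths : ∀ u v → u Fin.< v → ∃[ a ] ∃[ b ] Short u a b v × (∀ w → T (mark u v w) → On u a b v w)
      paths u v u<v = marked (mark⁻ u v)
        where
        u≢v : u ≢ v
        u≢v refl = <-irrefl refl u<v
        marked : (Σ (ShortestPath G u v) λ P → ∀ w → T (mark u v w) → w ∈ˡ vertices (proj₁ P)) ⊎ (∀ w → ¬ T (mark u v w)) →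
                 ∃[ a ] ∃[ b ] Short u a b v × (∀ w → T (mark u v w) → On u a b v w)
        marked (inj₁ (P , on)) = let a , b , short , rest = shorten u≢v P in a , b , short , λ w t → rest w (on w t)
        marked (inj₂ none)     = let a , b , short = classify u v u≢v in a , b , short , λ w t → ⊥-elim (none w t)
      covered : ∀ w → ¬ w ∈ S → ∃[ u ] ∃[ v ] u Fin.< v × u ∈ S × v ∈ S × T (mark u v w)
      covered w w∉ = let u , v , u∈ , v∈ , u<v , w∈ = covers w w∉ in u , v , u<v , u∈ , v∈ , mark⁺ u∈ v∈ u<v w∈

-- Decoding of instances and membership in NP

module Membership where

  open import Data.Bool.Base using (Bool; true; false; T)
  open import Data.Bool.Properties using (T-≡; T-∧)
  open import Data.Empty using (⊥; ⊥-elim)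
  open import Data.Fin.Base using (Fin; zero; suc; toℕ; combine; remQuot)
  open import Data.Fin.Properties using (toℕ-combine; remQuot-combine)
  open import Data.Fin.Subset using (Subset; _∈_; ∣_∣)
  open import Data.List.Base using (List; []; _∷_; [_]; _++_; concat; tabulate; replicate; length; drop)
  open import Data.List.Properties using (++-assoc; length-++; length-replicate; length-tabulate; ∷-injective)
  open import Data.Nat.Base hiding (_⊔_; ∣_-_∣)
  open import Data.Nat.Binary.Base using (ℕᵇ; zero; 2[1+_]; 1+[2_]; fromℕ) renaming (toℕ to toℕᵇ)
  open import Data.Nat.Binary.Properties using () renaming (toℕ-fromℕ to toℕᵇ-fromℕ; fromℕ-toℕ to fromℕ-toℕᵇ)
  open import Data.Nat.Properties
  open import Data.Nat.Tactic.RingSolver using (solve-∀)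
  open import Data.Product.Base using (Σ; ∃-syntax; _×_; _,_; proj₁; proj₂)
  open import Data.Unit.Base using (tt)
  open import Data.Vec.Base as Vec using (Vec; []; _∷_; lookup)
  open import Data.Vec.Properties using (lookup∘tabulate; []=⇒lookup; lookup⇒[]=)
  open import Function.Base using (_∘_)
  open import Function.Bundles using (mk⇔; Equivalence)
  open import Relation.Nullary using (yes; no; ¬_)
  open import Relation.Nullary.Reflects
  open import Relation.Binary.PropositionalEquality hiding ([_])

  open Bounds
  open Terms
  open Formulas
  open Hardness using (StrongGeodeticCoBipartite)
  open Verification
  open Certificates

  bitAt-past : ∀ x {k} → length x ≤ k → bitAt x k ≡ 0
  bitAt-past []      _         = refl
  bitAt-past (_ ∷ x) (s≤s l≤k) = bitAt-past x l≤k

  bitAt-++ : ∀ x y k → bitAt (x ++ y) (length x + k) ≡ bitAt y k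
  bitAt-++ []      y k = refl
  bitAt-++ (_ ∷ x) y k = bitAt-++ x y k

  bitAt-tabulate : ∀ {n} (f : Fin n → Bool) y i → bitAt (tabulate f ++ y) (toℕ i) ≡ code (f i)
  bitAt-tabulate f y zero    = refl
  bitAt-tabulate f y (suc i) = bitAt-tabulate (f ∘ suc) y i

  matrixBits : ∀ {m n} → (Fin m → Fin n → Bool) → BitString
  matrixBits f = concat (tabulate λ u → tabulate (f u))

  length-matrixBits : ∀ {m n} (f : Fin m → Fin n → Bool) → length (matrixBits f) ≡ m * n
  length-matrixBits {zero}      f = refl
  length-matrixBits {suc m} {n} f = trans (length-++ (tabulate (f zero)))
    (cong₂ _+_ (length-tabulate (f zero)) (length-matrixBits (f ∘ suc)))

  bitAt-matrixBits : ∀ {m n} (f : Fin m → Fin n → Bool) y u v → bitAt (matrixBits f ++ y) (toℕ u * n + toℕ v) ≡ code (f u v)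
  bitAt-matrixBits f y zero v = trans (cong (λ z → bitAt z (toℕ v)) (++-assoc (tabulate (f zero)) _ y)) (bitAt-tabulate (f zero) _ v)
  bitAt-matrixBits {suc m} {n} f y (suc u) v = trans
    (cong₂ bitAt (++-assoc (tabulate (f zero)) _ y)
      (trans (+-assoc n (toℕ u * n) (toℕ v)) (cong (_+ (toℕ u * n + toℕ v)) (sym (length-tabulate (f zero))))))
    (trans (bitAt-++ (tabulate (f zero)) _ (toℕ u * n + toℕ v)) (bitAt-matrixBits (f ∘ suc) y u v))

  code-bit : ∀ b → (code b ≡ᵇ 2) ≡ b
  code-bit false = refl
  code-bit true  = refl

  bit-reflects : ∀ {k b} → k ≡ code b → Reflects (T b) (k ≡ᵇ 2)
  bit-reflects {b = b} refl = reflects-≡ (code-bit b) (T-reflects b)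

  member-reflects : ∀ {n b} {p : Subset n} {x} → b ≡ lookup p x → Reflects (x ∈ p) b
  member-reflects {p = p} {x} refl = reflects-map
    (λ t → lookup⇒[]= x p (Equivalence.to T-≡ t)) (λ x∈ → Equivalence.from T-≡ ([]=⇒lookup x∈)) (T-reflects (lookup p x))

  instanceBits : ∀ {n} → (Fin n → Fin n → Bool) → BitString → BitString
  instanceBits {n} g ds = replicate n true ++ false ∷ matrixBits g ++ ds

  bitAt-ones : ∀ n w k → bitAt (replicate n true ++ false ∷ w) (n + 1 + k) ≡ bitAt w k
  bitAt-ones zero    w k = refl
  bitAt-ones (suc n) w k = bitAt-ones n w k

  bitAt-edge : ∀ {n} (g : Fin n → Fin n → Bool) ds u v →
               bitAt (instanceBits g ds) (n + 1 + (toℕ u * n + toℕ v)) ≡ code (g u v)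
  bitAt-edge {n} g ds u v = trans (bitAt-ones n (matrixBits g ++ ds) (toℕ u * n + toℕ v)) (bitAt-matrixBits g ds u v)

  digitStart : ℕ → ℕ
  digitStart n = n + 1 + n * n

  bitAt-digit : ∀ {n} (g : Fin n → Fin n → Bool) ds k → bitAt (instanceBits g ds) (digitStart n + k) ≡ bitAt ds k
  bitAt-digit {n} g ds k = trans
    (cong (bitAt (instanceBits g ds)) (+-assoc (n + 1) (n * n) k))
    (trans (bitAt-ones n (matrixBits g ++ ds) (n * n + k))
      (trans (cong (λ l → bitAt (matrixBits g ++ ds) (l + k)) (sym (length-matrixBits g))) (bitAt-++ (matrixBits g) ds k)))

  length-instanceBits : ∀ {n} (g : Fin n → Fin n → Bool) ds → length (instanceBits g ds) ≡ digitStart n + length ds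
  length-instanceBits {n} g ds = trans (length-++ (replicate n true)) (trans (cong₂ (λ a b → a + suc b) (length-replicate n)
    (trans (length-++ (matrixBits g)) (cong (_+ length ds) (length-matrixBits g)))) (lemma n (n * n) (length ds)))
    where
    lemma : ∀ a b c → a + suc (b + c) ≡ a + 1 + b + c
    lemma = solve-∀

  -- The last condition asks for a bit after the n² bits of the matrix. It ensures that the matrix
  -- is complete and that the bound has a digit, so it is positive.
  Header : BitString → ℕ → Set
  Header w n = 0 < n × (∀ (i : Fin n) → bitAt w (toℕ i) ≡ 2) × bitAt w n ≡ 1 × ¬ bitAt w (digitStart n) ≡ 0

  header-φ : Fm 2 1
  header-φ = (lit 0 ≺ v# 0) ∧ᶠ all (v# 0) (bit zero (v# 0) ≐ lit 2) ∧ᶠ (bit zero (v# 0) ≐ lit 1) ∧ᶠ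
             (¬ᶠ (bit zero (v# 0 ⊕ lit 1 ⊕ (v# 0 *ᵗ v# 0)) ≐ lit 0))

  header-reflects : ∀ w y n → Reflects (Header w n) (⟦ header-φ ⟧ᶠ (w ∷ y ∷ []) (n ∷ []))
  header-reflects w y n = <ᵇ-reflects refl refl ×-reflects (all-reflects (λ i → ≡ᵇ-reflects refl refl) ×-reflects
    (≡ᵇ-reflects refl refl ×-reflects ¬-reflects
      (≡ᵇ-reflects (cong (λ k → bitAt w (n + 1 + k)) (*ᵗ-value {xs = w ∷ y ∷ []} {ρ = n ∷ []} (v# 0) (v# 0))) refl)))

  header⁺ : ∀ {n} (g : Fin n → Fin n → Bool) ds → 0 < n → 0 < length ds → Header (instanceBits g ds) n
  header⁺ {n} g ds 0<n 0<ds = 0<n , ones n , stop n , λ e → nonzero ds 0<ds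
    (trans (sym (bitAt-digit g ds 0)) (trans (cong (bitAt (instanceBits g ds)) (+-identityʳ (digitStart n))) e))
    where
    ones : ∀ n {w} (i : Fin n) → bitAt (replicate n true ++ w) (toℕ i) ≡ 2
    ones (suc n) zero    = refl
    ones (suc n) (suc i) = ones n i
    stop : ∀ n {w} → bitAt (replicate n true ++ false ∷ w) n ≡ 1
    stop zero    = refl
    stop (suc n) = stop n
    nonzero : ∀ ds → 0 < length ds → bitAt ds 0 ≡ 0 → ⊥
    nonzero (false ∷ _) _ ()
    nonzero (true ∷ _)  _ ()

  header⁻ : ∀ {w n} → Header w n →
            Σ (Fin n → Fin n → Bool) λ g → ∃[ ds ] w ≡ instanceBits g ds × 0 < n × 0 < length ds
  header⁻ {w} {n} (0<n , ones , stop , more) with split-ones n w ones stop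
    where
    split-ones : ∀ n w → (∀ (i : Fin n) → bitAt w (toℕ i) ≡ 2) → bitAt w n ≡ 1 → ∃[ w′ ] w ≡ replicate n true ++ false ∷ w′
    split-ones zero    (false ∷ w) ones stop = w , refl
    split-ones (suc n) []          ones stop with () ← stop
    split-ones (suc n) (false ∷ w) ones stop with () ← ones zero
    split-ones (suc n) (true ∷ w)  ones stop = let w′ , e = split-ones n w (ones ∘ suc) stop in w′ , cong (true ∷_) e
  ... | w′ , refl = let g , ds , e = split-matrix n w′ (<⇒≤ long)
                    in g , ds , cong (λ z → replicate n true ++ false ∷ z) e , 0<n ,
                       +-cancelˡ-< (n * n) 0 (length ds) (≤-trans (≤-reflexive (cong suc (+-identityʳ (n * n))))
                         (≤-trans long (≤-reflexive (trans (cong length e) (trans (length-++ (matrixBits g)) (cong (_+ length ds) (length-matrixBits g)))))))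
    where
    long : n * n < length w′
    long with n * n <? length w′
    ... | yes n²<l = n²<l
    ... | no  n²≮l = ⊥-elim (more (trans (bitAt-ones n w′ (n * n)) (bitAt-past w′ (≮⇒≥ n²≮l))))
    split-row : ∀ n l → n ≤ length l → Σ (Fin n → Bool) λ f → ∃[ l′ ] l ≡ tabulate f ++ l′
    split-row zero    l       _         = (λ ()) , l , refl
    split-row (suc n) (b ∷ l) (s≤s n≤l) =
      let f , l′ , e = split-row n l n≤l in (λ { zero → b ; (suc i) → f i }) , l′ , cong (b ∷_) e
    split-matrix : ∀ {k} m l → m * k ≤ length l → Σ (Fin m → Fin k → Bool) λ f → ∃[ l′ ] l ≡ matrixBits f ++ l′
    split-matrix     zero    l _ = (λ ()) , l , refl
    split-matrix {k} (suc m) l m≤l with split-row k l (≤-trans (m≤m+n k _) m≤l)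
    ... | f , l′ , refl =
      let g , l″ , e = split-matrix m l′ (+-cancelˡ-≤ k _ _ (≤-trans m≤l (≤-reflexive
                         (trans (length-++ (tabulate f)) (cong (_+ length l′) (length-tabulate f))))))
      in (λ { zero → f ; (suc u) → g u }) , l″ , trans (cong (tabulate f ++_) e) (sym (++-assoc (tabulate f) _ l″))

  value-of : BitString → ℕ
  value-of []       = 0
  value-of (b ∷ bs) = value-of bs + value-of bs + code b

  value-of-binaryDigits : ∀ b → value-of (binaryDigits b) ≡ toℕᵇ b
  value-of-binaryDigits zero     = refl
  value-of-binaryDigits 2[1+ b ] rewrite value-of-binaryDigits b = lemma (toℕᵇ b)
    where
    lemma : ∀ m → m + m + 2 ≡ 2 * suc m
    lemma = solve-∀
  value-of-binaryDigits 1+[2 b ] rewrite value-of-binaryDigits b = lemma (toℕᵇ b)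
    where
    lemma : ∀ m → m + m + 1 ≡ suc (2 * m)
    lemma = solve-∀

  undigits : BitString → ℕᵇ
  undigits []           = zero
  undigits (true ∷ bs)  = 2[1+ undigits bs ]
  undigits (false ∷ bs) = 1+[2 undigits bs ]

  binaryDigits-undigits : ∀ bs → binaryDigits (undigits bs) ≡ bs
  binaryDigits-undigits []           = refl
  binaryDigits-undigits (true ∷ bs)  = cong (true ∷_) (binaryDigits-undigits bs)
  binaryDigits-undigits (false ∷ bs) = cong (false ∷_) (binaryDigits-undigits bs)

  -- In bijective base 2 every string is the numeral of exactly one number, so the verifier has
  -- nothing to check about the digits.
  digits-value-of : ∀ ds → digits-of (value-of ds) ≡ ds
  digits-value-of ds = trans (cong (digits-of ∘ value-of) (sym (binaryDigits-undigits ds)))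
    (trans (cong digits-of (value-of-binaryDigits (undigits ds)))
      (trans (cong binaryDigits (fromℕ-toℕᵇ (undigits ds))) (binaryDigits-undigits ds)))

  value-of-digits : ∀ k → value-of (digits-of k) ≡ k
  value-of-digits k = trans (value-of-binaryDigits (fromℕ k)) (toℕᵇ-fromℕ k)

  -- Subtracting the number from s by Horner's rule: s ∸ a is turned into
  -- s ∸ (2a + c), with a recovered as s ∸ (s ∸ a).
  horner-step : ∀ s a c → (s ∸ a) ∸ ((s ∸ (s ∸ a)) + c) ≡ s ∸ (a + a + c)
  horner-step s a c with a ≤? s
  ... | yes a≤s = trans (cong (λ z → (s ∸ a) ∸ (z + c)) (m∸[m∸n]≡n a≤s))
                    (trans (∸-+-assoc s a (a + c)) (cong (s ∸_) (sym (+-assoc a a c))))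
  ... | no  a≰s rewrite m≤n⇒m∸n≡0 (≰⇒≥ a≰s) = trans (0∸n≡0 (s + c))
                    (sym (m≤n⇒m∸n≡0 (≤-trans (≰⇒≥ a≰s) (≤-trans (m≤m+n a a) (m≤m+n (a + a) c)))))

  -- The number may be exponential in the length of `ds` and must not appear in unary. What is kept
  -- is s minus the number formed by the digits from position k on, which never exceeds s; the
  -- digits are taken from the most significant one.
  horner : ∀ s ds k → k ≤ length ds →
           decTo k (λ i r → (s ∸ r) + bitAt ds i) (s ∸ value-of (drop k ds)) ≡ s ∸ value-of ds
  horner s ds zero    _   = refl
  horner s ds (suc k) k<l = trans
    (cong (decTo k _) (trans (horner-step s (value-of (drop (suc k) ds)) (bitAt ds k)) (cong (s ∸_) (sym (value-drop ds k k<l)))))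
    (horner s ds k (<⇒≤ k<l))
    where
    value-drop : ∀ ds k → k < length ds →
      value-of (drop k ds) ≡ value-of (drop (suc k) ds) + value-of (drop (suc k) ds) + bitAt ds k
    value-drop (b ∷ ds) zero    _         = refl
    value-drop (b ∷ ds) (suc k) (s≤s k<l) = value-drop ds k k<l

  countᵗ : ∀ {k} → Tm 2 k → Tm 2 k
  countᵗ n = sum n (truth (chosen-φ (wk n) (var zero)))

  small-φ : Fm 2 1
  small-φ = dec (len zero ⊖ start) (countᵗ (v# 0))
                ((wk (wk (countᵗ (v# 0))) ⊖ v# 1) ⊕ bit zero (wk (wk start) ⊕ v# 0)) ≐ lit 0
    where
    start : Tm 2 1
    start = v# 0 ⊕ lit 1 ⊕ (v# 0 *ᵗ v# 0)

  decTo-cong : ∀ n {f g : ℕ → ℕ → ℕ} a → (∀ k r → f k r ≡ g k r) → decTo n f a ≡ decTo n g a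
  decTo-cong zero    a e = refl
  decTo-cong (suc n) {f} {g} a e = trans (cong (λ z → decTo n f (a ∸ z)) (e n a)) (decTo-cong n (a ∸ g n a) e)

  count-value : ∀ {n} (S : Subset n) f → (∀ i → f (toℕ i) ≡ indicator (lookup S i)) → sumTo n f ≡ ∣ S ∣
  count-value []          f e = refl
  count-value {suc n} (b ∷ S) f e = trans (sumTo-suc n f) (trans (cong₂ _+_ (e zero) (count-value S (f ∘ suc) (e ∘ suc))) (step b))
    where
    step : ∀ b → indicator b + ∣ S ∣ ≡ ∣ b ∷ S ∣
    step false = refl
    step true  = refl

  small-reflects : ∀ {n} (g : Fin n → Fin n → Bool) ds y (S : Subset n) →
    (∀ i → (bitAt y (n + toℕ i) ≡ᵇ 2) ≡ lookup S i) →
    Reflects (∣ S ∣ ≤ value-of ds) (⟦ small-φ ⟧ᶠ (instanceBits g ds ∷ y ∷ []) (n ∷ []))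
  small-reflects {n} g ds y S chosen = reflects-map m∸n≡0⇒m≤n m≤n⇒m∸n≡0 (≡ᵇ-reflects remaining refl)
    where
    w = instanceBits g ds
    xs : Vec BitString 2
    xs = w ∷ y ∷ []
    start : Tm 2 1
    start = v# 0 ⊕ lit 1 ⊕ (v# 0 *ᵗ v# 0)
    count≡ : ⟦ countᵗ (v# 0) ⟧ xs (n ∷ []) ≡ ∣ S ∣
    count≡ = trans (sumTo-cong n λ k → truth-value (chosen-φ (wk (v# 0)) (v# 0)) xs (k ∷ n ∷ []))
      (count-value S _ λ i → cong indicator (chosen i))
    start≡ : ⟦ start ⟧ xs (n ∷ []) ≡ digitStart n
    start≡ = cong (n + 1 +_) (*ᵗ-value {xs = xs} {ρ = n ∷ []} (v# 0) (v# 0))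
    digits≡ : length w ∸ ⟦ start ⟧ xs (n ∷ []) ≡ length ds
    digits≡ = trans (cong₂ _∸_ (length-instanceBits g ds) start≡) (m+n∸m≡n (digitStart n) (length ds))
    all-dropped : ∀ ds → drop (length ds) ds ≡ []
    all-dropped []       = refl
    all-dropped (_ ∷ ds) = all-dropped ds
    remaining : decTo (length w ∸ ⟦ start ⟧ xs (n ∷ []))
              (λ k r → (⟦ countᵗ (v# 0) ⟧ xs (n ∷ []) ∸ r) + bitAt w (⟦ start ⟧ xs (n ∷ []) + k))
              (⟦ countᵗ (v# 0) ⟧ xs (n ∷ [])) ≡ ∣ S ∣ ∸ value-of ds
    remaining = trans (decTo-cong (length w ∸ ⟦ start ⟧ xs (n ∷ [])) _ λ k r → cong₂ (λ c z → (c ∸ r) + z) count≡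
                    (trans (cong (λ z → bitAt w (z + k)) start≡) (bitAt-digit g ds k)))
      (trans (cong₂ (λ l c → decTo l (λ k r → (∣ S ∣ ∸ r) + bitAt ds k) c) digits≡
               (trans count≡ (sym (cong (λ z → ∣ S ∣ ∸ value-of z) (all-dropped ds)))))
             (horner ∣ S ∣ ds (length ds) ≤-refl))

  instance-φ : Fm 2 1
  instance-φ = header-φ ∧ᶠ valid-φ ∧ᶠ small-φ

  -- The order of the graph is not decoded but searched for among the numbers below the input
  -- length; the header condition recognises it.
  verifier : Out 2 0
  verifier = emit (any (len zero) instance-φ)

  module _ (w y : BitString) where

    private
      xs : Vec BitString 2
      xs = w ∷ y ∷ []

    accept⁺ : ∀ {n} → n < length w → T (⟦ header-φ ⟧ᶠ xs (n ∷ [])) → T (⟦ valid-φ ⟧ᶠ xs (n ∷ [])) → T (⟦ small-φ ⟧ᶠ xs (n ∷ [])) →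
              T (anyTo (length w) λ n → ⟦ instance-φ ⟧ᶠ xs (n ∷ []))
    accept⁺ n<l h v s = ⇒T (anyTo-reflects (length w) λ n _ → T-reflects (⟦ instance-φ ⟧ᶠ xs (n ∷ [])))
      (_ , n<l , Equivalence.from T-∧ (h , Equivalence.from T-∧ (v , s)))

    accept⁻ : T (anyTo (length w) λ n → ⟦ instance-φ ⟧ᶠ xs (n ∷ [])) →
              ∃[ n ] T (⟦ header-φ ⟧ᶠ xs (n ∷ [])) × T (⟦ valid-φ ⟧ᶠ xs (n ∷ [])) × T (⟦ small-φ ⟧ᶠ xs (n ∷ []))
    accept⁻ t =
      let n , _ , t′ = T⇒ (anyTo-reflects (length w) λ n _ → T-reflects (⟦ instance-φ ⟧ᶠ xs (n ∷ []))) t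
          h , vs = Equivalence.to T-∧ t′
          v , s = Equivalence.to T-∧ vs
      in n , h , v , s

  T-⇔⇒≡ : ∀ {a b} → (T a → T b) → (T b → T a) → a ≡ b
  T-⇔⇒≡ {false} {false} f g = refl
  T-⇔⇒≡ {true}  {true}  f g = refl
  T-⇔⇒≡ {false} {true}  f g = ⊥-elim (g tt)
  T-⇔⇒≡ {true}  {false} f g = ⊥-elim (f tt)

  ¬T⇒≡ : ∀ {a} → ¬ T a → a ≡ false
  ¬T⇒≡ {false} _ = refl
  ¬T⇒≡ {true}  h = ⊥-elim (h tt)

  -- The word is arbitrary at first. That it encodes a connected co-bipartite graph at all, with a
  -- symmetric and irreflexive matrix, is extracted from the checked conditions.
  certified⇒yes : ∀ w y n → T (⟦ header-φ ⟧ᶠ (w ∷ y ∷ []) (n ∷ [])) → T (⟦ valid-φ ⟧ᶠ (w ∷ y ∷ []) (n ∷ [])) →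
                  T (⟦ small-φ ⟧ᶠ (w ∷ y ∷ []) (n ∷ [])) → languageOf StrongGeodeticCoBipartite w
  certified⇒yes w y n h v s = build (header⁻ (T⇒ (header-reflects w y n) h)) v s
    where
    build : (Σ (Fin n → Fin n → Bool) λ g → ∃[ ds ] w ≡ instanceBits g ds × 0 < n × 0 < length ds) →
            T (⟦ valid-φ ⟧ᶠ (w ∷ y ∷ []) (n ∷ [])) → T (⟦ small-φ ⟧ᶠ (w ∷ y ∷ []) (n ∷ [])) → languageOf StrongGeodeticCoBipartite w
    build (g , ds , refl , 0<n , 0<ds) v s = (inst , coBipartite) , (S , strongGeodetic , few) , encoded
      where
      A S : Subset n
      A = Vec.tabulate λ u → bitAt y (toℕ u) ≡ᵇ 2
      S = Vec.tabulate λ u → bitAt y (n + toℕ u) ≡ᵇ 2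
      K : Fin n → Fin n → Fin n → Set
      K u v x = T (bitAt y (n + n + ((toℕ u * n + toℕ v) * n + toℕ x)) ≡ᵇ 2)
      S-bit : ∀ u → (bitAt y (n + toℕ u) ≡ᵇ 2) ≡ lookup S u
      S-bit u = sym (lookup∘tabulate _ u)
      valid : Conditions.Valid (λ u v → T (g u v)) (_∈ A) (_∈ S) K
      valid = T⇒ (valid-reflects {instanceBits g ds} {y} (λ u v → bit-reflects (bitAt-edge g ds u v))
        (λ u → member-reflects (sym (lookup∘tabulate _ u))) (λ u → member-reflects (S-bit u)) (λ u v x → T-reflects _)) v
      G : Graph n
      G = record
        { adjacent    = g
        ; symmetric   = λ u v → T-⇔⇒≡ (proj₁ valid u v) (proj₁ valid v u)
        ; irreflexive = λ u → ¬T⇒≡ (proj₁ (proj₂ valid) u) }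
      open Sound G A S K valid
      inst : StrongGeodeticInstance
      inst = record
        { order = n ; graph = G ; bound = value-of ds ; nonempty = >-nonZero 0<n ; connected = connected-by-paths
        ; positive = >-nonZero (value-positive ds 0<ds) }
        where
        value-positive : ∀ ds → 0 < length ds → 0 < value-of ds
        value-positive (false ∷ ds) _ = ≤-trans (s≤s z≤n) (m≤n+m 1 (value-of ds + value-of ds))
        value-positive (true ∷ ds)  _ = ≤-trans (s≤s z≤n) (m≤n+m 2 (value-of ds + value-of ds))
      few : ∣ S ∣ ≤ value-of ds
      few = T⇒ (small-reflects g ds y S S-bit) s
      encoded : instanceBits g ds ≡ encodeGraphNumber G (value-of ds)
      encoded = cong (λ z → replicate n true ++ false ∷ matrixBits g ++ z) (sym (digits-value-of ds))

  -- The certificate consists of A and S, n bits each, and n bits for every pair.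
  certificateBound : Polynomial
  certificateBound = 0 ∷ 2 ∷ 0 ∷ 1 ∷ []

  module Certificate (i : StrongGeodeticInstance) (cobipartite : CoBipartite (graph i))
                     (S : Subset (order i)) (geodetic : IsStrongGeodetic (graph i) S) (few : ∣ S ∣ ≤ bound i) where

    A : Subset (order i)
    A = proj₁ cobipartite

    open Complete (graph i) (connected i) A (proj₁ (proj₂ cobipartite)) (proj₂ (proj₂ cobipartite))
                  S (proj₁ geodetic) (proj₂ geodetic)

    n : ℕ
    n = order i

    g : Fin n → Fin n → Bool
    g = adjacent (graph i)

    ds w : BitString
    ds = digits-of (bound i)
    w = instanceBits g ds

    marks : Fin (n * n) → Fin n → Bool
    marks uv = let u , v = remQuot n uv in mark u v

    y : BitString
    -- The final `[]` gives the matrix of marks the form in which `bitAt-matrixBits` reads it.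
    y = tabulate (lookup A) ++ tabulate (lookup S) ++ matrixBits marks ++ []

    length-y : length y ≡ n + (n + (n * n * n + 0))
    length-y = trans (length-++ (tabulate (lookup A))) (cong₂ _+_ (length-tabulate (lookup A))
      (trans (length-++ (tabulate (lookup S))) (cong₂ _+_ (length-tabulate (lookup S))
        (trans (length-++ (matrixBits marks)) (cong (_+ 0) (length-matrixBits marks))))))

    n<w : n < length w
    n<w = ≤-trans (≤-trans (≤-reflexive (+-comm 1 n)) (m≤m+n (n + 1) (n * n)))
            (≤-trans (m≤m+n (digitStart n) (length ds)) (≤-reflexive (sym (length-instanceBits g ds))))

    y-short : length y ≤ eval certificateBound (length w)
    y-short = ≤-trans (≤-reflexive (trans length-y (lemma n))) (eval-mono certificateBound (<⇒≤ n<w))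
      where
      lemma : ∀ n → n + (n + (n * n * n + 0)) ≡ 0 + n * (2 + n * (0 + n * (1 + n * 0)))
      lemma = solve-∀

    A-bit : ∀ u → (bitAt y (toℕ u) ≡ᵇ 2) ≡ lookup A u
    A-bit u = trans (cong (_≡ᵇ 2) (bitAt-tabulate (lookup A) _ u)) (code-bit _)

    past-A : ∀ k → bitAt y (n + k) ≡ bitAt (tabulate (lookup S) ++ matrixBits marks ++ []) k
    past-A k = trans (cong (λ l → bitAt y (l + k)) (sym (length-tabulate (lookup A)))) (bitAt-++ (tabulate (lookup A)) _ k)

    S-bit : ∀ u → (bitAt y (n + toℕ u) ≡ᵇ 2) ≡ lookup S u
    S-bit u = trans (cong (_≡ᵇ 2) (trans (past-A (toℕ u)) (bitAt-tabulate (lookup S) _ u))) (code-bit _)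

    K-bit : ∀ u v x → bitAt y (n + n + ((toℕ u * n + toℕ v) * n + toℕ x)) ≡ code (mark u v x)
    K-bit u v x = trans (cong (bitAt y) (+-assoc n n k)) (trans (past-A (n + k))
      (trans (cong (λ l → bitAt (tabulate (lookup S) ++ matrixBits marks ++ []) (l + k)) (sym (length-tabulate (lookup S))))
      (trans (bitAt-++ (tabulate (lookup S)) _ k)
      (trans (cong (λ z → bitAt (matrixBits marks ++ []) (z * n + toℕ x))
               (trans (cong (_+ toℕ v) (*-comm (toℕ u) n)) (sym (toℕ-combine u v))))
      (trans (bitAt-matrixBits marks [] (combine u v) x)
             (cong (λ (u , v) → code (mark u v x)) (remQuot-combine u v)))))))
      where
      k : ℕ
      k = (toℕ u * n + toℕ v) * n + toℕ x

    accepted : T (anyTo (length w) λ n → ⟦ instance-φ ⟧ᶠ (w ∷ y ∷ []) (n ∷ []))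
    accepted = accept⁺ w y n<w
      (⇒T (header-reflects w y n) (header⁺ g ds (>-nonZero⁻¹ n {{nonempty i}}) (digits-positive (bound i) (positive i))))
      (⇒T (valid-reflects {w} {y} (λ u v → bit-reflects (bitAt-edge g ds u v)) (λ u → member-reflects (A-bit u))
            (λ u → member-reflects (S-bit u)) (λ u v x → bit-reflects (K-bit u v x))) valid)
      (⇒T (small-reflects g ds y S S-bit) (≤-trans few (≤-reflexive (sym (value-of-digits (bound i))))))
      where
      digits-positive : ∀ k → NonZero k → 0 < length (digits-of k)
      digits-positive k nz with digits-of k in eq
      ... | _ ∷ _ = z<s
      ... | []    = ⊥-elim (zero-bound k nz (trans (sym (value-of-digits k)) (cong value-of eq)))
        where
        zero-bound : ∀ k → NonZero k → k ≡ 0 → ⊥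
        zero-bound zero () _

  inNP : InNP (languageOf StrongGeodeticCoBipartite)
  inNP = (λ xs → ⟦ verifier ⟧ᵒ xs []) , out-polyTime verifier (λ _ → refl) , certificateBound , λ w → mk⇔ certify decide
    where
    certify : ∀ {w} → languageOf StrongGeodeticCoBipartite w →
              ∃[ y ] length y ≤ eval certificateBound (length w) × ⟦ verifier ⟧ᵒ (w ∷ y ∷ []) [] ≡ [ true ]
    certify ((i , cobip) , (S , geodetic , few) , refl) = y , y-short , cong [_] (Equivalence.to T-≡ accepted)
      where open Certificate i cobip S geodetic few
    decide : ∀ {w} → (∃[ y ] length y ≤ eval certificateBound (length w) × ⟦ verifier ⟧ᵒ (w ∷ y ∷ []) [] ≡ [ true ]) →
          languageOf StrongGeodeticCoBipartite w
    decide {w} (y , _ , e) =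
      let n , h , v , s = accept⁻ w y (Equivalence.from T-≡ (proj₁ (∷-injective e)))
      in certified⇒yes w y n h v s

theorem5 : NPComplete (languageOf (StrongGeodetic restrictedTo (λ i → CoBipartite (graph i))))
theorem5 = Membership.inNP , Hardness.npHard
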